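{- Let $(x_n)_{n\in\mathbb Z}$ be the sequence determined by independent indeterminates $x_0,x_1$ and, for all $n\in\mathbb Z$, $$x_{2n}x_{2n-2}=1+x_{2n-1},\qquad x_{2n+1}x_{2n-1}=1+x_{2n}^4 .$$ (1) Set $$y^{(0)}_1=\frac{1+x_1}{x_0^2},\quad y^{(0)}_2=\frac{x_0^4+(1+x_1)^2}{x_0^4x_1},\quad y^{(0)}_3=\frac{x_0^4+1+x_1}{x_0^2x_1},$$ $$y^{(1)}_1=\frac{x_2^4+1+x_1}{x_2^2x_1},\quad y^{(1)}_2=\frac{x_2^4+(1+x_1)^2}{x_2^4x_1},\quad y^{(1)}_3=\frac{1+x_1}{x_2^2}.$$ Then, as formal power series in $t$, $$\sum_{n\ge 0}x_{2n}t^n=\cfrac{x_0}{1-ty^{(0)}_1-\cfrac{t^2y^{(0)}_2}{1-ty^{(0)}_3}},\qquad \sum_{n\ge 0}x_{2n+2}t^n=\cfrac{x_2}{1-ty^{(1)}_1-\cfrac{t^2y^{(1)}_2}{1-ty^{(1)}_3}} .$$ (2) For all $n\ge 0$, $$x_{2n}=\sum_{q,\ell,r,s,m\ge 0}x_0^{1+4(q+\ell)-2n-4(r+s)}\,x_1^{m-q-\ell}\binom{n-q-\ell}{q-r,\,r}\binom{q+\ell-1}{\ell-s,\,s}\binom{n+2r+s-2q-\ell}{m},$$ $$x_{2n+2}=\sum_{q,\ell,r,s,m\ge 0}x_2^{1+2n-4(q+\ell+r+s)}\,x_1^{q+\ell+m-n}\binom{n-q-\ell}{q-r,\,r,\,s}\binom{q+\ell-1}{\ell}\binom{2r+s+\ell}{m}.$$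 (3) For every $n\ge 0$ the odd variable $x_{2n+1}=x_{2n}x_{2n+2}-1$ is a Laurent polynomial with non-negative integer coefficients in $(x_0,x_1)$, and also in $(x_1,x_2)$.
   Context: This is the rank 2 affine cluster algebra recursion (with trivial coefficients) of type $(b,c)=(1,4)$. All $x_n$ are elements of the field of rational functions in $x_0,x_1$, equivalently in $x_1,x_2$, since $x_0x_2=1+x_1$. Multinomial convention: $\binom{N}{m_1,\dots,m_k}=\frac{N!}{m_1!\cdots m_k!\,(N-\sum_i m_i)!}$ if all $m_i\ge 0$ and $\sum_i m_i\le N$, and it is $0$ otherwise, with the single exception $\binom{ -1}{0,\dots,0}=1$. The case $k=1$ is the ordinary binomial coefficient. -}

module Defs where

open import Algebra.Bundles using (CommutativeRing; Semiring)
open import Algebra.Structures using (IsCommutativeRing)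
import Algebra.Definitions.RawSemiring as RawSemiringDefinitions
import Algebra.Properties.Ring as RingProperties
open import Data.Integer.Base as ℤ using (ℤ; +_; -[1+_]; 0ℤ; -1ℤ)
import Data.Integer.Properties as ℤ
open import Data.List.Base as List using (List; []; _∷_)
open import Data.List.Membership.Propositional using (_∉_)
open import Data.List.Relation.Unary.All using (all?)
open import Data.List.Relation.Unary.Unique.Propositional using (Unique)
open import Data.Nat.Base as ℕ using (ℕ; zero; suc; _!)
import Data.Nat.Properties as ℕ
open import Data.Product.Base using (_×_; _,_; ∃-syntax)
open import Data.Sum.Base using ([_,_]′)
open import Level using (Level; _⊔_; 0ℓ)
open import Relation.Binary.Bundles using (Setoid)
open import Relation.Binary.Definitions using (Decidable)
import Relation.Binary.Reasoning.Setoid as SetoidReasoning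
open import Relation.Nullary using (¬_; Dec; yes; no; contradiction; _×-dec_)
import Relation.Nullary.Decidable as Dec

private
  variable
    c ℓ : Level

record DecidableDomain c ℓ : Set (Level.suc (c ⊔ ℓ)) where
  infix 4 _≟_
  field
    commutativeRing : CommutativeRing c ℓ

  open CommutativeRing commutativeRing public

  field
    _≟_       : Decidable _≈_
    1≉0       : ¬ 1# ≈ 0#
    xy≈0⇒y≈0  : ∀ {x y} → ¬ x ≈ 0# → x * y ≈ 0# → y ≈ 0#

record DecidableField c ℓ : Set (Level.suc (c ⊔ ℓ)) where
  infix 8 _⁻¹
  infix 4 _≟_
  field
    commutativeRing : CommutativeRing c ℓ

  open CommutativeRing commutativeRing public

  -- The inverse is total; its value at 0 is the junk value 0.
  field
    _≟_         : Decidable _≈_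
    1≉0         : ¬ 1# ≈ 0#
    _⁻¹         : Carrier → Carrier
    ⁻¹-cong     : ∀ {x y} → x ≈ y → x ⁻¹ ≈ y ⁻¹
    ⁻¹-inverseʳ : ∀ {x} → ¬ x ≈ 0# → x * x ⁻¹ ≈ 1#
    0⁻¹≈0       : 0# ⁻¹ ≈ 0#

  open RawSemiringDefinitions (Semiring.rawSemiring semiring) public
    using (_^_) renaming (_×_ to _•_)

  infixl 7 _÷_
  infixr 8 _^ᶻ_

  _÷_ : Carrier → Carrier → Carrier
  x ÷ y = x * y ⁻¹

  _^ᶻ_ : Carrier → ℤ → Carrier
  x ^ᶻ (+ n)    = x ^ n
  x ^ᶻ -[1+ n ] = (x ⁻¹) ^ suc n

private
  module RingIdentities (R : CommutativeRing c ℓ) where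
    open CommutativeRing R
    open import Algebra.Solver.Ring.NaturalCoefficients.Default commutativeSemiring

    +-medial : ∀ a b c d → (a + b) + (c + d) ≈ (a + c) + (b + d)
    +-medial = solve 4 (λ a b c d →
        (a :+ b) :+ (c :+ d) := (a :+ c) :+ (b :+ d)) refl

    transitivity₁ : ∀ d a y → d * (a * y) ≈ (a * d) * y
    transitivity₁ = solve 3 (λ d a y →
        d :* (a :* y) := (a :* d) :* y) refl

    transitivity₂ : ∀ c b y → (c * b) * y ≈ (c * y) * b
    transitivity₂ = solve 3 (λ c b y →
        (c :* b) :* y := (c :* y) :* b) refl

    transitivity₃ : ∀ x d b → (x * d) * b ≈ d * (x * b)
    transitivity₃ = solve 3 (λ x d b →
        (x :* d) :* b := d :* (x :* b)) refl

    +-cong₁ : ∀ a b c d b′ d′ →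
        (a * d + c * b) * (b′ * d′) ≈ (a * b′) * (d * d′) + (c * d′) * (b * b′)
    +-cong₁ = solve 6 (λ a b c d b′ d′ →
        (a :* d :+ c :* b) :* (b′ :* d′) := (a :* b′) :* (d :* d′) :+ (c :* d′) :* (b :* b′)) refl

    +-cong₂ : ∀ a′ b c′ d b′ d′ →
        (a′ * b) * (d * d′) + (c′ * d) * (b * b′) ≈ (a′ * d′ + c′ * b′) * (b * d)
    +-cong₂ = solve 6 (λ a′ b c′ d b′ d′ →
        (a′ :* b) :* (d :* d′) :+ (c′ :* d) :* (b :* b′) := (a′ :* d′ :+ c′ :* b′) :* (b :* d)) refl

    *-medial : ∀ a c b d → (a * c) * (b * d) ≈ (a * b) * (c * d)
    *-medial = solve 4 (λ a c b d →
        (a :* c) :* (b :* d) := (a :* b) :* (c :* d)) refl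

    +-assoc-frac : ∀ a b c d x y →
        ((a * d + c * b) * y + x * (b * d)) * (b * (d * y)) ≈
        (a * (d * y) + (c * y + x * d) * b) * ((b * d) * y)
    +-assoc-frac = solve 6 (λ a b c d x y →
        ((a :* d :+ c :* b) :* y :+ x :* (b :* d)) :* (b :* (d :* y)) := (a :* (d :* y) :+ (c :* y :+ x :* d) :* b) :* ((b :* d) :* y)) refl

    +-comm-frac : ∀ a b c d → (a * d + c * b) * (d * b) ≈ (c * b + a * d) * (b * d)
    +-comm-frac = solve 4 (λ a b c d →
        (a :* d :+ c :* b) :* (d :* b) := (c :* b :+ a :* d) :* (b :* d)) refl

    +-identity-frac : ∀ a b → (0# * b + a * 1#) * b ≈ a * (1# * b)
    +-identity-frac = solve 2 (λ a b →
        (con 0 :* b :+ a :* con 1) :* b := a :* (con 1 :* b)) refl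

    *-assoc-frac : ∀ a b c d x y →
        ((a * c) * x) * (b * (d * y)) ≈ (a * (c * x)) * ((b * d) * y)
    *-assoc-frac = solve 6 (λ a b c d x y →
        ((a :* c) :* x) :* (b :* (d :* y)) := (a :* (c :* x)) :* ((b :* d) :* y)) refl

    *-comm-frac : ∀ a b c d → (a * c) * (d * b) ≈ (c * a) * (b * d)
    *-comm-frac = solve 4 (λ a b c d →
        (a :* c) :* (d :* b) := (c :* a) :* (b :* d)) refl

    *-identity-frac : ∀ a b → (1# * a) * b ≈ a * (1# * b)
    *-identity-frac = solve 2 (λ a b →
        (con 1 :* a) :* b := a :* (con 1 :* b)) refl

    distrib-frac : ∀ a b c d x y →
        (a * (c * y + x * d)) * ((b * d) * (b * y)) ≈
        ((a * c) * (b * y) + (a * x) * (b * d)) * (b * (d * y))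
    distrib-frac = solve 6 (λ a b c d x y →
        (a :* (c :* y :+ x :* d)) :* ((b :* d) :* (b :* y)) := ((a :* c) :* (b :* y) :+ (a :* x) :* (b :* d)) :* (b :* (d :* y))) refl

    inverse-frac : ∀ a b → (a * b) * 1# ≈ 1# * (b * a)
    inverse-frac = solve 2 (λ a b →
        (a :* b) :* con 1 := con 1 :* (b :* a)) refl

    xz*y≈x*yz : ∀ x y z → (x * z) * y ≈ x * (y * z)
    xz*y≈x*yz = solve 3 (λ x y z →
        (x :* z) :* y := x :* (y :* z)) refl

module Polynomial (D : DecidableDomain c ℓ) where
  open DecidableDomain D
  private module Identities = RingIdentities commutativeRing
  open RingProperties ring using (-0#≈0#)

  private
    module ≈-Reasoning = SetoidReasoning setoid


  -- Lists of coefficients, constant term first.  Trailing zeros are allowed,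
  -- so equality of polynomials is equality of all coefficients.
  Poly : Set c
  Poly = List Carrier

  coeff : Poly → ℕ → Carrier
  coeff []      _       = 0#
  coeff (a ∷ p) zero    = a
  coeff (a ∷ p) (suc n) = coeff p n

  infix 4 _≈ₚ_
  record _≈ₚ_ (p q : Poly) : Set ℓ where
    constructor mk≈
    field at : ∀ n → coeff p n ≈ coeff q n
  open _≈ₚ_ public

  infixl 6 _+ₚ_
  infixl 7 _·ₚ_ _*ₚ_

  _+ₚ_ : Poly → Poly → Poly
  []      +ₚ q       = q
  (a ∷ p) +ₚ []      = a ∷ p
  (a ∷ p) +ₚ (b ∷ q) = a + b ∷ p +ₚ q

  -ₚ_ : Poly → Poly
  -ₚ_ = List.map (-_)

  _·ₚ_ : Carrier → Poly → Poly
  a ·ₚ p = List.map (a *_) p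

  _*ₚ_ : Poly → Poly → Poly
  []      *ₚ q = []
  (a ∷ p) *ₚ q = a ·ₚ q +ₚ (0# ∷ p *ₚ q)

  0ₚ 1ₚ X : Poly
  0ₚ = []
  1ₚ = 1# ∷ []
  X  = 0# ∷ 1# ∷ []

  const : Carrier → Poly
  const a = a ∷ []

  coeff-+ : ∀ p q n → coeff (p +ₚ q) n ≈ coeff p n + coeff q n
  coeff-+ []      q       n       = sym (+-identityˡ _)
  coeff-+ (a ∷ p) []      n       = sym (+-identityʳ _)
  coeff-+ (a ∷ p) (b ∷ q) zero    = refl
  coeff-+ (a ∷ p) (b ∷ q) (suc n) = coeff-+ p q n

  coeff-· : ∀ a p n → coeff (a ·ₚ p) n ≈ a * coeff p n
  coeff-· a []      n       = sym (zeroʳ a)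
  coeff-· a (b ∷ p) zero    = refl
  coeff-· a (b ∷ p) (suc n) = coeff-· a p n

  coeff-neg : ∀ p n → coeff (-ₚ p) n ≈ - coeff p n
  coeff-neg []      n       = sym -0#≈0#
  coeff-neg (a ∷ p) zero    = refl
  coeff-neg (a ∷ p) (suc n) = coeff-neg p n

  ≈ₚ-refl : ∀ {p} → p ≈ₚ p
  ≈ₚ-refl = mk≈ λ n → refl

  ≈ₚ-sym : ∀ {p q} → p ≈ₚ q → q ≈ₚ p
  ≈ₚ-sym e = mk≈ λ n → sym (at e n)

  ≈ₚ-trans : ∀ {p q r} → p ≈ₚ q → q ≈ₚ r → p ≈ₚ r
  ≈ₚ-trans e f = mk≈ λ n → trans (at e n) (at f n)

  ∷-cong : ∀ {a b p q} → a ≈ b → p ≈ₚ q → a ∷ p ≈ₚ b ∷ q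
  ∷-cong a≈b p≈q = mk≈ λ { zero → a≈b ; (suc n) → at p≈q n }

  ∷-tail : ∀ {a b p q} → a ∷ p ≈ₚ b ∷ q → p ≈ₚ q
  ∷-tail e = mk≈ λ n → at e (suc n)

  0∷0 : ∀ {a p} → a ≈ 0# → p ≈ₚ [] → a ∷ p ≈ₚ []
  0∷0 a≈0 p≈0 = mk≈ λ { zero → a≈0 ; (suc n) → at p≈0 n }

  0∷0-tail : ∀ {a p} → a ∷ p ≈ₚ [] → p ≈ₚ []
  0∷0-tail e = mk≈ λ n → at e (suc n)

  +ₚ-cong : ∀ {p p′ q q′} → p ≈ₚ p′ → q ≈ₚ q′ → p +ₚ q ≈ₚ p′ +ₚ q′
  +ₚ-cong {p} {p′} {q} {q′} e f = mk≈ λ n → begin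
    coeff (p +ₚ q) n          ≈⟨ coeff-+ p q n ⟩
    coeff p n + coeff q n     ≈⟨ +-cong (at e n) (at f n) ⟩
    coeff p′ n + coeff q′ n   ≈⟨ coeff-+ p′ q′ n ⟨
    coeff (p′ +ₚ q′) n        ∎
    where open ≈-Reasoning

  +ₚ-assoc : ∀ p q r → (p +ₚ q) +ₚ r ≈ₚ p +ₚ (q +ₚ r)
  +ₚ-assoc p q r = mk≈ λ n → begin
    coeff ((p +ₚ q) +ₚ r) n                ≈⟨ coeff-+ (p +ₚ q) r n ⟩
    coeff (p +ₚ q) n + coeff r n           ≈⟨ +-congʳ (coeff-+ p q n) ⟩
    (coeff p n + coeff q n) + coeff r n    ≈⟨ +-assoc _ _ _ ⟩
    coeff p n + (coeff q n + coeff r n)    ≈⟨ +-congˡ (coeff-+ q r n) ⟨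
    coeff p n + coeff (q +ₚ r) n           ≈⟨ coeff-+ p (q +ₚ r) n ⟨
    coeff (p +ₚ (q +ₚ r)) n                ∎
    where open ≈-Reasoning

  +ₚ-comm : ∀ p q → p +ₚ q ≈ₚ q +ₚ p
  +ₚ-comm p q = mk≈ λ n → begin
    coeff (p +ₚ q) n        ≈⟨ coeff-+ p q n ⟩
    coeff p n + coeff q n   ≈⟨ +-comm _ _ ⟩
    coeff q n + coeff p n   ≈⟨ coeff-+ q p n ⟨
    coeff (q +ₚ p) n        ∎
    where open ≈-Reasoning

  +ₚ-identityʳ : ∀ p → p +ₚ [] ≈ₚ p
  +ₚ-identityʳ p = +ₚ-comm p []

  -ₚ-cong : ∀ {p q} → p ≈ₚ q → -ₚ p ≈ₚ -ₚ q
  -ₚ-cong {p} {q} e = mk≈ λ n →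
    trans (coeff-neg p n) (trans (-‿cong (at e n)) (sym (coeff-neg q n)))

  -ₚ-inverseʳ : ∀ p → p +ₚ (-ₚ p) ≈ₚ []
  -ₚ-inverseʳ p = mk≈ λ n → begin
    coeff (p +ₚ (-ₚ p)) n       ≈⟨ coeff-+ p (-ₚ p) n ⟩
    coeff p n + coeff (-ₚ p) n  ≈⟨ +-congˡ (coeff-neg p n) ⟩
    coeff p n - coeff p n       ≈⟨ -‿inverseʳ _ ⟩
    0#                          ∎
    where open ≈-Reasoning

  interchange : ∀ p q r s → (p +ₚ q) +ₚ (r +ₚ s) ≈ₚ (p +ₚ r) +ₚ (q +ₚ s)
  interchange p q r s = mk≈ λ n → begin
    coeff ((p +ₚ q) +ₚ (r +ₚ s)) n
      ≈⟨ expand p q r s n ⟩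
    (coeff p n + coeff q n) + (coeff r n + coeff s n)
      ≈⟨ Identities.+-medial (coeff p n) (coeff q n) (coeff r n) (coeff s n) ⟩
    (coeff p n + coeff r n) + (coeff q n + coeff s n)
      ≈⟨ expand p r q s n ⟨
    coeff ((p +ₚ r) +ₚ (q +ₚ s)) n ∎
    where
    open ≈-Reasoning
    expand : ∀ p q r s n → coeff ((p +ₚ q) +ₚ (r +ₚ s)) n ≈
                           (coeff p n + coeff q n) + (coeff r n + coeff s n)
    expand p q r s n = trans (coeff-+ (p +ₚ q) (r +ₚ s) n)
                             (+-cong (coeff-+ p q n) (coeff-+ r s n))

  ·ₚ-cong : ∀ {a b p q} → a ≈ b → p ≈ₚ q → a ·ₚ p ≈ₚ b ·ₚ q
  ·ₚ-cong {a} {b} {p} {q} e f = mk≈ λ n →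
    trans (coeff-· a p n) (trans (*-cong e (at f n)) (sym (coeff-· b q n)))

  ·ₚ-zeroˡ : ∀ {a} p → a ≈ 0# → a ·ₚ p ≈ₚ []
  ·ₚ-zeroˡ {a} p a≈0 = mk≈ λ n →
    trans (coeff-· a p n) (trans (*-congʳ a≈0) (zeroˡ _))

  ·ₚ-identity : ∀ p → 1# ·ₚ p ≈ₚ p
  ·ₚ-identity p = mk≈ λ n → trans (coeff-· 1# p n) (*-identityˡ _)

  ·ₚ-distribˡ : ∀ a p q → a ·ₚ (p +ₚ q) ≈ₚ a ·ₚ p +ₚ a ·ₚ q
  ·ₚ-distribˡ a p q = mk≈ λ n → begin
    coeff (a ·ₚ (p +ₚ q)) n                  ≈⟨ coeff-· a (p +ₚ q) n ⟩
    a * coeff (p +ₚ q) n                     ≈⟨ *-congˡ (coeff-+ p q n) ⟩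
    a * (coeff p n + coeff q n)              ≈⟨ distribˡ _ _ _ ⟩
    a * coeff p n + a * coeff q n            ≈⟨ +-cong (coeff-· a p n) (coeff-· a q n) ⟨
    coeff (a ·ₚ p) n + coeff (a ·ₚ q) n      ≈⟨ coeff-+ (a ·ₚ p) (a ·ₚ q) n ⟨
    coeff (a ·ₚ p +ₚ a ·ₚ q) n               ∎
    where open ≈-Reasoning

  ·ₚ-assoc : ∀ a b p → (a * b) ·ₚ p ≈ₚ a ·ₚ (b ·ₚ p)
  ·ₚ-assoc a b p = mk≈ λ n → begin
    coeff ((a * b) ·ₚ p) n     ≈⟨ coeff-· (a * b) p n ⟩
    (a * b) * coeff p n        ≈⟨ *-assoc _ _ _ ⟩
    a * (b * coeff p n)        ≈⟨ *-congˡ (coeff-· b p n) ⟨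
    a * coeff (b ·ₚ p) n       ≈⟨ coeff-· a (b ·ₚ p) n ⟨
    coeff (a ·ₚ (b ·ₚ p)) n    ∎
    where open ≈-Reasoning

  ·ₚ-∷0 : ∀ a p → a ·ₚ (0# ∷ p) ≈ₚ 0# ∷ a ·ₚ p
  ·ₚ-∷0 a p = ∷-cong (zeroʳ a) ≈ₚ-refl

  private
    polySetoid : Setoid c ℓ
    polySetoid = record
      { Carrier = Poly ; _≈_ = _≈ₚ_
      ; isEquivalence = record { refl = ≈ₚ-refl ; sym = ≈ₚ-sym ; trans = ≈ₚ-trans }
      }
    module ≈ₚ-Reasoning = SetoidReasoning polySetoid

  *ₚ-congˡ : ∀ p {q r} → q ≈ₚ r → p *ₚ q ≈ₚ p *ₚ r
  *ₚ-congˡ []      e = ≈ₚ-refl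
  *ₚ-congˡ (a ∷ p) e = +ₚ-cong (·ₚ-cong refl e) (∷-cong refl (*ₚ-congˡ p e))

  *ₚ-zeroʳ : ∀ p → p *ₚ [] ≈ₚ []
  *ₚ-zeroʳ []      = ≈ₚ-refl
  *ₚ-zeroʳ (a ∷ p) = 0∷0 refl (*ₚ-zeroʳ p)

  *ₚ-∷ : ∀ p b q → p *ₚ (b ∷ q) ≈ₚ b ·ₚ p +ₚ (0# ∷ p *ₚ q)
  *ₚ-∷ []      b q = ≈ₚ-sym (0∷0 refl ≈ₚ-refl)
  *ₚ-∷ (a ∷ p) b q = ∷-cong (+-congʳ (*-comm a b)) (begin
    a ·ₚ q +ₚ p *ₚ (b ∷ q)                      ≈⟨ +ₚ-cong ≈ₚ-refl (*ₚ-∷ p b q) ⟩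
    a ·ₚ q +ₚ (b ·ₚ p +ₚ (0# ∷ p *ₚ q))         ≈⟨ +ₚ-assoc (a ·ₚ q) (b ·ₚ p) _ ⟨
    (a ·ₚ q +ₚ b ·ₚ p) +ₚ (0# ∷ p *ₚ q)         ≈⟨ +ₚ-cong (+ₚ-comm (a ·ₚ q) (b ·ₚ p)) ≈ₚ-refl ⟩
    (b ·ₚ p +ₚ a ·ₚ q) +ₚ (0# ∷ p *ₚ q)         ≈⟨ +ₚ-assoc (b ·ₚ p) (a ·ₚ q) _ ⟩
    b ·ₚ p +ₚ (a ·ₚ q +ₚ (0# ∷ p *ₚ q))         ∎)
    where open ≈ₚ-Reasoning

  *ₚ-comm : ∀ p q → p *ₚ q ≈ₚ q *ₚ p
  *ₚ-comm []      q = ≈ₚ-sym (*ₚ-zeroʳ q)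
  *ₚ-comm (a ∷ p) q = begin
    a ·ₚ q +ₚ (0# ∷ p *ₚ q)   ≈⟨ +ₚ-cong ≈ₚ-refl (∷-cong refl (*ₚ-comm p q)) ⟩
    a ·ₚ q +ₚ (0# ∷ q *ₚ p)   ≈⟨ *ₚ-∷ q a p ⟨
    q *ₚ (a ∷ p)              ∎
    where open ≈ₚ-Reasoning

  *ₚ-cong : ∀ {p p′ q q′} → p ≈ₚ p′ → q ≈ₚ q′ → p *ₚ q ≈ₚ p′ *ₚ q′
  *ₚ-cong {p} {p′} {q} {q′} e f = begin
    p *ₚ q     ≈⟨ *ₚ-congˡ p f ⟩
    p *ₚ q′    ≈⟨ *ₚ-comm p q′ ⟩
    q′ *ₚ p    ≈⟨ *ₚ-congˡ q′ e ⟩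
    q′ *ₚ p′   ≈⟨ *ₚ-comm q′ p′ ⟩
    p′ *ₚ q′   ∎
    where open ≈ₚ-Reasoning

  *ₚ-distribˡ : ∀ p q r → p *ₚ (q +ₚ r) ≈ₚ p *ₚ q +ₚ p *ₚ r
  *ₚ-distribˡ []      q r = ≈ₚ-refl
  *ₚ-distribˡ (a ∷ p) q r = begin
    a ·ₚ (q +ₚ r) +ₚ (0# ∷ p *ₚ (q +ₚ r))
      ≈⟨ +ₚ-cong (·ₚ-distribˡ a q r)
                 (∷-cong (sym (+-identityˡ 0#)) (*ₚ-distribˡ p q r)) ⟩
    (a ·ₚ q +ₚ a ·ₚ r) +ₚ ((0# ∷ p *ₚ q) +ₚ (0# ∷ p *ₚ r))
      ≈⟨ interchange (a ·ₚ q) (a ·ₚ r) (0# ∷ p *ₚ q) (0# ∷ p *ₚ r) ⟩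
    (a ·ₚ q +ₚ (0# ∷ p *ₚ q)) +ₚ (a ·ₚ r +ₚ (0# ∷ p *ₚ r)) ∎
    where open ≈ₚ-Reasoning

  *ₚ-distribʳ : ∀ p q r → (q +ₚ r) *ₚ p ≈ₚ q *ₚ p +ₚ r *ₚ p
  *ₚ-distribʳ p q r = begin
    (q +ₚ r) *ₚ p        ≈⟨ *ₚ-comm (q +ₚ r) p ⟩
    p *ₚ (q +ₚ r)        ≈⟨ *ₚ-distribˡ p q r ⟩
    p *ₚ q +ₚ p *ₚ r     ≈⟨ +ₚ-cong (*ₚ-comm p q) (*ₚ-comm p r) ⟩
    q *ₚ p +ₚ r *ₚ p     ∎
    where open ≈ₚ-Reasoning

  0∷-*ₚ : ∀ {a} p q → a ≈ 0# → (a ∷ p) *ₚ q ≈ₚ 0# ∷ p *ₚ q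
  0∷-*ₚ p q a≈0 = +ₚ-cong {q = 0# ∷ p *ₚ q} (·ₚ-zeroˡ q a≈0) ≈ₚ-refl

  ·ₚ-*ₚ : ∀ a p q → (a ·ₚ p) *ₚ q ≈ₚ a ·ₚ (p *ₚ q)
  ·ₚ-*ₚ a []      q = ≈ₚ-refl
  ·ₚ-*ₚ a (b ∷ p) q = begin
    (a * b) ·ₚ q +ₚ (0# ∷ (a ·ₚ p) *ₚ q)
      ≈⟨ +ₚ-cong (·ₚ-assoc a b q) (∷-cong refl (·ₚ-*ₚ a p q)) ⟩
    a ·ₚ (b ·ₚ q) +ₚ (0# ∷ a ·ₚ (p *ₚ q))
      ≈⟨ +ₚ-cong ≈ₚ-refl (·ₚ-∷0 a (p *ₚ q)) ⟨
    a ·ₚ (b ·ₚ q) +ₚ a ·ₚ (0# ∷ p *ₚ q)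
      ≈⟨ ·ₚ-distribˡ a (b ·ₚ q) (0# ∷ p *ₚ q) ⟨
    a ·ₚ (b ·ₚ q +ₚ (0# ∷ p *ₚ q)) ∎
    where open ≈ₚ-Reasoning

  *ₚ-assoc : ∀ p q r → (p *ₚ q) *ₚ r ≈ₚ p *ₚ (q *ₚ r)
  *ₚ-assoc []      q r = ≈ₚ-refl
  *ₚ-assoc (a ∷ p) q r = begin
    (a ·ₚ q +ₚ (0# ∷ p *ₚ q)) *ₚ r
      ≈⟨ *ₚ-distribʳ r (a ·ₚ q) (0# ∷ p *ₚ q) ⟩
    (a ·ₚ q) *ₚ r +ₚ (0# ∷ p *ₚ q) *ₚ r
      ≈⟨ +ₚ-cong (·ₚ-*ₚ a q r) (0∷-*ₚ (p *ₚ q) r refl) ⟩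
    a ·ₚ (q *ₚ r) +ₚ (0# ∷ (p *ₚ q) *ₚ r)
      ≈⟨ +ₚ-cong ≈ₚ-refl (∷-cong refl (*ₚ-assoc p q r)) ⟩
    a ·ₚ (q *ₚ r) +ₚ (0# ∷ p *ₚ (q *ₚ r)) ∎
    where open ≈ₚ-Reasoning

  *ₚ-identityˡ : ∀ p → 1ₚ *ₚ p ≈ₚ p
  *ₚ-identityˡ p = begin
    1# ·ₚ p +ₚ (0# ∷ [])   ≈⟨ +ₚ-cong (·ₚ-identity p) (0∷0 refl ≈ₚ-refl) ⟩
    p +ₚ []                ≈⟨ +ₚ-identityʳ p ⟩
    p                      ∎
    where open ≈ₚ-Reasoning

  ₚ-isCommutativeRing : IsCommutativeRing _≈ₚ_ _+ₚ_ _*ₚ_ -ₚ_ 0ₚ 1ₚ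
  ₚ-isCommutativeRing = record
    { isRing = record
      { +-isAbelianGroup = record
        { isGroup = record
          { isMonoid = record
            { isSemigroup = record
              { isMagma = record
                { isEquivalence = record { refl = ≈ₚ-refl ; sym = ≈ₚ-sym ; trans = ≈ₚ-trans }
                ; ∙-cong = +ₚ-cong
                }
              ; assoc = +ₚ-assoc
              }
            ; identity = (λ p → ≈ₚ-refl) , +ₚ-identityʳ
            }
          ; inverse = (λ p → ≈ₚ-trans (+ₚ-comm (-ₚ p) p) (-ₚ-inverseʳ p)) , -ₚ-inverseʳ
          ; ⁻¹-cong = -ₚ-cong
          }
        ; comm = +ₚ-comm
        }
      ; *-cong = *ₚ-cong
      ; *-assoc = *ₚ-assoc
      ; *-identity = *ₚ-identityˡ
                   , λ p → ≈ₚ-trans (*ₚ-comm p 1ₚ) (*ₚ-identityˡ p)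
      ; distrib = *ₚ-distribˡ , *ₚ-distribʳ
      }
    ; *-comm = *ₚ-comm
    }

  ≈0? : ∀ p → Dec (p ≈ₚ [])
  ≈0? []      = yes ≈ₚ-refl
  ≈0? (a ∷ p) = Dec.map′ (λ (a≈0 , p≈0) → 0∷0 a≈0 p≈0)
                         (λ e → at e 0 , 0∷0-tail e)
                         ((a ≟ 0#) ×-dec ≈0? p)

  infix 4 _≟ₚ_
  _≟ₚ_ : Decidable _≈ₚ_
  []      ≟ₚ q       = Dec.map′ ≈ₚ-sym ≈ₚ-sym (≈0? q)
  (a ∷ p) ≟ₚ []      = ≈0? (a ∷ p)
  (a ∷ p) ≟ₚ (b ∷ q) = Dec.map′ (λ (a≈b , p≈q) → ∷-cong a≈b p≈q)
                                (λ e → at e 0 , ∷-tail e)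
                                ((a ≟ b) ×-dec (p ≟ₚ q))

  noZeroDivisors : ∀ p q → ¬ p ≈ₚ [] → p *ₚ q ≈ₚ [] → q ≈ₚ []
  noZeroDivisors []      q       p≉0 _ = contradiction ≈ₚ-refl p≉0
  noZeroDivisors (a ∷ p) q       p≉0 e with a ≟ 0#
  noZeroDivisors (a ∷ p) q       p≉0 e | yes a≈0 =
    noZeroDivisors p q (λ p≈0 → p≉0 (0∷0 a≈0 p≈0))
      (0∷0-tail (≈ₚ-trans (≈ₚ-sym (0∷-*ₚ p q a≈0)) e))
  noZeroDivisors (a ∷ p) q       p≉0 e | no a≉0 = go q e
    where
    go : ∀ q → (a ∷ p) *ₚ q ≈ₚ [] → q ≈ₚ []
    go []      e = ≈ₚ-refl
    go (b ∷ q) e = 0∷0 b≈0 (go q (0∷0-tail (begin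
      0# ∷ (a ∷ p) *ₚ q
        ≈⟨ +ₚ-cong {q = 0# ∷ (a ∷ p) *ₚ q} (·ₚ-zeroˡ (a ∷ p) b≈0) ≈ₚ-refl ⟨
      b ·ₚ (a ∷ p) +ₚ (0# ∷ (a ∷ p) *ₚ q)
        ≈⟨ *ₚ-∷ (a ∷ p) b q ⟨
      (a ∷ p) *ₚ (b ∷ q)
        ≈⟨ e ⟩
      [] ∎)))
      where
      open ≈ₚ-Reasoning
      b≈0 : b ≈ 0#
      b≈0 = xy≈0⇒y≈0 a≉0 (trans (sym (+-identityʳ (a * b))) (at e 0))

  domain : DecidableDomain c ℓ
  domain = record
    { commutativeRing = record { isCommutativeRing = ₚ-isCommutativeRing }
    ; _≟_ = _≟ₚ_
    ; 1≉0 = λ e → 1≉0 (at e 0)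
    ; xy≈0⇒y≈0 = λ {p} {q} → noZeroDivisors p q
    }

module Fractions (D : DecidableDomain c ℓ) where
  open DecidableDomain D
  private module Identities = RingIdentities commutativeRing
  open RingProperties ring using (x∙y⁻¹≈ε⇒x≈y; x[y-z]≈xy-xz; -‿distribˡ-*)
  open SetoidReasoning setoid

  record Frac : Set (c ⊔ ℓ) where
    constructor frac
    field
      num   : Carrier
      den   : Carrier
      den≉0 : ¬ den ≈ 0#
  open Frac public

  infix 4 _≈ᶠ_
  record _≈ᶠ_ (u v : Frac) : Set ℓ where
    constructor mk≈
    field cross : num u * den v ≈ num v * den u
  open _≈ᶠ_ public

  *-nonZero : ∀ {x y} → ¬ x ≈ 0# → ¬ y ≈ 0# → ¬ x * y ≈ 0#
  *-nonZero x≉0 y≉0 xy≈0 = y≉0 (xy≈0⇒y≈0 x≉0 xy≈0)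

  *-cancelˡ : ∀ x y z → ¬ x ≈ 0# → x * y ≈ x * z → y ≈ z
  *-cancelˡ x y z x≉0 e = x∙y⁻¹≈ε⇒x≈y y z (xy≈0⇒y≈0 x≉0 (begin
    x * (y - z)       ≈⟨ x[y-z]≈xy-xz x y z ⟩
    x * y - x * z     ≈⟨ +-congʳ e ⟩
    x * z - x * z     ≈⟨ -‿inverseʳ _ ⟩
    0#                ∎))

  infixl 6 _+ᶠ_
  infixl 7 _*ᶠ_

  _+ᶠ_ _*ᶠ_ : Frac → Frac → Frac
  frac a b b≉0 +ᶠ frac c d d≉0 = frac (a * d + c * b) (b * d) (*-nonZero b≉0 d≉0)
  frac a b b≉0 *ᶠ frac c d d≉0 = frac (a * c) (b * d) (*-nonZero b≉0 d≉0)

  -ᶠ_ : Frac → Frac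
  -ᶠ frac a b b≉0 = frac (- a) b b≉0

  embed : Carrier → Frac
  embed a = frac a 1# 1≉0

  0ᶠ 1ᶠ : Frac
  0ᶠ = embed 0#
  1ᶠ = embed 1#

  _⁻¹ᶠ : Frac → Frac
  frac a b _ ⁻¹ᶠ with a ≟ 0#
  ... | yes _  = 0ᶠ
  ... | no a≉0 = frac b a a≉0

  ≈ᶠ-sym : ∀ {u v} → u ≈ᶠ v → v ≈ᶠ u
  ≈ᶠ-sym (mk≈ e) = mk≈ (sym e)

  ≈ᶠ-trans : ∀ {u v w} → u ≈ᶠ v → v ≈ᶠ w → u ≈ᶠ w
  ≈ᶠ-trans {frac a b _} {frac c d d≉0} {frac x y _} (mk≈ e) (mk≈ f) =
    mk≈ (*-cancelˡ d (a * y) (x * b) d≉0 (begin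
      d * (a * y)   ≈⟨ Identities.transitivity₁ d a y ⟩
      (a * d) * y   ≈⟨ *-congʳ e ⟩
      (c * b) * y   ≈⟨ Identities.transitivity₂ c b y ⟩
      (c * y) * b   ≈⟨ *-congʳ f ⟩
      (x * d) * b   ≈⟨ Identities.transitivity₃ x d b ⟩
      d * (x * b)   ∎))

  +ᶠ-cong : ∀ {u u′ v v′} → u ≈ᶠ u′ → v ≈ᶠ v′ → u +ᶠ v ≈ᶠ u′ +ᶠ v′
  +ᶠ-cong {frac a b _} {frac a′ b′ _} {frac c d _} {frac c′ d′ _} (mk≈ e) (mk≈ f) = mk≈ (begin
    (a * d + c * b) * (b′ * d′)                  ≈⟨ Identities.+-cong₁ a b c d b′ d′ ⟩
    (a * b′) * (d * d′) + (c * d′) * (b * b′)    ≈⟨ +-cong (*-congʳ e) (*-congʳ f) ⟩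
    (a′ * b) * (d * d′) + (c′ * d) * (b * b′)    ≈⟨ Identities.+-cong₂ a′ b c′ d b′ d′ ⟩
    (a′ * d′ + c′ * b′) * (b * d)                ∎)

  *ᶠ-cong : ∀ {u u′ v v′} → u ≈ᶠ u′ → v ≈ᶠ v′ → u *ᶠ v ≈ᶠ u′ *ᶠ v′
  *ᶠ-cong {frac a b _} {frac a′ b′ _} {frac c d _} {frac c′ d′ _} (mk≈ e) (mk≈ f) = mk≈ (begin
    (a * c) * (b′ * d′)      ≈⟨ Identities.*-medial a c b′ d′ ⟩
    (a * b′) * (c * d′)      ≈⟨ *-cong e f ⟩
    (a′ * b) * (c′ * d)      ≈⟨ Identities.*-medial a′ c′ b d ⟨
    (a′ * c′) * (b * d)      ∎)

  -ᶠ-cong : ∀ {u v} → u ≈ᶠ v → -ᶠ u ≈ᶠ -ᶠ v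
  -ᶠ-cong {frac a b _} {frac c d _} (mk≈ e) = mk≈ (begin
    - a * d     ≈⟨ -‿distribˡ-* a d ⟨
    - (a * d)   ≈⟨ -‿cong e ⟩
    - (c * b)   ≈⟨ -‿distribˡ-* c b ⟩
    - c * b     ∎)

  +ᶠ-assoc : ∀ u v w → (u +ᶠ v) +ᶠ w ≈ᶠ u +ᶠ (v +ᶠ w)
  +ᶠ-assoc (frac a b _) (frac c d _) (frac x y _) = mk≈ (Identities.+-assoc-frac a b c d x y)

  +ᶠ-comm : ∀ u v → u +ᶠ v ≈ᶠ v +ᶠ u
  +ᶠ-comm (frac a b _) (frac c d _) = mk≈ (Identities.+-comm-frac a b c d)

  +ᶠ-identityˡ : ∀ u → 0ᶠ +ᶠ u ≈ᶠ u
  +ᶠ-identityˡ (frac a b _) = mk≈ (Identities.+-identity-frac a b)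

  -ᶠ-inverseˡ : ∀ u → (-ᶠ u) +ᶠ u ≈ᶠ 0ᶠ
  -ᶠ-inverseˡ (frac a b _) = mk≈ (begin
    (- a * b + a * b) * 1#   ≈⟨ *-congʳ (+-congʳ (-‿distribˡ-* a b)) ⟨
    (- (a * b) + a * b) * 1# ≈⟨ *-congʳ (-‿inverseˡ _) ⟩
    0# * 1#                  ≈⟨ zeroˡ _ ⟩
    0#                       ≈⟨ zeroˡ _ ⟨
    0# * (b * b)             ∎)

  *ᶠ-assoc : ∀ u v w → (u *ᶠ v) *ᶠ w ≈ᶠ u *ᶠ (v *ᶠ w)
  *ᶠ-assoc (frac a b _) (frac c d _) (frac x y _) = mk≈ (Identities.*-assoc-frac a b c d x y)

  *ᶠ-comm : ∀ u v → u *ᶠ v ≈ᶠ v *ᶠ u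
  *ᶠ-comm (frac a b _) (frac c d _) = mk≈ (Identities.*-comm-frac a b c d)

  *ᶠ-identityˡ : ∀ u → 1ᶠ *ᶠ u ≈ᶠ u
  *ᶠ-identityˡ (frac a b _) = mk≈ (Identities.*-identity-frac a b)

  *ᶠ-distribˡ : ∀ u v w → u *ᶠ (v +ᶠ w) ≈ᶠ u *ᶠ v +ᶠ u *ᶠ w
  *ᶠ-distribˡ (frac a b _) (frac c d _) (frac x y _) = mk≈ (Identities.distrib-frac a b c d x y)

  *ᶠ-distribʳ : ∀ u v w → (v +ᶠ w) *ᶠ u ≈ᶠ v *ᶠ u +ᶠ w *ᶠ u
  *ᶠ-distribʳ u v w =
    ≈ᶠ-trans (*ᶠ-comm (v +ᶠ w) u)
      (≈ᶠ-trans (*ᶠ-distribˡ u v w) (+ᶠ-cong (*ᶠ-comm u v) (*ᶠ-comm u w)))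

  ᶠ-isCommutativeRing : IsCommutativeRing _≈ᶠ_ _+ᶠ_ _*ᶠ_ -ᶠ_ 0ᶠ 1ᶠ
  ᶠ-isCommutativeRing = record
    { isRing = record
      { +-isAbelianGroup = record
        { isGroup = record
          { isMonoid = record
            { isSemigroup = record
              { isMagma = record
                { isEquivalence = record { refl = mk≈ refl ; sym = ≈ᶠ-sym ; trans = ≈ᶠ-trans }
                ; ∙-cong = +ᶠ-cong
                }
              ; assoc = +ᶠ-assoc
              }
            ; identity = +ᶠ-identityˡ
                       , λ u → ≈ᶠ-trans (+ᶠ-comm u 0ᶠ) (+ᶠ-identityˡ u)
            }
          ; inverse = -ᶠ-inverseˡ
                    , λ u → ≈ᶠ-trans (+ᶠ-comm u (-ᶠ u)) (-ᶠ-inverseˡ u)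
          ; ⁻¹-cong = -ᶠ-cong
          }
        ; comm = +ᶠ-comm
        }
      ; *-cong = *ᶠ-cong
      ; *-assoc = *ᶠ-assoc
      ; *-identity = *ᶠ-identityˡ
                   , λ u → ≈ᶠ-trans (*ᶠ-comm u 1ᶠ) (*ᶠ-identityˡ u)
      ; distrib = *ᶠ-distribˡ , *ᶠ-distribʳ
      }
    ; *-comm = *ᶠ-comm
    }

  num≈0⇒≈0 : ∀ {u} → num u ≈ 0# → u ≈ᶠ 0ᶠ
  num≈0⇒≈0 e = mk≈ (trans (*-congʳ e) (trans (zeroˡ _) (sym (zeroˡ _))))

  ≈0⇒num≈0 : ∀ {u} → u ≈ᶠ 0ᶠ → num u ≈ 0#
  ≈0⇒num≈0 (mk≈ e) = trans (sym (*-identityʳ _)) (trans e (zeroˡ _))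

  infix 4 _≟ᶠ_
  _≟ᶠ_ : Decidable _≈ᶠ_
  u ≟ᶠ v = Dec.map′ mk≈ cross (num u * den v ≟ num v * den u)

  ⁻¹ᶠ-cong : ∀ {u v} → u ≈ᶠ v → (u ⁻¹ᶠ) ≈ᶠ (v ⁻¹ᶠ)
  ⁻¹ᶠ-cong {u@(frac a b _)} {v@(frac c d _)} e with a ≟ 0# | c ≟ 0#
  ... | yes _   | yes _   = mk≈ refl
  ... | yes a≈0 | no c≉0  = contradiction (≈0⇒num≈0 (≈ᶠ-trans (≈ᶠ-sym e) (num≈0⇒≈0 a≈0))) c≉0
  ... | no a≉0  | yes c≈0 = contradiction (≈0⇒num≈0 (≈ᶠ-trans e (num≈0⇒≈0 c≈0))) a≉0
  ... | no _    | no _    = mk≈ (trans (*-comm b c) (trans (sym (cross e)) (*-comm a d)))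

  ⁻¹ᶠ-inverseʳ : ∀ {u} → ¬ u ≈ᶠ 0ᶠ → u *ᶠ (u ⁻¹ᶠ) ≈ᶠ 1ᶠ
  ⁻¹ᶠ-inverseʳ {frac a b _} u≉0 with a ≟ 0#
  ... | yes a≈0 = contradiction (num≈0⇒≈0 a≈0) u≉0
  ... | no _    = mk≈ (Identities.inverse-frac a b)

  0⁻¹ᶠ≈0 : (0ᶠ ⁻¹ᶠ) ≈ᶠ 0ᶠ
  0⁻¹ᶠ≈0 with 0# ≟ 0#
  ... | yes _  = mk≈ refl
  ... | no 0≉0 = contradiction refl 0≉0

  field′ : DecidableField (c ⊔ ℓ) ℓ
  field′ = record
    { commutativeRing = record { isCommutativeRing = ᶠ-isCommutativeRing }
    ; _≟_ = _≟ᶠ_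
    ; 1≉0 = λ e → 1≉0 (≈0⇒num≈0 e)
    ; _⁻¹ = _⁻¹ᶠ
    ; ⁻¹-cong = ⁻¹ᶠ-cong
    ; ⁻¹-inverseʳ = ⁻¹ᶠ-inverseʳ
    ; 0⁻¹≈0 = 0⁻¹ᶠ≈0
    }

module PowerSeries (K : DecidableField c ℓ) where
  open DecidableField K
  private module Identities = RingIdentities commutativeRing

  -- f n is the coefficient of tⁿ, so that λ n → a n is Σₙ aₙ tⁿ.
  Series : Set c
  Series = ℕ → Carrier

  infix 4 _≈ˢ_
  _≈ˢ_ : Series → Series → Set ℓ
  f ≈ˢ g = ∀ n → f n ≈ g n

  tail : Series → Series
  tail f n = f (suc n)

  C : Carrier → Series
  C a zero    = a
  C a (suc _) = 0#

  t : Series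
  t (suc zero) = 1#
  t _          = 0#

  infixl 6 _-ˢ_
  infixl 7 _*ˢ_ _/ˢ_

  _-ˢ_ : Series → Series → Series
  (f -ˢ g) n = f n - g n

  -- The Cauchy product Σ_{i+j=n} fᵢ gⱼ, with the i = 0 summand split off.
  _*ˢ_ : Series → Series → Series
  (f *ˢ g) zero    = f 0 * g 0
  (f *ˢ g) (suc n) = f 0 * g (suc n) + (tail f *ˢ g) n

  -- Long division: if q is the quotient then q₀ = f₀/g₀, and the tail of q is
  -- the quotient of tail f − q₀·tail g by g.  Meaningful only for g₀ ≠ 0, see
  -- /ˢ-correct.
  _/ˢ_ : Series → Series → Series
  (f /ˢ g) zero    = f 0 ÷ g 0
  (f /ˢ g) (suc n) = ((λ k → f (suc k) - (f 0 ÷ g 0) * g (suc k)) /ˢ g) n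

  /ˢ-correct : ∀ f g → ¬ g 0 ≈ 0# → (f /ˢ g) *ˢ g ≈ˢ f
  /ˢ-correct f g g₀≉0 zero = begin
    (f 0 * g 0 ⁻¹) * g 0     ≈⟨ Identities.xz*y≈x*yz (f 0) (g 0) (g 0 ⁻¹) ⟩
    f 0 * (g 0 * g 0 ⁻¹)     ≈⟨ *-congˡ (⁻¹-inverseʳ g₀≉0) ⟩
    f 0 * 1#                 ≈⟨ *-identityʳ _ ⟩
    f 0                      ∎
    where
    open SetoidReasoning setoid
  /ˢ-correct f g g₀≉0 (suc n) = begin
    q₀ * g (suc n) + ((r /ˢ g) *ˢ g) n                 ≈⟨ +-congˡ (/ˢ-correct r g g₀≉0 n) ⟩
    q₀ * g (suc n) + (f (suc n) - q₀ * g (suc n))      ≈⟨ +-comm _ _ ⟩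
    (f (suc n) - q₀ * g (suc n)) + q₀ * g (suc n)      ≈⟨ +-assoc _ _ _ ⟩
    f (suc n) + (- (q₀ * g (suc n)) + q₀ * g (suc n))  ≈⟨ +-congˡ (-‿inverseˡ _) ⟩
    f (suc n) + 0#                                     ≈⟨ +-identityʳ _ ⟩
    f (suc n)                                          ∎
    where
    open SetoidReasoning setoid
    q₀ : Carrier
    q₀ = f 0 ÷ g 0
    r : Series
    r k = f (suc k) - q₀ * g (suc k)

sumℤ : List ℤ → ℤ
sumℤ = List.foldr ℤ._+_ 0ℤ

∏! : List ℤ → ℕ
∏! = List.foldr (λ m k → (ℤ.∣ m ∣ !) ℕ.* k) 1

∏!≢0 : ∀ ms → ℕ.NonZero (∏! ms)
∏!≢0 []       = _
∏!≢0 (m ∷ ms) = ℕ.m*n≢0 (ℤ.∣ m ∣ !) (∏! ms) {{ ℤ.∣ m ∣ ℕ.!≢0 }} {{ ∏!≢0 ms }}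

-- multinomial N (m₁ ∷ … ∷ m_k ∷ []) has the remaining part N − Σ mᵢ implicit.
multinomial : ℤ → List ℤ → ℕ
multinomial N ms
  with all? (0ℤ ℤ.≤?_) ms ×-dec (sumℤ ms ℤ.≤? N)
     | (N ℤ.≟ -1ℤ) ×-dec all? (ℤ._≟ 0ℤ) ms
... | yes _ | _     = ℕ._/_ (ℤ.∣ N ∣ !) (∏! (N ℤ.- sumℤ ms ∷ ms)) {{ ∏!≢0 (N ℤ.- sumℤ ms ∷ ms) }}
... | no _  | yes _ = 1
... | no _  | no _  = 0

module Sums (K : DecidableField c ℓ) where
  open DecidableField K

  sumOver : {I : Set} → List I → (I → Carrier) → Carrier
  sumOver is f = List.foldr (λ i s → f i + s) 0# is

  -- s = Σ_{i ∈ I} f i, where all but finitely many summands vanish.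
  record IsSum {I : Set} (f : I → Carrier) (s : Carrier) : Set (c ⊔ ℓ) where
    field
      support   : List I
      unique    : Unique support
      vanishing : ∀ i → i ∉ support → f i ≈ 0#
      sum≈      : s ≈ sumOver support f

  -- z = Σ c uᵃ vᵇ with c ∈ ℕ and a , b ∈ ℤ.  Repeated exponents are harmless.
  IsPositiveLaurentIn : Carrier → Carrier → Carrier → Set ℓ
  IsPositiveLaurentIn u v z =
    ∃[ terms ] z ≈ sumOver {ℕ × ℤ × ℤ} terms λ (c , a , b) → c • (u ^ᶻ a * v ^ᶻ b)

ℤ-domain : DecidableDomain 0ℓ 0ℓ
ℤ-domain = record
  { commutativeRing = ℤ.+-*-commutativeRing
  ; _≟_ = ℤ._≟_
  ; 1≉0 = λ ()
  ; xy≈0⇒y≈0 = λ {x} x≢0 xy≡0 →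
      [ (λ x≡0 → contradiction x≡0 x≢0) , (λ y≡0 → y≡0) ]′ (ℤ.i*j≡0⇒i≡0∨j≡0 x xy≡0)
  }

module ℤ[X₀]     = Polynomial ℤ-domain
module ℤ[X₀][X₁] = Polynomial ℤ[X₀].domain

-- ℚ(X₀, X₁), obtained as Frac(ℤ[X₀][X₁]).
module FracℤX₀X₁ = Fractions ℤ[X₀][X₁].domain

ℚ⟨X₀,X₁⟩ : DecidableField 0ℓ 0ℓ
ℚ⟨X₀,X₁⟩ = FracℤX₀X₁.field′

open DecidableField ℚ⟨X₀,X₁⟩ public
  using (Carrier; _≈_; _+_; _*_; _-_; -_; 0#; 1#; _⁻¹; _÷_; _^_; _^ᶻ_; _•_)
open PowerSeries ℚ⟨X₀,X₁⟩ public
  using (Series; _≈ˢ_; C; t; _-ˢ_; _*ˢ_; _/ˢ_)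
open Sums ℚ⟨X₀,X₁⟩ public
  using (sumOver; IsSum; IsPositiveLaurentIn)

X₀ X₁ : Carrier
X₀ = FracℤX₀X₁.embed (ℤ[X₀][X₁].const ℤ[X₀].X)
X₁ = FracℤX₀X₁.embed ℤ[X₀][X₁].X

record IsClusterSequence (x : ℤ → Carrier) : Set where
  field
    x₀≈X₀ : x (+ 0) ≈ X₀
    x₁≈X₁ : x (+ 1) ≈ X₁
    even  : ∀ n → x (+ 2 ℤ.* n) * x (+ 2 ℤ.* n ℤ.- + 2)
                  ≈ 1# + x (+ 2 ℤ.* n ℤ.- + 1)
    odd   : ∀ n → x (+ 2 ℤ.* n ℤ.+ + 1) * x (+ 2 ℤ.* n ℤ.- + 1)
                  ≈ 1# + x (+ 2 ℤ.* n) ^ 4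

-- a / (1 − t y₁ − t² y₂ / (1 − t y₃))
continuedFraction : (a y₁ y₂ y₃ : Carrier) → Series
continuedFraction a y₁ y₂ y₃ =
  C a /ˢ (C 1# -ˢ t *ˢ C y₁ -ˢ (t *ˢ t *ˢ C y₂) /ˢ (C 1# -ˢ t *ˢ C y₃))

{-# OPTIONS --safe #-}
-- Let M = (y₁ y₂ ; 1 y₃), a matrix of determinant 1 and trace a² y₂, and let Aₙ be the top left
-- entry of Mⁿ.  These two invariants show that x₂ₙ = a Aₙ solves the cluster recursion, whose
-- solution is unique because no xₙ vanishes.  The continued fraction is the generating function of
-- a Aₙ.  Sorting the closed paths of length n counted by Aₙ according to their exponents of y₁, y₂
-- and y₃, and applying the binomial theorem three times, gives the explicit formulas.  In
-- x₂ₙ₊₁ = x₂ₙ x₂ₙ₊₂ − 1 the subtracted 1 = det Mⁿ cancels before expansion, and what is left has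
-- only positive terms.
module Submission where

import Algebra.Properties.CommutativeSemigroup as CommutativeSemigroup
import Algebra.Properties.CommutativeSemiring.Exp as Exp
import Algebra.Properties.Semiring.Mult as Mult
open import Algebra.Bundles using (CommutativeSemiring)
open import Data.Integer.Base as ℤ using (ℤ; +_; -[1+_]; 0ℤ; -1ℤ)
  renaming (_+_ to _+ℤ_; _-_ to _-ℤ_; _*_ to _*ℤ_)
import Data.Integer.Properties as ℤ
open import Data.Integer.Tactic.RingSolver using () renaming (solve-∀ to ℤ-solve-∀)
open import Data.List.Base as List using (List; []; _∷_; _++_; applyUpTo; upTo)
open import Data.List.Membership.Propositional using (_∉_)
open import Data.List.Membership.Propositional.Properties using (∈-cartesianProduct⁺; ∈-upTo⁺)
open import Data.List.Relation.Unary.All using (All; []; _∷_; all?)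
open import Data.List.Relation.Unary.Unique.Propositional.Properties using (cartesianProduct⁺; upTo⁺)
open import Data.Nat.Base as ℕ using (ℕ; zero; suc; _!; z≤n; s≤s) renaming (_+_ to _+ℕ_; _*_ to _*ℕ_)
import Data.Nat.Properties as ℕ
open import Data.Nat.Combinatorics using
  (_C_; nCk≡n!/k![n-k]!; k![n∸k]!∣n!; k>n⇒nCk≡0; nCk+nC[k+1]≡[n+1]C[k+1]; nCn≡1)
open import Data.Nat.DivMod using (m*n/n≡m; m/n*n≡m; /-congˡ)
open import Data.Nat.Tactic.RingSolver using () renaming (solve-∀ to ℕ-solve-∀)
open import Data.Product.Base using (_×_; _,_; proj₁; proj₂; ∃-syntax)
open import Data.Sum.Base using (_⊎_; inj₁; inj₂)
open import Function.Base using (_∘_; id)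
open import Level using (Level; _⊔_)
open import Relation.Nullary using (¬_; yes; no; contradiction; _×-dec_)
open import Relation.Binary.PropositionalEquality as ≡ using (_≡_)
import Relation.Binary.Reasoning.Setoid as SetoidReasoning

open import Defs using
  ( DecidableField; DecidableDomain; module PowerSeries; module Sums; module Polynomial; module Fractions
  ; multinomial; ∏!; ∏!≢0; sumℤ; ℤ-domain)
open CommutativeSemigroup ℤ.+-commutativeSemigroup using () renaming (interchange to ℤ-interchange)

private
  variable
    c ℓ : Level

-- The columns of the powers of M = (y₁ y₂ ; 1 y₃) are (A n , B n) and (y₂ B n , D n).
module Transfer (R : CommutativeSemiring c ℓ)
                (y₁ y₂ y₃ : CommutativeSemiring.Carrier R) where
  open CommutativeSemiring R

  A B D : ℕ → Carrier
  A zero    = 1#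
  A (suc n) = y₁ * A n + y₂ * B n
  B zero    = 0#
  B (suc n) = A n + y₃ * B n
  D zero    = 1#
  D (suc n) = y₂ * B n + y₃ * D n

-- The orbit x₂ₙ = a Aₙ , x₂ₙ₊₁ = Wₙ.
module Orbits (R : CommutativeSemiring c ℓ) where
  open CommutativeSemiring R

  module Orbit (a e y₁ y₂ y₃ : Carrier)
               (det   : y₁ * y₃ ≈ 1# + y₂)
               (trace : (a * a) * y₂ ≈ y₁ + y₃)
               (first : (a * a) * y₁ ≈ 1# + e) where
    open Transfer R y₁ y₂ y₃
    open import Algebra.Solver.Ring.NaturalCoefficients.Default R
    open SetoidReasoning setoid

    E : ℕ → Carrier
    E zero    = e
    E (suc n) = (y₁ * E n + (y₁ + y₁) * D n) + (e * y₂) * B n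

    W : ℕ → Carrier
    W n = A n * E n + y₂ * (B n * B n)

    -- M commutes with Mⁿ.
    y₁B+D≈A+y₃B : ∀ n → y₁ * B n + D n ≈ A n + y₃ * B n
    y₁B+D≈A+y₃B zero    = solve 2 (λ y₁ y₃ → y₁ :* con 0 :+ con 1 := con 1 :+ y₃ :* con 0) refl y₁ y₃
    y₁B+D≈A+y₃B (suc n) = begin
      y₁ * (A n + y₃ * B n) + (y₂ * B n + y₃ * D n)
        ≈⟨ solve 6 (λ y₁ y₂ y₃ A B D →
             y₁ :* (A :+ y₃ :* B) :+ (y₂ :* B :+ y₃ :* D) :=
             (y₁ :* A :+ y₂ :* B) :+ y₃ :* (y₁ :* B :+ D)) refl y₁ y₂ y₃ (A n) (B n) (D n) ⟩
      A (suc n) + y₃ * (y₁ * B n + D n)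
        ≈⟨ +-congˡ (*-congˡ (y₁B+D≈A+y₃B n)) ⟩
      A (suc n) + y₃ * B (suc n) ∎

    AD≈1+y₂B² : ∀ n → A n * D n ≈ 1# + y₂ * (B n * B n)
    AD≈1+y₂B² zero    = solve 1 (λ y₂ → con 1 :* con 1 := con 1 :+ y₂ :* (con 0 :* con 0)) refl y₂
    AD≈1+y₂B² (suc n) = begin
      (y₁ * A n + y₂ * B n) * (y₂ * B n + y₃ * D n)
        ≈⟨ solve 6 (λ y₁ y₂ y₃ A B D →
             (y₁ :* A :+ y₂ :* B) :* (y₂ :* B :+ y₃ :* D) :=
             (y₁ :* y₃) :* (A :* D) :+ ((y₁ :* y₂) :* (A :* B) :+ y₂ :* (y₂ :* (B :* B)) :+ (y₂ :* y₃) :* (B :* D)))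
             refl y₁ y₂ y₃ (A n) (B n) (D n) ⟩
      (y₁ * y₃) * (A n * D n) + _
        ≈⟨ +-congʳ (*-congʳ det) ⟩
      (1# + y₂) * (A n * D n) + _
        ≈⟨ solve 6 (λ y₁ y₂ y₃ A B D →
             (con 1 :+ y₂) :* (A :* D) :+ ((y₁ :* y₂) :* (A :* B) :+ y₂ :* (y₂ :* (B :* B)) :+ (y₂ :* y₃) :* (B :* D)) :=
             A :* D :+ (y₂ :* (A :* D) :+ ((y₁ :* y₂) :* (A :* B) :+ y₂ :* (y₂ :* (B :* B)) :+ (y₂ :* y₃) :* (B :* D))))
             refl y₁ y₂ y₃ (A n) (B n) (D n) ⟩
      A n * D n + _
        ≈⟨ +-congʳ (AD≈1+y₂B² n) ⟩
      (1# + y₂ * (B n * B n)) + _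
        ≈⟨ solve 6 (λ y₁ y₂ y₃ A B D →
             (con 1 :+ y₂ :* (B :* B)) :+ (y₂ :* (A :* D) :+ ((y₁ :* y₂) :* (A :* B) :+ y₂ :* (y₂ :* (B :* B)) :+ (y₂ :* y₃) :* (B :* D))) :=
             (con 1 :+ y₂) :* (y₂ :* (B :* B)) :+ (con 1 :+ y₂ :* (A :* (y₁ :* B :+ D) :+ y₃ :* (B :* D))))
             refl y₁ y₂ y₃ (A n) (B n) (D n) ⟩
      (1# + y₂) * (y₂ * (B n * B n)) + _
        ≈⟨ +-congʳ (*-congʳ det) ⟨
      (y₁ * y₃) * (y₂ * (B n * B n)) + _
        ≈⟨ solve 6 (λ y₁ y₂ y₃ A B D →
             (y₁ :* y₃) :* (y₂ :* (B :* B)) :+ (con 1 :+ y₂ :* (A :* (y₁ :* B :+ D) :+ y₃ :* (B :* D))) :=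
             con 1 :+ y₂ :* ((A :+ y₃ :* B) :* (y₁ :* B :+ D)))
             refl y₁ y₂ y₃ (A n) (B n) (D n) ⟩
      1# + y₂ * (B (suc n) * (y₁ * B n + D n))
        ≈⟨ +-congˡ (*-congˡ (*-congˡ (y₁B+D≈A+y₃B n))) ⟩
      1# + y₂ * (B (suc n) * B (suc n)) ∎

    a²A′≈E+D : ∀ n → (a * a) * A (suc n) ≈ E n + D n
    a²A′≈E+D zero    = begin
      (a * a) * (y₁ * 1# + y₂ * 0#)
        ≈⟨ solve 3 (λ a y₁ y₂ → (a :* a) :* (y₁ :* con 1 :+ y₂ :* con 0) := (a :* a) :* y₁) refl a y₁ y₂ ⟩
      (a * a) * y₁   ≈⟨ first ⟩
      1# + e         ≈⟨ +-comm 1# e ⟩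
      e + 1#         ∎
    a²A′≈E+D (suc n) = begin
      (a * a) * (y₁ * A (suc n) + y₂ * B (suc n))
        ≈⟨ solve 5 (λ a y₁ y₂ A B →
             (a :* a) :* (y₁ :* A :+ y₂ :* B) := y₁ :* ((a :* a) :* A) :+ ((a :* a) :* y₂) :* B)
             refl a y₁ y₂ (A (suc n)) (B (suc n)) ⟩
      y₁ * ((a * a) * A (suc n)) + ((a * a) * y₂) * B (suc n)
        ≈⟨ +-cong (*-congˡ (a²A′≈E+D n)) (*-cong trace (sym (y₁B+D≈A+y₃B n))) ⟩
      y₁ * (E n + D n) + (y₁ + y₃) * (y₁ * B n + D n)
        ≈⟨ solve 5 (λ y₁ y₃ B D E →
             y₁ :* (E :+ D) :+ (y₁ :+ y₃) :* (y₁ :* B :+ D) :=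
             (y₁ :+ y₃) :* y₁ :* B :+ (y₁ :* E :+ (y₁ :+ y₁) :* D :+ y₃ :* D))
             refl y₁ y₃ (B n) (D n) (E n) ⟩
      (y₁ + y₃) * y₁ * B n + _
        ≈⟨ +-congʳ (*-congʳ (*-congʳ trace)) ⟨
      (a * a) * y₂ * y₁ * B n + _
        ≈⟨ solve 7 (λ a y₁ y₂ y₃ B D E →
             (a :* a) :* y₂ :* y₁ :* B :+ (y₁ :* E :+ (y₁ :+ y₁) :* D :+ y₃ :* D) :=
             ((a :* a) :* y₁) :* (y₂ :* B) :+ (y₁ :* E :+ (y₁ :+ y₁) :* D :+ y₃ :* D))
             refl a y₁ y₂ y₃ (B n) (D n) (E n) ⟩
      ((a * a) * y₁) * (y₂ * B n) + _
        ≈⟨ +-congʳ (*-congʳ first) ⟩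
      (1# + e) * (y₂ * B n) + _
        ≈⟨ solve 7 (λ e y₁ y₂ y₃ B D E →
             (con 1 :+ e) :* (y₂ :* B) :+ (y₁ :* E :+ (y₁ :+ y₁) :* D :+ y₃ :* D) :=
             (y₁ :* E :+ (y₁ :+ y₁) :* D :+ e :* y₂ :* B) :+ (y₂ :* B :+ y₃ :* D))
             refl e y₁ y₂ y₃ (B n) (D n) (E n) ⟩
      E (suc n) + D (suc n) ∎

    aAaA′≈1+W : ∀ n → (a * A (suc n)) * (a * A n) ≈ 1# + W n
    aAaA′≈1+W n = begin
      (a * A (suc n)) * (a * A n)
        ≈⟨ solve 3 (λ a A A′ → (a :* A′) :* (a :* A) := A :* ((a :* a) :* A′)) refl a (A n) (A (suc n)) ⟩
      A n * ((a * a) * A (suc n))             ≈⟨ *-congˡ (a²A′≈E+D n) ⟩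
      A n * (E n + D n)                       ≈⟨ distribˡ _ _ _ ⟩
      A n * E n + A n * D n                   ≈⟨ +-congˡ (AD≈1+y₂B² n) ⟩
      A n * E n + (1# + y₂ * (B n * B n))     ≈⟨ solve 2 (λ u v → u :+ (con 1 :+ v) := con 1 :+ (u :+ v)) refl _ _ ⟩
      1# + W n                                ∎

    A+A″≈tA′ : ∀ n → A (suc (suc n)) + A n ≈ (y₁ + y₃) * A (suc n)
    A+A″≈tA′ n = begin
      (y₁ * A (suc n) + y₂ * (A n + y₃ * B n)) + A n
        ≈⟨ solve 6 (λ y₁ y₂ y₃ A A′ B →
             (y₁ :* A′ :+ y₂ :* (A :+ y₃ :* B)) :+ A :=
             (con 1 :+ y₂) :* A :+ (y₁ :* A′ :+ y₃ :* (y₂ :* B))) refl y₁ y₂ y₃ (A n) (A (suc n)) (B n) ⟩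
      (1# + y₂) * A n + _
        ≈⟨ +-congʳ (*-congʳ det) ⟨
      (y₁ * y₃) * A n + _
        ≈⟨ solve 6 (λ y₁ y₂ y₃ A A′ B →
             (y₁ :* y₃) :* A :+ (y₁ :* A′ :+ y₃ :* (y₂ :* B)) :=
             y₁ :* A′ :+ y₃ :* (y₁ :* A :+ y₂ :* B)) refl y₁ y₂ y₃ (A n) (A (suc n)) (B n) ⟩
      y₁ * A (suc n) + y₃ * A (suc n)
        ≈⟨ distribʳ _ _ _ ⟨
      (y₁ + y₃) * A (suc n) ∎

    AB′≈1+A′B : ∀ n → A n * B (suc n) ≈ 1# + A (suc n) * B n
    AB′≈1+A′B n = begin
      A n * B (suc n)            ≈⟨ *-congˡ (y₁B+D≈A+y₃B n) ⟨
      A n * (y₁ * B n + D n)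
        ≈⟨ solve 4 (λ y₁ A B D → A :* (y₁ :* B :+ D) := A :* D :+ y₁ :* A :* B) refl y₁ (A n) (B n) (D n) ⟩
      A n * D n + y₁ * A n * B n ≈⟨ +-congʳ (AD≈1+y₂B² n) ⟩
      (1# + y₂ * (B n * B n)) + y₁ * A n * B n
        ≈⟨ solve 4 (λ y₁ y₂ A B → (con 1 :+ y₂ :* (B :* B)) :+ y₁ :* A :* B :=
                                  con 1 :+ (y₁ :* A :+ y₂ :* B) :* B) refl y₁ y₂ (A n) (B n) ⟩
      1# + A (suc n) * B n ∎

    AA″≈y₂+A′² : ∀ n → A (suc (suc n)) * A n ≈ y₂ + A (suc n) * A (suc n)
    AA″≈y₂+A′² n = begin
      (y₁ * A (suc n) + y₂ * B (suc n)) * A n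
        ≈⟨ solve 5 (λ y₁ y₂ A A′ B′ → (y₁ :* A′ :+ y₂ :* B′) :* A :=
                      y₂ :* (A :* B′) :+ y₁ :* A :* A′) refl y₁ y₂ (A n) (A (suc n)) (B (suc n)) ⟩
      y₂ * (A n * B (suc n)) + y₁ * A n * A (suc n)
        ≈⟨ +-congʳ (*-congˡ (AB′≈1+A′B n)) ⟩
      y₂ * (1# + A (suc n) * B n) + y₁ * A n * A (suc n)
        ≈⟨ solve 5 (λ y₁ y₂ A A′ B → y₂ :* (con 1 :+ A′ :* B) :+ y₁ :* A :* A′ :=
                      y₂ :+ A′ :* (y₁ :* A :+ y₂ :* B)) refl y₁ y₂ (A n) (A (suc n)) (B n) ⟩
      y₂ + A (suc n) * A (suc n) ∎

    -- With 1 + Wₙ + Wₙ₊₁ added to both sides, to avoid subtraction.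
    W′W≈1+[aA′]⁴ : ∀ n → W (suc n) * W n + (1# + W n + W (suc n)) ≈
               (1# + (a * A (suc n)) * ((a * A (suc n)) * ((a * A (suc n)) * ((a * A (suc n)) * 1#))))
               + (1# + W n + W (suc n))
    W′W≈1+[aA′]⁴ n = begin
      W (suc n) * W n + (1# + W n + W (suc n))
        ≈⟨ solve 2 (λ w w′ → w′ :* w :+ (con 1 :+ w :+ w′) := (con 1 :+ w′) :* (con 1 :+ w)) refl (W n) (W (suc n)) ⟩
      (1# + W (suc n)) * (1# + W n)
        ≈⟨ *-cong (aAaA′≈1+W (suc n)) (aAaA′≈1+W n) ⟨
      ((a * A (suc (suc n))) * (a * A (suc n))) * ((a * A (suc n)) * (a * A n))
        ≈⟨ solve 4 (λ a A A′ A″ →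
             ((a :* A″) :* (a :* A′)) :* ((a :* A′) :* (a :* A)) :=
             (a :* A′) :* (a :* A′) :* (a :* a) :* (A″ :* A)) refl a (A n) (A (suc n)) (A (suc (suc n))) ⟩
      (a * A (suc n)) * (a * A (suc n)) * (a * a) * (A (suc (suc n)) * A n)
        ≈⟨ *-congˡ (AA″≈y₂+A′² n) ⟩
      (a * A (suc n)) * (a * A (suc n)) * (a * a) * (y₂ + A (suc n) * A (suc n))
        ≈⟨ solve 3 (λ a y₂ A′ →
             (a :* A′) :* (a :* A′) :* (a :* a) :* (y₂ :+ A′ :* A′) :=
             (a :* A′) :* (a :* A′) :* ((a :* a) :* y₂) :+
             (a :* A′) :* ((a :* A′) :* ((a :* A′) :* ((a :* A′) :* con 1)))) refl a y₂ (A (suc n)) ⟩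
      (a * A (suc n)) * (a * A (suc n)) * ((a * a) * y₂) + _
        ≈⟨ +-congʳ (*-congˡ trace) ⟩
      (a * A (suc n)) * (a * A (suc n)) * (y₁ + y₃) + _
        ≈⟨ +-congʳ (solve 3 (λ a t A′ → (a :* A′) :* (a :* A′) :* t := (a :* a :* A′) :* (t :* A′)) refl a (y₁ + y₃) (A (suc n))) ⟩
      (a * a * A (suc n)) * ((y₁ + y₃) * A (suc n)) + _
        ≈⟨ +-congʳ (*-congˡ (A+A″≈tA′ n)) ⟨
      (a * a * A (suc n)) * (A (suc (suc n)) + A n) + _
        ≈⟨ +-congʳ (solve 4 (λ a A A′ A″ →
             (a :* a :* A′) :* (A″ :+ A) := (a :* A″) :* (a :* A′) :+ (a :* A′) :* (a :* A))
             refl a (A n) (A (suc n)) (A (suc (suc n)))) ⟩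
      ((a * A (suc (suc n))) * (a * A (suc n)) + (a * A (suc n)) * (a * A n)) + _
        ≈⟨ +-congʳ (+-cong (aAaA′≈1+W (suc n)) (aAaA′≈1+W n)) ⟩
      ((1# + W (suc n)) + (1# + W n)) + _
        ≈⟨ solve 3 (λ w w′ f → ((con 1 :+ w′) :+ (con 1 :+ w)) :+ f := (con 1 :+ f) :+ (con 1 :+ w :+ w′)) refl (W n) (W (suc n)) _ ⟩
      _ ∎

module FieldProperties (K : DecidableField c ℓ) where
  open DecidableField K
  open import Algebra.Solver.Ring.NaturalCoefficients.Default commutativeSemiring
  open SetoidReasoning setoid
  open Exp commutativeSemiring using (^-homo-*; ^-cong)

  ⁻¹-inverseˡ : ∀ {x} → ¬ x ≈ 0# → x ⁻¹ * x ≈ 1#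
  ⁻¹-inverseˡ x≉0 = trans (*-comm _ _) (⁻¹-inverseʳ x≉0)

  *-cancelˡ : ∀ {x y z} → ¬ x ≈ 0# → x * y ≈ x * z → y ≈ z
  *-cancelˡ {x} {y} {z} x≉0 e = begin
    y              ≈⟨ lemma y ⟩
    x ⁻¹ * (x * y) ≈⟨ *-congˡ e ⟩
    x ⁻¹ * (x * z) ≈⟨ lemma z ⟨
    z              ∎
    where
    lemma : ∀ y → y ≈ x ⁻¹ * (x * y)
    lemma y = begin
      y              ≈⟨ *-identityˡ y ⟨
      1# * y         ≈⟨ *-congʳ (⁻¹-inverseˡ x≉0) ⟨
      x ⁻¹ * x * y   ≈⟨ *-assoc _ _ _ ⟩
      x ⁻¹ * (x * y) ∎

  *-cancelʳ : ∀ {x y z} → ¬ x ≈ 0# → y * x ≈ z * x → y ≈ z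
  *-cancelʳ x≉0 e = *-cancelˡ x≉0 (trans (*-comm _ _) (trans e (*-comm _ _)))

  *-≉0 : ∀ {x y} → ¬ x ≈ 0# → ¬ y ≈ 0# → ¬ x * y ≈ 0#
  *-≉0 x≉0 y≉0 e = y≉0 (*-cancelˡ x≉0 (trans e (sym (zeroʳ _))))

  ^-≉0 : ∀ {x} n → ¬ x ≈ 0# → ¬ x ^ n ≈ 0#
  ^-≉0 zero    x≉0 = 1≉0
  ^-≉0 (suc n) x≉0 = *-≉0 x≉0 (^-≉0 n x≉0)

  x÷y*y≈x : ∀ x {y} → ¬ y ≈ 0# → (x ÷ y) * y ≈ x
  x÷y*y≈x x {y} y≉0 = begin
    x * y ⁻¹ * y   ≈⟨ *-assoc _ _ _ ⟩
    x * (y ⁻¹ * y) ≈⟨ *-congˡ (⁻¹-inverseˡ y≉0) ⟩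
    x * 1#         ≈⟨ *-identityʳ x ⟩
    x              ∎

  ÷-unique : ∀ {x y z} → ¬ y ≈ 0# → z * y ≈ x → x ÷ y ≈ z
  ÷-unique y≉0 e = *-cancelʳ y≉0 (trans (x÷y*y≈x _ y≉0) (sym e))

  x^m*x⁻¹^n : ∀ {x} → ¬ x ≈ 0# → ∀ m n → x ^ m * (x ⁻¹) ^ n ≈ x ^ᶻ (m ℤ.⊖ n)
  x^m*x⁻¹^n x≉0 m       zero    = *-identityʳ _
  x^m*x⁻¹^n x≉0 zero    (suc n) = *-identityˡ _
  x^m*x⁻¹^n {x} x≉0 (suc m) (suc n) = begin
    (x * x ^ m) * (x ⁻¹ * (x ⁻¹) ^ n)
      ≈⟨ solve 4 (λ x i p q → (x :* p) :* (i :* q) := (x :* i) :* (p :* q)) refl x (x ⁻¹) (x ^ m) ((x ⁻¹) ^ n) ⟩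
    (x * x ⁻¹) * (x ^ m * (x ⁻¹) ^ n)  ≈⟨ *-congʳ (⁻¹-inverseʳ x≉0) ⟩
    1# * (x ^ m * (x ⁻¹) ^ n)          ≈⟨ *-identityˡ _ ⟩
    x ^ m * (x ⁻¹) ^ n                 ≈⟨ x^m*x⁻¹^n x≉0 m n ⟩
    x ^ᶻ (m ℤ.⊖ n)                     ≡⟨ ≡.cong (x ^ᶻ_) (ℤ.[1+m]⊖[1+n]≡m⊖n m n) ⟨
    x ^ᶻ (suc m ℤ.⊖ suc n)             ∎

  ^ᶻ-homo-+ : ∀ {x} → ¬ x ≈ 0# → ∀ i j → x ^ᶻ (i ℤ.+ j) ≈ x ^ᶻ i * x ^ᶻ j
  ^ᶻ-homo-+ {x} x≉0 (+ m)    (+ n)    = ^-homo-* x m n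
  ^ᶻ-homo-+ {x} x≉0 (+ m)    -[1+ n ] = sym (x^m*x⁻¹^n x≉0 m (suc n))
  ^ᶻ-homo-+ {x} x≉0 -[1+ m ] (+ n)    = trans (sym (x^m*x⁻¹^n x≉0 n (suc m))) (*-comm _ _)
  ^ᶻ-homo-+ {x} x≉0 -[1+ m ] -[1+ n ] =
    trans (^-cong {x ⁻¹} refl (≡.cong suc (≡.sym (ℕ.+-suc m n)))) (^-homo-* (x ⁻¹) (suc m) (suc n))

module Division (K : DecidableField c ℓ) where
  open DecidableField K
  open PowerSeries K
  open FieldProperties K
  open import Algebra.Solver.Ring.NaturalCoefficients.Default commutativeSemiring
  open import Algebra.Properties.Ring ring
    using (-0#≈0#; +-cancelʳ)
  open SetoidReasoning setoid

  /ˢ-cong : ∀ {f f′ g g′} → f ≈ˢ f′ → g ≈ˢ g′ → f /ˢ g ≈ˢ f′ /ˢ g′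
  /ˢ-cong e e′ zero    = *-cong (e 0) (⁻¹-cong (e′ 0))
  /ˢ-cong e e′ (suc n) = /ˢ-cong
    (λ k → +-cong (e (suc k)) (-‿cong (*-cong (*-cong (e 0) (⁻¹-cong (e′ 0))) (e′ (suc k))))) e′ n

  x≈y+z⇒x-y≈z : ∀ {x y z} → x ≈ y + z → x - y ≈ z
  x≈y+z⇒x-y≈z {x} {y} {z} e = begin
    x - y           ≈⟨ +-congʳ e ⟩
    (y + z) - y     ≈⟨ solve 3 (λ y z n → (y :+ z) :+ n := (y :+ n) :+ z) refl y z (- y) ⟩
    (y - y) + z     ≈⟨ +-congʳ (-‿inverseʳ y) ⟩
    0# + z          ≈⟨ +-identityˡ z ⟩
    z               ∎

  /ˢ-unique : ∀ {f g h} → ¬ g 0 ≈ 0# → h *ˢ g ≈ˢ f → f /ˢ g ≈ˢ h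
  /ˢ-unique {f} {g} {h} g₀≉0 e zero    = ÷-unique g₀≉0 (e 0)
  /ˢ-unique {f} {g} {h} g₀≉0 e (suc n) = /ˢ-unique g₀≉0 (λ k → sym (x≈y+z⇒x-y≈z (begin
    f (suc k)                            ≈⟨ e (suc k) ⟨
    h 0 * g (suc k) + (tail h *ˢ g) k    ≈⟨ +-congʳ (*-congʳ (÷-unique g₀≉0 (e 0))) ⟨
    f 0 ÷ g 0 * g (suc k) + (tail h *ˢ g) k ∎))) n

  *ˢ-C : ∀ f a n → (f *ˢ C a) n ≈ f n * a
  *ˢ-C f a zero    = refl
  *ˢ-C f a (suc n) = trans (+-cong (zeroʳ _) (*ˢ-C (tail f) a n)) (+-identityˡ _)

  0-*ˢ : ∀ {f} g → (∀ n → f n ≈ 0#) → ∀ n → (f *ˢ g) n ≈ 0#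
  0-*ˢ g e zero    = trans (*-congʳ (e 0)) (zeroˡ _)
  0-*ˢ g e (suc n) = trans (+-cong (trans (*-congʳ (e 0)) (zeroˡ _)) (0-*ˢ g (λ k → e (suc k)) n)) (+-identityˡ 0#)

  t-*ˢ : ∀ f n → (t *ˢ f) (suc n) ≈ f n
  t-*ˢ f n = trans (+-congʳ (zeroˡ _)) (trans (+-identityˡ _) (tail-t n))
    where
    tail-t : ∀ n → (tail t *ˢ f) n ≈ f n
    tail-t zero    = *-identityˡ _
    tail-t (suc n) = trans (+-cong (*-identityˡ _) (0-*ˢ f (λ _ → refl) n)) (+-identityʳ _)

  -- The denominator 1 − t y₁ − t² y₂ / (1 − t y₃), with the geometric series expanded.
  denominator : (y₁ y₂ y₃ : Carrier) → Series
  denominator y₁ y₂ y₃ zero          = 1#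
  denominator y₁ y₂ y₃ (suc zero)    = - y₁
  denominator y₁ y₂ y₃ (suc (suc n)) = - (y₂ * y₃ ^ n)

  denominator≈ : ∀ y₁ y₂ y₃ →
    C 1# -ˢ t *ˢ C y₁ -ˢ (t *ˢ t *ˢ C y₂) /ˢ (C 1# -ˢ t *ˢ C y₃) ≈ˢ denominator y₁ y₂ y₃
  denominator≈ y₁ y₂ y₃ = λ where
      zero → begin
        (1# - 0# * y₁) - q 0       ≈⟨ +-cong (1-0y y₁) (-‿cong (q≈tail 0)) ⟩
        1# - 0#                    ≈⟨ x-0 1# ⟩
        1#                         ∎
      (suc zero) → begin
        (0# - (t *ˢ C y₁) 1) - q 1 ≈⟨ +-cong (0-ty y₁) (-‿cong (q≈tail 1)) ⟩
        (- y₁) - 0#                ≈⟨ x-0 (- y₁) ⟩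
        - y₁                       ∎
      (suc (suc n)) → begin
        (0# - (t *ˢ C y₁) (suc (suc n))) - q (suc (suc n))
          ≈⟨ +-cong (0-ty′ y₁ n) (-‿cong (q≈tail (suc (suc n)))) ⟩
        0# - (y₂ * y₃ ^ n)         ≈⟨ +-identityˡ _ ⟩
        - (y₂ * y₃ ^ n)            ∎
    where
    x-0 : ∀ x → x - 0# ≈ x
    x-0 x = trans (+-congˡ -0#≈0#) (+-identityʳ x)

    1-0y : ∀ y → 1# - 0# * y ≈ 1#
    1-0y y = trans (+-congˡ (-‿cong (zeroˡ y))) (x-0 1#)

    0-ty : ∀ y → 0# - (t *ˢ C y) 1 ≈ - y
    0-ty y = trans (+-identityˡ _) (-‿cong (t-*ˢ (C y) 0))

    0-ty′ : ∀ y n → 0# - (t *ˢ C y) (suc (suc n)) ≈ 0#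
    0-ty′ y n = trans (+-identityˡ _) (trans (-‿cong (t-*ˢ (C y) (suc n))) -0#≈0#)

    g tail₂ q : Series
    g = C 1# -ˢ t *ˢ C y₃
    tail₂ (suc (suc n)) = y₂ * y₃ ^ n
    tail₂ _             = 0#
    q = (t *ˢ t *ˢ C y₂) /ˢ g

    -- Multiplication by 1 − t y₃, with the subtracted term moved to the left.
    *ˢ-g : ∀ f n → (f *ˢ g) (suc n) + f n * y₃ ≈ f (suc n)
    *ˢ-g f zero    = begin
      (f 0 * g 1 + f 1 * g 0) + f 0 * y₃
        ≈⟨ +-congʳ (+-cong (*-congˡ (0-ty y₃)) (*-congˡ (1-0y y₃))) ⟩
      (f 0 * - y₃ + f 1 * 1#) + f 0 * y₃
        ≈⟨ solve 4 (λ a b n y → (a :* n :+ b :* con 1) :+ a :* y := b :+ a :* (y :+ n)) refl (f 0) (f 1) (- y₃) y₃ ⟩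
      f 1 + f 0 * (y₃ - y₃) ≈⟨ +-congˡ (trans (*-congˡ (-‿inverseʳ y₃)) (zeroʳ _)) ⟩
      f 1 + 0#              ≈⟨ +-identityʳ _ ⟩
      f 1                   ∎
    *ˢ-g f (suc n) = begin
      (f 0 * g (suc (suc n)) + (tail f *ˢ g) (suc n)) + f (suc n) * y₃
        ≈⟨ +-congʳ (+-congʳ (trans (*-congˡ (0-ty′ y₃ n)) (zeroʳ _))) ⟩
      (0# + (tail f *ˢ g) (suc n)) + f (suc n) * y₃
        ≈⟨ +-congʳ (+-identityˡ _) ⟩
      (tail f *ˢ g) (suc n) + f (suc n) * y₃
        ≈⟨ *ˢ-g (tail f) n ⟩
      f (suc (suc n)) ∎

    tt : ∀ n → (t *ˢ t) n * y₂ + tail₂ (ℕ.pred n) * y₃ ≈ tail₂ n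
    tt zero                = trans (+-cong (trans (*-congʳ (zeroˡ _)) (zeroˡ _)) (zeroˡ _)) (+-identityˡ _)
    tt (suc zero)          = trans (+-cong (trans (*-congʳ (t-*ˢ t 0)) (zeroˡ _)) (zeroˡ _)) (+-identityˡ _)
    tt (suc (suc zero))    = trans (+-cong (trans (*-congʳ (t-*ˢ t 1)) (*-comm _ _)) (zeroˡ _)) (+-identityʳ _)
    tt (suc (suc (suc n))) = trans (+-cong (trans (*-congʳ (t-*ˢ t (2 ℕ.+ n))) (zeroˡ _))
      (solve 3 (λ a b c → a :* c :* b := a :* (b :* c)) refl y₂ y₃ (y₃ ^ n))) (+-identityˡ _)

    q≈tail : q ≈ˢ tail₂
    q≈tail = /ˢ-unique (λ e → 1≉0 (trans (sym (1-0y y₃)) e)) λ where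
      zero    → begin
        0# * g 0                ≈⟨ zeroˡ _ ⟩
        0#                      ≈⟨ trans (*-congʳ (zeroˡ _)) (zeroˡ _) ⟨
        (t *ˢ t *ˢ C y₂) 0      ∎
      (suc n) → +-cancelʳ (tail₂ n * y₃) _ _ (begin
        (tail₂ *ˢ g) (suc n) + tail₂ n * y₃           ≈⟨ *ˢ-g tail₂ n ⟩
        tail₂ (suc n)                                 ≈⟨ tt (suc n) ⟨
        (t *ˢ t) (suc n) * y₂ + tail₂ n * y₃          ≈⟨ +-congʳ (*ˢ-C (t *ˢ t) y₂ (suc n)) ⟨
        (t *ˢ t *ˢ C y₂) (suc n) + tail₂ n * y₃       ∎)

  module _ (y₁ y₂ y₃ : Carrier) (det : y₁ * y₃ ≈ 1# + y₂) where

    -- That is, f times the denominator is f₀ + Σ y₃ⁿ (f₁ − y₁ f₀) tⁿ⁺¹, with the subtracted term moved to the left.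
    *ˢ-denominator : ∀ f → (∀ n → f (suc (suc n)) + f n ≈ (y₁ + y₃) * f (suc n)) → ∀ n →
      (f *ˢ denominator y₁ y₂ y₃) (suc n) + y₃ ^ n * (y₁ * f 0) ≈ y₃ ^ n * f 1
    *ˢ-denominator f rec zero = begin
      (f 0 * - y₁ + f 1 * 1#) + 1# * (y₁ * f 0)
        ≈⟨ solve 4 (λ f₀ f₁ y n → (f₀ :* n :+ f₁ :* con 1) :+ con 1 :* (y :* f₀) :=
                                  con 1 :* f₁ :+ f₀ :* (y :+ n)) refl (f 0) (f 1) y₁ (- y₁) ⟩
      1# * f 1 + f 0 * (y₁ - y₁)
        ≈⟨ +-congˡ (trans (*-congˡ (-‿inverseʳ y₁)) (zeroʳ _)) ⟩
      1# * f 1 + 0#  ≈⟨ +-identityʳ _ ⟩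
      1# * f 1       ∎
    *ˢ-denominator f rec (suc n) = +-cancelʳ (P * (y₂ * f 0) + P * (y₁ * f 1)) _ _ (begin
      ((f 0 * - (y₂ * P) + S) + y₃ * P * (y₁ * f 0)) + (P * (y₂ * f 0) + P * (y₁ * f 1))
        ≈⟨ solve 8 (λ f₀ f₁ y₁ y₂ y₃ P n S →
             ((f₀ :* n :+ S) :+ y₃ :* P :* (y₁ :* f₀)) :+ (P :* (y₂ :* f₀) :+ P :* (y₁ :* f₁)) :=
             f₀ :* (y₂ :* P :+ n) :+ ((S :+ P :* (y₁ :* f₁)) :+ P :* ((y₁ :* y₃) :* f₀)))
             refl (f 0) (f 1) y₁ y₂ y₃ P (- (y₂ * P)) S ⟩
      f 0 * (y₂ * P - y₂ * P) + ((S + P * (y₁ * f 1)) + P * ((y₁ * y₃) * f 0))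
        ≈⟨ +-cong (trans (*-congˡ (-‿inverseʳ _)) (zeroʳ _))
                  (+-cong (*ˢ-denominator (tail f) (λ k → rec (suc k)) n) (*-congˡ (*-congʳ det))) ⟩
      0# + (P * f 2 + P * ((1# + y₂) * f 0))
        ≈⟨ solve 4 (λ f₀ f₂ P y₂ → con 0 :+ (P :* f₂ :+ P :* ((con 1 :+ y₂) :* f₀)) :=
                                   P :* (f₂ :+ f₀) :+ P :* (y₂ :* f₀)) refl (f 0) (f 2) P y₂ ⟩
      P * (f 2 + f 0) + P * (y₂ * f 0)
        ≈⟨ +-congʳ (*-congˡ (rec 0)) ⟩
      P * ((y₁ + y₃) * f 1) + P * (y₂ * f 0)
        ≈⟨ solve 6 (λ f₀ f₁ P y₁ y₂ y₃ → P :* ((y₁ :+ y₃) :* f₁) :+ P :* (y₂ :* f₀) :=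
                    y₃ :* P :* f₁ :+ (P :* (y₂ :* f₀) :+ P :* (y₁ :* f₁))) refl (f 0) (f 1) P y₁ y₂ y₃ ⟩
      y₃ * P * f 1 + (P * (y₂ * f 0) + P * (y₁ * f 1)) ∎)
      where
      P S : Carrier
      P = y₃ ^ n
      S = (tail f *ˢ denominator y₁ y₂ y₃) (suc n)

    continuedFraction-unique : ∀ f →
      (∀ n → f (suc (suc n)) + f n ≈ (y₁ + y₃) * f (suc n)) → f 1 ≈ y₁ * f 0 →
      f ≈ˢ C (f 0) /ˢ (C 1# -ˢ t *ˢ C y₁ -ˢ (t *ˢ t *ˢ C y₂) /ˢ (C 1# -ˢ t *ˢ C y₃))
    continuedFraction-unique f rec f₁ n = sym (trans
      (/ˢ-cong {f = C (f 0)} (λ _ → refl) (denominator≈ y₁ y₂ y₃) n)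
      (/ˢ-unique {g = denominator y₁ y₂ y₃} {h = f} 1≉0 product n))
      where
      product : f *ˢ denominator y₁ y₂ y₃ ≈ˢ C (f 0)
      product zero    = *-identityʳ _
      product (suc n) = begin
        p                     ≈⟨ x≈y+z⇒x-y≈z (+-comm p _) ⟨
        (p + _) - _           ≈⟨ +-congʳ (*ˢ-denominator f rec n) ⟩
        y₃ ^ n * f 1 - y₃ ^ n * (y₁ * f 0) ≈⟨ +-congʳ (*-congˡ f₁) ⟩
        y₃ ^ n * (y₁ * f 0) - y₃ ^ n * (y₁ * f 0) ≈⟨ -‿inverseʳ _ ⟩
        0#                    ∎
        where
        p : Carrier
        p = (f *ˢ denominator y₁ y₂ y₃) (suc n)

module SumProperties (K : DecidableField c ℓ) where
  open DecidableField K
  open Sums K using (sumOver)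
  open SetoidReasoning setoid

  private
    variable
      I J : Set

  sumOver-cong : ∀ {f g : I → Carrier} is → (∀ i → f i ≈ g i) → sumOver is f ≈ sumOver is g
  sumOver-cong []       e = refl
  sumOver-cong (i ∷ is) e = +-cong (e i) (sumOver-cong is e)

  sumOver-++ : ∀ (f : I → Carrier) is js → sumOver (is ++ js) f ≈ sumOver is f + sumOver js f
  sumOver-++ f []       js = sym (+-identityˡ _)
  sumOver-++ f (i ∷ is) js = trans (+-congˡ (sumOver-++ f is js)) (sym (+-assoc _ _ _))

  sumOver-map : ∀ (f : J → Carrier) (g : I → J) is →
                sumOver (List.map g is) f ≈ sumOver is (λ i → f (g i))
  sumOver-map f g []       = refl
  sumOver-map f g (i ∷ is) = +-congˡ (sumOver-map f g is)

  sumOver-*ˡ : ∀ a (f : I → Carrier) is → a * sumOver is f ≈ sumOver is (λ i → a * f i)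
  sumOver-*ˡ a f []       = zeroʳ a
  sumOver-*ˡ a f (i ∷ is) = trans (distribˡ _ _ _) (+-congˡ (sumOver-*ˡ a f is))

  sumOver-cartesianProduct : ∀ (f : I × J → Carrier) is js →
    sumOver (List.cartesianProduct is js) f ≈ sumOver is (λ i → sumOver js (λ j → f (i , j)))
  sumOver-cartesianProduct f []       js = refl
  sumOver-cartesianProduct f (i ∷ is) js = trans
    (sumOver-++ f (List.map (i ,_) js) _)
    (+-cong (sumOver-map f (i ,_) js) (sumOver-cartesianProduct f is js))

module PositiveLaurent (K : DecidableField c ℓ) where
  open DecidableField K
  open Sums K
  open FieldProperties K
  open SumProperties K
  open Mult semiring using (×-assoc-*; ×-comm-*; ×-assocˡ; ×-congʳ)
  open import Algebra.Solver.Ring.NaturalCoefficients.Default commutativeSemiring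
    using (solve; _:=_; _:*_)
  open SetoidReasoning setoid

  module _ {u v : Carrier} where

    Positive : Carrier → Set ℓ
    Positive = IsPositiveLaurentIn u v

    positive-resp : ∀ {x y} → x ≈ y → Positive x → Positive y
    positive-resp x≈y (ts , e) = ts , trans (sym x≈y) e

    0-positive : Positive 0#
    0-positive = [] , refl

    monomial-positive : ∀ i j → Positive (u ^ᶻ i * v ^ᶻ j)
    monomial-positive i j = ((1 , i , j) ∷ []) , sym (trans (+-identityʳ _) (+-identityʳ _))

    +-positive : ∀ {x y} → Positive x → Positive y → Positive (x + y)
    +-positive (ts , e) (ts′ , e′) = ts ++ ts′ , trans (+-cong e e′) (sym (sumOver-++ _ ts ts′))

    module _ (u≉0 : ¬ u ≈ 0#) (v≉0 : ¬ v ≈ 0#) where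

      private
        Term : Set
        Term = ℕ × ℤ × ℤ

        ⟦_⟧ : Term → Carrier
        ⟦ c , i , j ⟧ = c • (u ^ᶻ i * v ^ᶻ j)

        _*ₜ_ : Term → Term → Term
        (c , i , j) *ₜ (c′ , i′ , j′) = c ℕ.* c′ , i ℤ.+ i′ , j ℤ.+ j′

        ⟦⟧-homo-* : ∀ s t → ⟦ s *ₜ t ⟧ ≈ ⟦ s ⟧ * ⟦ t ⟧
        ⟦⟧-homo-* (c , i , j) (c′ , i′ , j′) = begin
          (c ℕ.* c′) • (u ^ᶻ (i ℤ.+ i′) * v ^ᶻ (j ℤ.+ j′))
            ≈⟨ ×-congʳ (c ℕ.* c′) (*-cong (^ᶻ-homo-+ u≉0 i i′) (^ᶻ-homo-+ v≉0 j j′)) ⟩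
          (c ℕ.* c′) • ((u ^ᶻ i * u ^ᶻ i′) * (v ^ᶻ j * v ^ᶻ j′))
            ≈⟨ ×-congʳ (c ℕ.* c′) (solve 4 (λ a b c d → (a :* b) :* (c :* d) := (a :* c) :* (b :* d)) refl _ _ _ _) ⟩
          (c ℕ.* c′) • ((u ^ᶻ i * v ^ᶻ j) * (u ^ᶻ i′ * v ^ᶻ j′))
            ≈⟨ ×-assocˡ _ c c′ ⟨
          c • (c′ • ((u ^ᶻ i * v ^ᶻ j) * (u ^ᶻ i′ * v ^ᶻ j′)))
            ≈⟨ ×-congʳ c (×-comm-* c′ _ _) ⟨
          c • ((u ^ᶻ i * v ^ᶻ j) * (c′ • (u ^ᶻ i′ * v ^ᶻ j′)))
            ≈⟨ ×-assoc-* c _ _ ⟨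
          ⟦ c , i , j ⟧ * ⟦ c′ , i′ , j′ ⟧ ∎

        *-distrib-sum : ∀ ss ts →
          sumOver (List.cartesianProductWith _*ₜ_ ss ts) ⟦_⟧ ≈ sumOver ss ⟦_⟧ * sumOver ts ⟦_⟧
        *-distrib-sum []       ts = sym (zeroˡ _)
        *-distrib-sum (s ∷ ss) ts = begin
          sumOver (List.map (s *ₜ_) ts ++ _) ⟦_⟧
            ≈⟨ sumOver-++ ⟦_⟧ (List.map (s *ₜ_) ts) _ ⟩
          sumOver (List.map (s *ₜ_) ts) ⟦_⟧ + _
            ≈⟨ +-cong (trans (sumOver-map ⟦_⟧ (s *ₜ_) ts)
                 (trans (sumOver-cong ts (⟦⟧-homo-* s)) (sym (sumOver-*ˡ ⟦ s ⟧ ⟦_⟧ ts)))) (*-distrib-sum ss ts) ⟩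
          ⟦ s ⟧ * sumOver ts ⟦_⟧ + sumOver ss ⟦_⟧ * sumOver ts ⟦_⟧
            ≈⟨ distribʳ _ _ _ ⟨
          (⟦ s ⟧ + sumOver ss ⟦_⟧) * sumOver ts ⟦_⟧ ∎

      *-positive : ∀ {x y} → Positive x → Positive y → Positive (x * y)
      *-positive (ts , e) (ts′ , e′) =
        List.cartesianProductWith _*ₜ_ ts ts′ , trans (*-cong e e′) (sym (*-distrib-sum ts ts′))

      1-positive : Positive 1#
      1-positive = positive-resp (*-identityˡ _) (monomial-positive (+ 0) (+ 0))

      u-positive : Positive u
      u-positive = positive-resp (trans (*-identityʳ _) (*-identityʳ _)) (monomial-positive (+ 1) (+ 0))

      v-positive : Positive v
      v-positive = positive-resp (trans (*-identityˡ _) (*-identityʳ _)) (monomial-positive (+ 0) (+ 1))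

      u⁻¹-positive : Positive (u ⁻¹)
      u⁻¹-positive = positive-resp (trans (*-identityʳ _) (*-identityʳ _)) (monomial-positive -[1+ 0 ] (+ 0))

      v⁻¹-positive : Positive (v ⁻¹)
      v⁻¹-positive = positive-resp (trans (*-identityˡ _) (*-identityʳ _)) (monomial-positive (+ 0) -[1+ 0 ])

      ^-positive : ∀ {x} n → Positive x → Positive (x ^ n)
      ^-positive zero    p = 1-positive
      ^-positive (suc n) p = *-positive p (^-positive n p)

  swap-positive : ∀ {u v x} → IsPositiveLaurentIn u v x → IsPositiveLaurentIn v u x
  swap-positive {u} {v} {x} (ts , e) = List.map swap ts , (begin
    x                                                ≈⟨ e ⟩
    _                                                ≈⟨ sumOver-cong ts (λ (c , i , j) → ×-congʳ c (*-comm _ _)) ⟩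
    sumOver ts _                                     ≈⟨ sumOver-map _ swap ts ⟨
    sumOver (List.map swap ts) _                     ∎)
    where
    swap : ℕ × ℤ × ℤ → ℕ × ℤ × ℤ
    swap (c , i , j) = c , j , i

  -- An orbit written in a and x₁, where a = x₀ or a = x₂.
  module _ {a x₁ e y₁ y₂ y₃ : Carrier} (a≉0 : ¬ a ≈ 0#) (x₁≉0 : ¬ x₁ ≈ 0#)
           (det   : y₁ * y₃ ≈ 1# + y₂)
           (trace : (a * a) * y₂ ≈ y₁ + y₃)
           (first : (a * a) * y₁ ≈ 1# + e)
           (e⁺  : Positive {a} {x₁} e) (y₁⁺ : Positive {a} {x₁} y₁)
           (y₂⁺ : Positive {a} {x₁} y₂) (y₃⁺ : Positive {a} {x₁} y₃) where
    open Transfer commutativeSemiring y₁ y₂ y₃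
    open Orbits.Orbit commutativeSemiring a e y₁ y₂ y₃ det trace first using (E; W)

    private
      infixl 6 _⊕_
      infixl 7 _⊛_
      _⊕_ : ∀ {x y} → Positive {a} {x₁} x → Positive {a} {x₁} y → Positive {a} {x₁} (x + y)
      _⊕_ = +-positive
      _⊛_ : ∀ {x y} → Positive {a} {x₁} x → Positive {a} {x₁} y → Positive {a} {x₁} (x * y)
      _⊛_ = *-positive a≉0 x₁≉0

    A-positive : ∀ n → Positive {a} {x₁} (A n)
    B-positive : ∀ n → Positive {a} {x₁} (B n)
    A-positive zero    = 1-positive a≉0 x₁≉0
    A-positive (suc n) = y₁⁺ ⊛ A-positive n ⊕ y₂⁺ ⊛ B-positive n
    B-positive zero    = 0-positive
    B-positive (suc n) = A-positive n ⊕ y₃⁺ ⊛ B-positive n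

    D-positive : ∀ n → Positive {a} {x₁} (D n)
    D-positive zero    = 1-positive a≉0 x₁≉0
    D-positive (suc n) = y₂⁺ ⊛ B-positive n ⊕ y₃⁺ ⊛ D-positive n

    E-positive : ∀ n → Positive {a} {x₁} (E n)
    E-positive zero    = e⁺
    E-positive (suc n) = y₁⁺ ⊛ E-positive n ⊕ (y₁⁺ ⊕ y₁⁺) ⊛ D-positive n ⊕ e⁺ ⊛ y₂⁺ ⊛ B-positive n

    W-positive : ∀ n → Positive {a} {x₁} (W n)
    W-positive n = A-positive n ⊛ E-positive n ⊕ y₂⁺ ⊛ (B-positive n ⊛ B-positive n)

module ClusterSequences (K : DecidableField c ℓ) where
  open DecidableField K

  module ClusterSequence
    (x : ℤ → Carrier)
    (even : ∀ n → x (+ 2 ℤ.* n) * x (+ 2 ℤ.* n ℤ.- + 2) ≈ 1# + x (+ 2 ℤ.* n ℤ.- + 1))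
    (odd  : ∀ n → x (+ 2 ℤ.* n ℤ.+ + 1) * x (+ 2 ℤ.* n ℤ.- + 1) ≈ 1# + x (+ 2 ℤ.* n) ^ 4)
    where
    open import Algebra.Solver.Ring.NaturalCoefficients.Default commutativeSemiring
    open import Algebra.Properties.CommutativeSemiring.Exp commutativeSemiring using (^-congˡ)
    open import Algebra.Properties.Ring ring using (+-cancelʳ)
    open FieldProperties K
    open Division K using (continuedFraction-unique; x≈y+z⇒x-y≈z)
    open PowerSeries K
    open Sums K
    open PositiveLaurent K hiding (Positive)
    open SetoidReasoning setoid

    z w : ℕ → Carrier
    z n = x (+ (2 ℕ.* n))
    w n = x (+ (2 ℕ.* n ℕ.+ 1))

    private
      2[1+n] : ∀ n → + 2 ℤ.* + suc n ≡ + (2 ℕ.* suc n)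
      2[1+n] n = ≡.sym (ℤ.pos-* 2 (suc n))

      2[1+n]-2 : ∀ n → + 2 ℤ.* + suc n ℤ.- + 2 ≡ + (2 ℕ.* n)
      2[1+n]-2 n = ≡.trans (lemma (+ n)) (≡.sym (ℤ.pos-* 2 n))
        where
        lemma : ∀ n → + 2 ℤ.* (+ 1 ℤ.+ n) ℤ.- + 2 ≡ + 2 ℤ.* n
        lemma = ℤ-solve-∀

      2[1+n]-1 : ∀ n → + 2 ℤ.* + suc n ℤ.- + 1 ≡ + (2 ℕ.* n ℕ.+ 1)
      2[1+n]-1 n = ≡.trans (lemma (+ n)) (≡.cong (ℤ._+ + 1) (≡.sym (ℤ.pos-* 2 n)))
        where
        lemma : ∀ n → + 2 ℤ.* (+ 1 ℤ.+ n) ℤ.- + 1 ≡ + 2 ℤ.* n ℤ.+ + 1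
        lemma = ℤ-solve-∀

    z-recurrence : ∀ n → z (suc n) * z n ≈ 1# + w n
    z-recurrence n = begin
      z (suc n) * z n  ≡⟨ ≡.cong₂ (λ i j → x i * x j) (2[1+n] n) (2[1+n]-2 n) ⟨
      _                ≈⟨ even (+ suc n) ⟩
      _                ≡⟨ ≡.cong (λ i → 1# + x i) (2[1+n]-1 n) ⟩
      1# + w n         ∎

    w-recurrence : ∀ n → w (suc n) * w n ≈ 1# + z (suc n) ^ 4
    w-recurrence n = begin
      w (suc n) * w n  ≡⟨ ≡.cong₂ (λ i j → x i * x j) (≡.cong (ℤ._+ + 1) (2[1+n] n)) (2[1+n]-1 n) ⟨
      _                ≈⟨ odd (+ suc n) ⟩
      _                ≡⟨ ≡.cong (λ i → 1# + x i ^ 4) (2[1+n] n) ⟩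
      1# + z (suc n) ^ 4 ∎

    private
      x₀ x₁ x₂ x₃ : Carrier
      x₀ = x (+ 0)
      x₁ = x (+ 1)
      x₂ = x (+ 2)
      x₃ = x (+ 3)

    module Solution (z≉0 : ∀ n → ¬ z n ≈ 0#) (w≉0 : ∀ n → ¬ w n ≈ 0#) where

      w≈zz-1 : ∀ n → w n ≈ z n * x (+ (2 ℕ.* n ℕ.+ 2)) - 1#
      w≈zz-1 n = sym (x≈y+z⇒x-y≈z (begin
        z n * x (+ (2 ℕ.* n ℕ.+ 2)) ≡⟨ ≡.cong (λ k → z n * x (+ k)) (≡.trans (ℕ.+-comm (2 ℕ.* n) 2) (≡.sym (ℕ.*-suc 2 n))) ⟩
        z n * z (suc n)             ≈⟨ *-comm _ _ ⟩
        z (suc n) * z n             ≈⟨ z-recurrence n ⟩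
        1# + w n                    ∎))

      module FromOrbit (k : ℕ) (y₁ y₂ y₃ : Carrier)
               (det   : y₁ * y₃ ≈ 1# + y₂)
               (trace : (z k * z k) * y₂ ≈ y₁ + y₃)
               (first : (z k * z k) * y₁ ≈ 1# + w k) where
        open Transfer commutativeSemiring y₁ y₂ y₃ public
        open Orbits.Orbit commutativeSemiring (z k) (w k) y₁ y₂ y₃ det trace first

        z≈aA : ∀ n → z (k ℕ.+ n) ≈ z k * A n
        w≈W  : ∀ n → w (k ℕ.+ n) ≈ W n
        z≈aA zero    = trans (reflexive (≡.cong z (ℕ.+-identityʳ k))) (sym (*-identityʳ _))
        z≈aA (suc n) = trans (reflexive (≡.cong z (ℕ.+-suc k n))) (*-cancelʳ (z≉0 (k ℕ.+ n)) (begin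
          z (suc (k ℕ.+ n)) * z (k ℕ.+ n) ≈⟨ z-recurrence (k ℕ.+ n) ⟩
          1# + w (k ℕ.+ n)                ≈⟨ +-congˡ (w≈W n) ⟩
          1# + W n                        ≈⟨ aAaA′≈1+W n ⟨
          (z k * A (suc n)) * (z k * A n) ≈⟨ *-congˡ (z≈aA n) ⟨
          (z k * A (suc n)) * z (k ℕ.+ n) ∎))
        w≈W zero    = trans (reflexive (≡.cong w (ℕ.+-identityʳ k))) (sym
          (solve 2 (λ e y → con 1 :* e :+ y :* (con 0 :* con 0) := e) refl (w k) y₂))
        w≈W (suc n) = trans (reflexive (≡.cong w (ℕ.+-suc k n))) (*-cancelʳ (w≉0 (k ℕ.+ n)) (begin
          w (suc (k ℕ.+ n)) * w (k ℕ.+ n) ≈⟨ w-recurrence (k ℕ.+ n) ⟩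
          1# + z (suc (k ℕ.+ n)) ^ 4      ≡⟨ ≡.cong (λ i → 1# + z i ^ 4) (ℕ.+-suc k n) ⟨
          1# + z (k ℕ.+ suc n) ^ 4        ≈⟨ +-congˡ (^-congˡ 4 (z≈aA (suc n))) ⟩
          1# + (z k * A (suc n)) ^ 4      ≈⟨ +-cancelʳ _ _ _ (W′W≈1+[aA′]⁴ n) ⟨
          W (suc n) * W n                 ≈⟨ *-congˡ (w≈W n) ⟨
          W (suc n) * w (k ℕ.+ n)         ∎))

        z-linear : ∀ n → z (k ℕ.+ suc (suc n)) + z (k ℕ.+ n) ≈ (y₁ + y₃) * z (k ℕ.+ suc n)
        z-linear n = begin
          z (k ℕ.+ suc (suc n)) + z (k ℕ.+ n)     ≈⟨ +-cong (z≈aA (suc (suc n))) (z≈aA n) ⟩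
          z k * A (suc (suc n)) + z k * A n       ≈⟨ distribˡ _ _ _ ⟨
          z k * (A (suc (suc n)) + A n)           ≈⟨ *-congˡ (A+A″≈tA′ n) ⟩
          z k * ((y₁ + y₃) * A (suc n))           ≈⟨ solve 3 (λ a y A → a :* (y :* A) := y :* (a :* A)) refl (z k) (y₁ + y₃) (A (suc n)) ⟩
          (y₁ + y₃) * (z k * A (suc n))           ≈⟨ *-congˡ (z≈aA (suc n)) ⟨
          (y₁ + y₃) * z (k ℕ.+ suc n)             ∎

        continuedFraction : (λ n → z (k ℕ.+ n)) ≈ˢ
          C (z k) /ˢ (C 1# -ˢ t *ˢ C y₁ -ˢ (t *ˢ t *ˢ C y₂) /ˢ (C 1# -ˢ t *ˢ C y₃))
        continuedFraction n = trans
          (continuedFraction-unique y₁ y₂ y₃ det (λ n → z (k ℕ.+ n)) z-linear (begin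
            z (k ℕ.+ 1)       ≈⟨ z≈aA 1 ⟩
            z k * (y₁ * 1# + y₂ * 0#)
              ≈⟨ solve 3 (λ a y₁ y₂ → a :* (y₁ :* con 1 :+ y₂ :* con 0) := y₁ :* a) refl (z k) y₁ y₂ ⟩
            y₁ * z k          ≡⟨ ≡.cong (λ i → y₁ * z i) (ℕ.+-identityʳ k) ⟨
            y₁ * z (k ℕ.+ 0)  ∎) n)
          (reflexive (≡.cong (λ i → (C (z i) /ˢ _) n) (ℕ.+-identityʳ k)))

        w-positive : let Positive = IsPositiveLaurentIn (z k) x₁ in
          Positive (w k) → Positive y₁ → Positive y₂ → Positive y₃ →
          ∀ n → Positive (w (k ℕ.+ n))
        w-positive w⁺ y₁⁺ y₂⁺ y₃⁺ n = positive-resp (sym (w≈W n))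
          (W-positive (z≉0 k) (w≉0 0) det trace first w⁺ y₁⁺ y₂⁺ y₃⁺ n)

      -- The three fractions attached to a ∈ {x₀ , x₂}: p and s are y₁ and y₃ up to order.
      module Weights (a : Carrier) (a≉0 : ¬ a ≈ 0#) where
        p q s : Carrier
        p = (1# + x₁) ÷ a ^ 2
        q = (a ^ 4 + (1# + x₁) ^ 2) ÷ (a ^ 4 * x₁)
        s = (a ^ 4 + 1# + x₁) ÷ (a ^ 2 * x₁)

        pa² : p * a ^ 2 ≈ 1# + x₁
        pa² = x÷y*y≈x _ (^-≉0 2 a≉0)

        qa⁴x₁ : q * (a ^ 4 * x₁) ≈ a ^ 4 + (1# + x₁) ^ 2
        qa⁴x₁ = x÷y*y≈x _ (*-≉0 (^-≉0 4 a≉0) (w≉0 0))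

        sa²x₁ : s * (a ^ 2 * x₁) ≈ a ^ 4 + 1# + x₁
        sa²x₁ = x÷y*y≈x _ (*-≉0 (^-≉0 2 a≉0) (w≉0 0))

        a²p≈1+x₁ : (a * a) * p ≈ 1# + x₁
        a²p≈1+x₁ = trans (solve 2 (λ a p → (a :* a) :* p := p :* (a :^ 2)) refl a p) pa²

        ps≈1+q : p * s ≈ 1# + q
        ps≈1+q = *-cancelʳ (*-≉0 (^-≉0 4 a≉0) (w≉0 0)) (begin
          p * s * (a ^ 4 * x₁)
            ≈⟨ solve 4 (λ p s a x → p :* s :* (a :^ 4 :* x) := (p :* a :^ 2) :* (s :* (a :^ 2 :* x))) refl p s a x₁ ⟩
          (p * a ^ 2) * (s * (a ^ 2 * x₁))   ≈⟨ *-cong pa² sa²x₁ ⟩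
          (1# + x₁) * (a ^ 4 + 1# + x₁)
            ≈⟨ solve 2 (λ a x → (con 1 :+ x) :* (a :^ 4 :+ con 1 :+ x) := a :^ 4 :* x :+ (a :^ 4 :+ (con 1 :+ x) :^ 2)) refl a x₁ ⟩
          a ^ 4 * x₁ + (a ^ 4 + (1# + x₁) ^ 2) ≈⟨ +-congˡ qa⁴x₁ ⟨
          a ^ 4 * x₁ + q * (a ^ 4 * x₁)
            ≈⟨ solve 2 (λ d q → d :+ q :* d := (con 1 :+ q) :* d) refl (a ^ 4 * x₁) q ⟩
          (1# + q) * (a ^ 4 * x₁) ∎)

        a²q≈p+s : (a * a) * q ≈ p + s
        a²q≈p+s = *-cancelʳ (*-≉0 (^-≉0 2 a≉0) (w≉0 0)) (begin
          (a * a) * q * (a ^ 2 * x₁)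
            ≈⟨ solve 3 (λ q a x → (a :* a) :* q :* (a :^ 2 :* x) := q :* (a :^ 4 :* x)) refl q a x₁ ⟩
          q * (a ^ 4 * x₁) ≈⟨ qa⁴x₁ ⟩
          a ^ 4 + (1# + x₁) ^ 2
            ≈⟨ solve 2 (λ a x → a :^ 4 :+ (con 1 :+ x) :^ 2 := (con 1 :+ x) :* x :+ (a :^ 4 :+ con 1 :+ x)) refl a x₁ ⟩
          (1# + x₁) * x₁ + (a ^ 4 + 1# + x₁) ≈⟨ +-cong (*-congʳ pa²) sa²x₁ ⟨
          (p * a ^ 2) * x₁ + s * (a ^ 2 * x₁)
            ≈⟨ solve 4 (λ p s a x → (p :* a :^ 2) :* x :+ s :* (a :^ 2 :* x) := (p :+ s) :* (a :^ 2 :* x)) refl p s a x₁ ⟩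
          (p + s) * (a ^ 2 * x₁) ∎)

        a²s≈1+x₃ : ∀ {x₃} → x₃ * x₁ ≈ 1# + a ^ 4 → (a * a) * s ≈ 1# + x₃
        a²s≈1+x₃ {x₃} e = *-cancelʳ (w≉0 0) (begin
          (a * a) * s * x₁
            ≈⟨ solve 3 (λ s a x → (a :* a) :* s :* x := s :* (a :^ 2 :* x)) refl s a x₁ ⟩
          s * (a ^ 2 * x₁)       ≈⟨ sa²x₁ ⟩
          a ^ 4 + 1# + x₁        ≈⟨ solve 2 (λ f x → f :+ con 1 :+ x := x :+ (con 1 :+ f)) refl (a ^ 4) x₁ ⟩
          x₁ + (1# + a ^ 4)      ≈⟨ +-congˡ e ⟨
          x₁ + x₃ * x₁           ≈⟨ solve 2 (λ x y → x :+ y :* x := (con 1 :+ y) :* x) refl x₁ x₃ ⟩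
          (1# + x₃) * x₁         ∎)

        i j : Carrier
        i = a ⁻¹
        j = x₁ ⁻¹

        ai≈1 : a * i ≈ 1#
        ai≈1 = ⁻¹-inverseʳ a≉0

        x₁j≈1 : x₁ * j ≈ 1#
        x₁j≈1 = ⁻¹-inverseʳ (w≉0 0)

        p≈ : p ≈ (1# + x₁) * i ^ 2
        p≈ = ÷-unique (^-≉0 2 a≉0) (begin
          (1# + x₁) * i ^ 2 * a ^ 2
            ≈⟨ solve 3 (λ u i a → u :* i :^ 2 :* a :^ 2 := u :* (a :* i) :^ 2) refl (1# + x₁) i a ⟩
          (1# + x₁) * (a * i) ^ 2 ≈⟨ *-congˡ (^-congˡ 2 ai≈1) ⟩
          (1# + x₁) * 1# ^ 2      ≈⟨ solve 1 (λ u → u :* con 1 :^ 2 := u) refl (1# + x₁) ⟩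
          1# + x₁                 ∎)

        q≈ : q ≈ (1# + (1# + x₁) ^ 2 * i ^ 4) * j
        q≈ = ÷-unique (*-≉0 (^-≉0 4 a≉0) (w≉0 0)) (begin
          (1# + (1# + x₁) ^ 2 * i ^ 4) * j * (a ^ 4 * x₁)
            ≈⟨ solve 5 (λ u i j a x → (con 1 :+ u :^ 2 :* i :^ 4) :* j :* (a :^ 4 :* x) :=
                 (a :^ 4 :+ u :^ 2 :* (a :* i) :^ 4) :* (x :* j)) refl (1# + x₁) i j a x₁ ⟩
          (a ^ 4 + (1# + x₁) ^ 2 * (a * i) ^ 4) * (x₁ * j)
            ≈⟨ *-cong (+-congˡ (*-congˡ (^-congˡ 4 ai≈1))) x₁j≈1 ⟩
          (a ^ 4 + (1# + x₁) ^ 2 * 1# ^ 4) * 1#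
            ≈⟨ solve 2 (λ u a → (a :^ 4 :+ u :^ 2 :* con 1 :^ 4) :* con 1 := a :^ 4 :+ u :^ 2) refl (1# + x₁) a ⟩
          a ^ 4 + (1# + x₁) ^ 2   ∎)

        s≈ : s ≈ (1# + (1# + x₁) * i ^ 4) * a ^ 2 * j
        s≈ = ÷-unique (*-≉0 (^-≉0 2 a≉0) (w≉0 0)) (begin
          (1# + (1# + x₁) * i ^ 4) * a ^ 2 * j * (a ^ 2 * x₁)
            ≈⟨ solve 4 (λ i j a x → (con 1 :+ (con 1 :+ x) :* i :^ 4) :* a :^ 2 :* j :* (a :^ 2 :* x) :=
                 (a :^ 4 :+ (con 1 :+ x) :* (a :* i) :^ 4) :* (x :* j)) refl i j a x₁ ⟩
          (a ^ 4 + (1# + x₁) * (a * i) ^ 4) * (x₁ * j)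
            ≈⟨ *-cong (+-congˡ (*-congˡ (^-congˡ 4 ai≈1))) x₁j≈1 ⟩
          (a ^ 4 + (1# + x₁) * 1# ^ 4) * 1#
            ≈⟨ solve 2 (λ x a → (a :^ 4 :+ (con 1 :+ x) :* con 1 :^ 4) :* con 1 := a :^ 4 :+ con 1 :+ x) refl x₁ a ⟩
          a ^ 4 + 1# + x₁         ∎)

        private
          Positive : Carrier → Set ℓ
          Positive = IsPositiveLaurentIn a x₁

          infixl 6 _⊕_
          infixl 7 _⊛_
          infixr 8 _^⁺_
          _⊕_ : ∀ {y z} → Positive y → Positive z → Positive (y + z)
          _⊕_ = +-positive
          _⊛_ : ∀ {y z} → Positive y → Positive z → Positive (y * z)
          _⊛_ = *-positive a≉0 (w≉0 0)
          _^⁺_ : ∀ {y} → Positive y → ∀ n → Positive (y ^ n)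
          y⁺ ^⁺ n = ^-positive a≉0 (w≉0 0) n y⁺

          1⁺ : Positive 1#
          1⁺ = 1-positive a≉0 (w≉0 0)
          a⁺ : Positive a
          a⁺ = u-positive a≉0 (w≉0 0)
          i⁺ : Positive i
          i⁺ = u⁻¹-positive a≉0 (w≉0 0)
          j⁺ : Positive j
          j⁺ = v⁻¹-positive a≉0 (w≉0 0)

        x₁-positive : Positive x₁
        x₁-positive = v-positive a≉0 (w≉0 0)

        p-positive : Positive p
        p-positive = positive-resp (sym p≈) ((1⁺ ⊕ x₁-positive) ⊛ i⁺ ^⁺ 2)

        q-positive : Positive q
        q-positive = positive-resp (sym q≈) ((1⁺ ⊕ (1⁺ ⊕ x₁-positive) ^⁺ 2 ⊛ i⁺ ^⁺ 4) ⊛ j⁺)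

        s-positive : Positive s
        s-positive = positive-resp (sym s≈) ((1⁺ ⊕ (1⁺ ⊕ x₁-positive) ⊛ i⁺ ^⁺ 4) ⊛ a⁺ ^⁺ 2 ⊛ j⁺)

        x₃-positive : ∀ {x₃} → x₃ * x₁ ≈ 1# + a ^ 4 → Positive x₃
        x₃-positive {x₃} e = positive-resp (begin
            (1# + a ^ 4) * j  ≈⟨ *-congʳ e ⟨
            x₃ * x₁ * j       ≈⟨ *-assoc _ _ _ ⟩
            x₃ * (x₁ * j)     ≈⟨ *-congˡ x₁j≈1 ⟩
            x₃ * 1#           ≈⟨ *-identityʳ x₃ ⟩
            x₃                ∎) ((1⁺ ⊕ a⁺ ^⁺ 4) ⊛ j⁺)
      module F₀ = Weights x₀ (z≉0 0)
      module F₂ = Weights x₂ (z≉0 1)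

      module Orbit₀ = FromOrbit 0 F₀.p F₀.q F₀.s F₀.ps≈1+q F₀.a²q≈p+s F₀.a²p≈1+x₁

      module Orbit₂ = FromOrbit 1 F₂.s F₂.q F₂.p (trans (*-comm _ _) F₂.ps≈1+q)
        (trans F₂.a²q≈p+s (+-comm _ _)) (F₂.a²s≈1+x₃ (w-recurrence 0))

      w-positive₀ : ∀ n → IsPositiveLaurentIn x₀ x₁ (w n)
      w-positive₀ = Orbit₀.w-positive F₀.x₁-positive F₀.p-positive F₀.q-positive F₀.s-positive

      w-positive₂ : ∀ n → IsPositiveLaurentIn x₁ x₂ (w n)
      w-positive₂ zero    = swap-positive F₂.x₁-positive
      w-positive₂ (suc n) = swap-positive (Orbit₂.w-positive (F₂.x₃-positive (w-recurrence 0))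
        F₂.s-positive F₂.q-positive F₂.p-positive n)

multinomial-yes : ∀ N ms X → All (0ℤ ℤ.≤_) ms → sumℤ ms ℤ.≤ N →
                  X ℕ.* ∏! (N ℤ.- sumℤ ms ∷ ms) ≡ ℤ.∣ N ∣ ! → multinomial N ms ≡ X
multinomial-yes N ms X ms≥0 Σ≤N e
  with all? (0ℤ ℤ.≤?_) ms ×-dec (sumℤ ms ℤ.≤? N)
     | (N ℤ.≟ -1ℤ) ×-dec all? (ℤ._≟ 0ℤ) ms
... | yes _ | _ = ≡.trans (/-congˡ {{∏!≢0 (N ℤ.- sumℤ ms ∷ ms)}} (≡.sym e))
                          (m*n/n≡m X (∏! (N ℤ.- sumℤ ms ∷ ms)) {{∏!≢0 (N ℤ.- sumℤ ms ∷ ms)}})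
... | no n  | _ = contradiction (ms≥0 , Σ≤N) n

multinomial-no : ∀ N ms → ¬ (All (0ℤ ℤ.≤_) ms × sumℤ ms ℤ.≤ N) → ¬ (N ≡ -1ℤ × All (_≡ 0ℤ) ms) →
                 multinomial N ms ≡ 0
multinomial-no N ms n n′
  with all? (0ℤ ℤ.≤?_) ms ×-dec (sumℤ ms ℤ.≤? N)
     | (N ℤ.≟ -1ℤ) ×-dec all? (ℤ._≟ 0ℤ) ms
... | yes y | _      = contradiction y n
... | no _  | yes y′ = contradiction y′ n′
... | no _  | no _   = ≡.refl

multinomial-≡0 : ∀ N ms → ¬ (All (0ℤ ℤ.≤_) ms × sumℤ ms ℤ.≤ + N) → multinomial (+ N) ms ≡ 0
multinomial-≡0 N ms n = multinomial-no (+ N) ms n (λ ())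

[h+a]Ca*a!*h! : ∀ h a → ((h ℕ.+ a) C a) ℕ.* (a ! ℕ.* h !) ≡ (h ℕ.+ a) !
[h+a]Ca*a!*h! h a = begin
  (n C a) ℕ.* (a ! ℕ.* h !)         ≡⟨ ≡.cong (λ i → (n C a) ℕ.* (a ! ℕ.* i !)) (≡.sym (ℕ.m+n∸n≡m h a)) ⟩
  (n C a) ℕ.* (a ! ℕ.* (n ℕ.∸ a) !) ≡⟨ ≡.cong (ℕ._* (a ! ℕ.* (n ℕ.∸ a) !)) (nCk≡n!/k![n-k]! a≤n) ⟩
  (n ! ℕ./ (a ! ℕ.* (n ℕ.∸ a) !)) ℕ.* (a ! ℕ.* (n ℕ.∸ a) !) ≡⟨ m/n*n≡m (k![n∸k]!∣n! a≤n) ⟩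
  n ! ∎
  where
  open ≡.≡-Reasoning
  n : ℕ
  n = h ℕ.+ a
  a≤n : a ℕ.≤ n
  a≤n = ℕ.m≤n+m a h
  instance
    _ = a ℕ.!* (n ℕ.∸ a) !≢0

private
  h+s-s≡h : ∀ h s → (h ℤ.+ s) ℤ.- s ≡ h
  h+s-s≡h = ℤ-solve-∀

data SubtractionView (k j : ℕ) : Set where
  below : k ℕ.< j → SubtractionView k j
  above : ∀ i → k ≡ i ℕ.+ j → SubtractionView k j

subtractionView : ∀ k j → SubtractionView k j
subtractionView k j with j ℕ.≤? k
... | yes j≤k = above (k ℕ.∸ j) (≡.sym (ℕ.m∸n+n≡m j≤k))
... | no  j≰k = below (ℕ.≰⇒> j≰k)

multinomial₁ : ∀ N m → multinomial (+ N) (+ m ∷ []) ≡ N C m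
multinomial₁ N m with subtractionView N m
... | below N<m = ≡.trans
  (multinomial-≡0 N (+ m ∷ []) λ (_ , m≤N) →
    ℕ.<⇒≱ N<m (≡.subst (ℕ._≤ N) (ℕ.+-identityʳ m) (ℤ.drop‿+≤+ m≤N)))
  (≡.sym (k>n⇒nCk≡0 N<m))
... | above h ≡.refl = multinomial-yes (+ (h ℕ.+ m)) (+ m ∷ []) ((h ℕ.+ m) C m)
  (ℤ.+≤+ ℕ.z≤n ∷ []) (ℤ.+≤+ (≡.subst (ℕ._≤ h ℕ.+ m) (≡.sym (ℕ.+-identityʳ m)) (ℕ.m≤n+m m h))) (begin
    ((h ℕ.+ m) C m) ℕ.* (ℤ.∣ + (h ℕ.+ m) ℤ.- + (m ℕ.+ 0) ∣ ! ℕ.* (m ! ℕ.* 1))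
      ≡⟨ ≡.cong (λ i → ((h ℕ.+ m) C m) ℕ.* (ℤ.∣ + (h ℕ.+ m) ℤ.- + i ∣ ! ℕ.* (m ! ℕ.* 1))) (ℕ.+-identityʳ m) ⟩
    ((h ℕ.+ m) C m) ℕ.* (ℤ.∣ + h ℤ.+ + m ℤ.- + m ∣ ! ℕ.* (m ! ℕ.* 1))
      ≡⟨ ≡.cong (λ i → ((h ℕ.+ m) C m) ℕ.* (ℤ.∣ i ∣ ! ℕ.* (m ! ℕ.* 1))) (h+s-s≡h (+ h) (+ m)) ⟩
    ((h ℕ.+ m) C m) ℕ.* (h ! ℕ.* (m ! ℕ.* 1))
      ≡⟨ lemma ((h ℕ.+ m) C m) (h !) (m !) ⟩
    ((h ℕ.+ m) C m) ℕ.* (m ! ℕ.* h !) ≡⟨ [h+a]Ca*a!*h! h m ⟩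
    (h ℕ.+ m) ! ∎)
  where
  open ≡.≡-Reasoning
  lemma : ∀ x h m → x ℕ.* (h ℕ.* (m ℕ.* 1)) ≡ x ℕ.* (m ℕ.* h)
  lemma = ℕ-solve-∀

k<j⇒k-j≱0 : ∀ {k j} → k ℕ.< j → ¬ 0ℤ ℤ.≤ + k ℤ.- + j
k<j⇒k-j≱0 k<j le = ℕ.<⇒≱ k<j (ℤ.drop‿+≤+ (ℤ.0≤i-j⇒j≤i le))

multinomial₃ : ∀ p q r s → multinomial (+ (p ℕ.+ q)) (+ q ℤ.- + r ∷ + r ∷ + s ∷ []) ≡
               ((p ℕ.+ q) C q) ℕ.* (q C r) ℕ.* (p C s)
multinomial₃ p q r s with subtractionView q r | subtractionView p s
... | below q<r | _ = ≡.trans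
  (multinomial-≡0 (p ℕ.+ q) (+ q ℤ.- + r ∷ + r ∷ + s ∷ []) λ { (le ∷ _ , _) → k<j⇒k-j≱0 q<r le })
  (≡.sym (≡.trans (≡.cong (λ i → ((p ℕ.+ q) C q) ℕ.* i ℕ.* (p C s)) (k>n⇒nCk≡0 q<r))
    (≡.cong (ℕ._* (p C s)) (ℕ.*-zeroʳ ((p ℕ.+ q) C q)))))
... | above i ≡.refl | below p<s = ≡.trans
  (multinomial-≡0 (p ℕ.+ q) (+ q ℤ.- + r ∷ + r ∷ + s ∷ []) λ (_ , le) →
    ℕ.<⇒≱ p<s (ℕ.+-cancelʳ-≤ q s p (ℤ.drop‿+≤+ (≡.subst (ℤ._≤ + (p ℕ.+ q)) (sum≡ (+ i) (+ r) (+ s)) le))))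
  (≡.sym (≡.trans (≡.cong (((p ℕ.+ q) C q) ℕ.* (q C r) ℕ.*_) (k>n⇒nCk≡0 p<s)) (ℕ.*-zeroʳ (((p ℕ.+ q) C q) ℕ.* (q C r)))))
  where
  sum≡ : ∀ i r s → i ℤ.+ r ℤ.- r ℤ.+ (r ℤ.+ (s ℤ.+ + 0)) ≡ s ℤ.+ (i ℤ.+ r)
  sum≡ = ℤ-solve-∀
... | above i ≡.refl | above h ≡.refl rewrite h+s-s≡h (+ i) (+ r) =
  multinomial-yes (+ (p ℕ.+ q)) (+ i ∷ + r ∷ + s ∷ []) (((p ℕ.+ q) C q) ℕ.* (q C r) ℕ.* (p C s))
    (ℤ.+≤+ ℕ.z≤n ∷ ℤ.+≤+ ℕ.z≤n ∷ ℤ.+≤+ ℕ.z≤n ∷ [])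
    (ℤ.+≤+ (≡.subst (ℕ._≤ p ℕ.+ q) (≡.sym (sum≡ i r s)) (≡.subst (S ℕ.≤_) (≡.sym (N≡ h i r s)) (ℕ.m≤n+m S h)))) (begin
      X ℕ.* (ℤ.∣ + (p ℕ.+ q) ℤ.- + (i ℕ.+ (r ℕ.+ (s ℕ.+ 0))) ∣ ! ℕ.* (i ! ℕ.* (r ! ℕ.* (s ! ℕ.* 1))))
        ≡⟨ ≡.cong₂ (λ N S → X ℕ.* (ℤ.∣ + N ℤ.- + S ∣ ! ℕ.* (i ! ℕ.* (r ! ℕ.* (s ! ℕ.* 1))))) (N≡ h i r s) (sum≡ i r s) ⟩
      X ℕ.* (ℤ.∣ + h ℤ.+ + S ℤ.- + S ∣ ! ℕ.* (i ! ℕ.* (r ! ℕ.* (s ! ℕ.* 1))))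
        ≡⟨ ≡.cong (λ h → X ℕ.* (ℤ.∣ h ∣ ! ℕ.* (i ! ℕ.* (r ! ℕ.* (s ! ℕ.* 1))))) (h+s-s≡h (+ h) (+ S)) ⟩
      X ℕ.* (h ! ℕ.* (i ! ℕ.* (r ! ℕ.* (s ! ℕ.* 1))))
        ≡⟨ regroup ((p ℕ.+ q) C q) (q C r) (p C s) (h !) (i !) (r !) (s !) ⟩
      ((p ℕ.+ q) C q) ℕ.* ((q C r) ℕ.* (r ! ℕ.* i !) ℕ.* ((p C s) ℕ.* (s ! ℕ.* h !)))
        ≡⟨ ≡.cong₂ (λ a b → ((p ℕ.+ q) C q) ℕ.* (a ℕ.* b)) ([h+a]Ca*a!*h! i r) ([h+a]Ca*a!*h! h s) ⟩
      ((p ℕ.+ q) C q) ℕ.* (q ! ℕ.* p !) ≡⟨ [h+a]Ca*a!*h! p q ⟩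
      (p ℕ.+ q) ! ∎)
  where
  open ≡.≡-Reasoning
  X S : ℕ
  X = ((p ℕ.+ q) C q) ℕ.* (q C r) ℕ.* (p C s)
  S = i ℕ.+ r ℕ.+ s
  sum≡ : ∀ i r s → i ℕ.+ (r ℕ.+ (s ℕ.+ 0)) ≡ i ℕ.+ r ℕ.+ s
  sum≡ = ℕ-solve-∀
  N≡ : ∀ h i r s → (h ℕ.+ s) ℕ.+ (i ℕ.+ r) ≡ h ℕ.+ (i ℕ.+ r ℕ.+ s)
  N≡ = ℕ-solve-∀
  regroup : ∀ a b c h i r s → a ℕ.* b ℕ.* c ℕ.* (h ℕ.* (i ℕ.* (r ℕ.* (s ℕ.* 1)))) ≡
                              a ℕ.* (b ℕ.* (r ℕ.* i) ℕ.* (c ℕ.* (s ℕ.* h)))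
  regroup = ℕ-solve-∀

multinomial₂ : ∀ N k j → multinomial (+ N) (+ k ℤ.- + j ∷ + j ∷ []) ≡ (N C k) ℕ.* (k C j)
multinomial₂ N k j with subtractionView k j | subtractionView N k
... | below k<j | _ = ≡.trans
  (multinomial-≡0 N (+ k ℤ.- + j ∷ + j ∷ []) λ { (le ∷ _ , _) → k<j⇒k-j≱0 k<j le })
  (≡.sym (≡.trans (≡.cong ((N C k) ℕ.*_) (k>n⇒nCk≡0 k<j)) (ℕ.*-zeroʳ (N C k))))
... | above i ≡.refl | below N<k = ≡.trans
  (multinomial-≡0 N (+ k ℤ.- + j ∷ + j ∷ []) λ (_ , le) →
    ℕ.<⇒≱ N<k (ℤ.drop‿+≤+ (≡.subst (ℤ._≤ + N) (sum≡ (+ i) (+ j)) le)))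
  (≡.sym (≡.cong (ℕ._* (k C j)) (k>n⇒nCk≡0 N<k)))
  where
  sum≡ : ∀ i j → i ℤ.+ j ℤ.- j ℤ.+ (j ℤ.+ + 0) ≡ i ℤ.+ j
  sum≡ = ℤ-solve-∀
... | above i ≡.refl | above h ≡.refl rewrite h+s-s≡h (+ i) (+ j) =
  multinomial-yes (+ N) (+ i ∷ + j ∷ []) ((N C k) ℕ.* (k C j))
    (ℤ.+≤+ ℕ.z≤n ∷ ℤ.+≤+ ℕ.z≤n ∷ [])
    (ℤ.+≤+ (≡.subst (ℕ._≤ N) (≡.sym (sum≡ i j)) (ℕ.m≤n+m k h))) (begin
      X ℕ.* (ℤ.∣ + N ℤ.- + (i ℕ.+ (j ℕ.+ 0)) ∣ ! ℕ.* (i ! ℕ.* (j ! ℕ.* 1)))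
        ≡⟨ ≡.cong (λ S → X ℕ.* (ℤ.∣ + N ℤ.- + S ∣ ! ℕ.* (i ! ℕ.* (j ! ℕ.* 1)))) (sum≡ i j) ⟩
      X ℕ.* (ℤ.∣ + h ℤ.+ + k ℤ.- + k ∣ ! ℕ.* (i ! ℕ.* (j ! ℕ.* 1)))
        ≡⟨ ≡.cong (λ h → X ℕ.* (ℤ.∣ h ∣ ! ℕ.* (i ! ℕ.* (j ! ℕ.* 1)))) (h+s-s≡h (+ h) (+ k)) ⟩
      X ℕ.* (h ! ℕ.* (i ! ℕ.* (j ! ℕ.* 1)))
        ≡⟨ regroup (N C k) (k C j) (h !) (i !) (j !) ⟩
      (N C k) ℕ.* ((k C j) ℕ.* (j ! ℕ.* i !) ℕ.* h !)
        ≡⟨ ≡.cong (λ a → (N C k) ℕ.* (a ℕ.* h !)) ([h+a]Ca*a!*h! i j) ⟩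
      (N C k) ℕ.* (k ! ℕ.* h !) ≡⟨ [h+a]Ca*a!*h! h k ⟩
      N ! ∎)
  where
  open ≡.≡-Reasoning
  X : ℕ
  X = (N C k) ℕ.* (k C j)
  sum≡ : ∀ i j → i ℕ.+ (j ℕ.+ 0) ≡ i ℕ.+ j
  sum≡ = ℕ-solve-∀
  regroup : ∀ a b h i j → a ℕ.* b ℕ.* (h ℕ.* (i ℕ.* (j ℕ.* 1))) ≡ a ℕ.* (b ℕ.* (j ℕ.* i) ℕ.* h)
  regroup = ℕ-solve-∀

-- The binomial coefficient C(q + ℓ − 1, ℓ), with C(−1, 0) = 1.
multichoose : ℕ → ℕ → ℕ
multichoose zero    zero    = 1
multichoose zero    (suc ℓ) = 0
multichoose (suc q) ℓ       = (q ℕ.+ ℓ) C ℓ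

private
  1+i-1≡i : ∀ q ℓ → + 1 ℤ.+ q ℤ.+ ℓ ℤ.- + 1 ≡ q ℤ.+ ℓ
  1+i-1≡i = ℤ-solve-∀

multinomial-multichoose₁ : ∀ q ℓ → multinomial (+ q ℤ.+ + ℓ ℤ.- + 1) (+ ℓ ∷ []) ≡ multichoose q ℓ
multinomial-multichoose₁ zero    zero    = ≡.refl
multinomial-multichoose₁ zero    (suc ℓ) = ≡.trans (multinomial₁ ℓ (suc ℓ)) (k>n⇒nCk≡0 (ℕ.n<1+n ℓ))
multinomial-multichoose₁ (suc q) ℓ       rewrite 1+i-1≡i (+ q) (+ ℓ) = multinomial₁ (q ℕ.+ ℓ) ℓ

multinomial-multichoose₂ : ∀ q ℓ s →
  multinomial (+ q ℤ.+ + ℓ ℤ.- + 1) (+ ℓ ℤ.- + s ∷ + s ∷ []) ≡ multichoose q ℓ ℕ.* (ℓ C s)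
multinomial-multichoose₂ zero    zero    zero    = ≡.refl
multinomial-multichoose₂ zero    zero    (suc s) =
  multinomial-no -1ℤ (+ 0 ℤ.- + suc s ∷ + suc s ∷ []) (λ { (() ∷ _ , _) }) (λ { (_ , () ∷ _) })
multinomial-multichoose₂ zero    (suc ℓ) s       = ≡.trans (multinomial₂ ℓ (suc ℓ) s)
  (≡.cong (ℕ._* (suc ℓ C s)) (k>n⇒nCk≡0 (ℕ.n<1+n ℓ)))
multinomial-multichoose₂ (suc q) ℓ       s       rewrite 1+i-1≡i (+ q) (+ ℓ) = multinomial₂ (q ℕ.+ ℓ) ℓ s

private
  n-q-ℓ<q : ∀ {n q ℓ} → n ℕ.< 2 ℕ.* q ℕ.+ ℓ → + n ℤ.- + q ℤ.- + ℓ ℤ.< + q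
  n-q-ℓ<q {n} {q} {ℓ} n<2q+ℓ = ≡.subst (+ n ℤ.- + q ℤ.- + ℓ ℤ.<_) (cancel (+ q) (+ ℓ))
    (ℤ.+-monoˡ-< (ℤ.- + ℓ) (ℤ.+-monoˡ-< (ℤ.- + q)
      (≡.subst (+ n ℤ.<_) (≡.cong (ℤ._+ + ℓ) (ℤ.pos-* 2 q)) (ℤ.+<+ n<2q+ℓ))))
    where
    cancel : ∀ q ℓ → + 2 ℤ.* q ℤ.+ ℓ ℤ.- q ℤ.- ℓ ≡ q
    cancel = ℤ-solve-∀

  *-≡0 : ∀ i {j} → j ≡ 0 → i ℕ.* j ≡ 0
  *-≡0 i ≡.refl = ℕ.*-zeroʳ i

  suc-q-r≢0 : ∀ q r → ¬ (+ suc q ℤ.- + r ≡ 0ℤ × + r ≡ 0ℤ)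
  suc-q-r≢0 q .0 (() , ≡.refl)

multinomial₂-vanishes : ∀ n q ℓ r s → n ℕ.< 2 ℕ.* q ℕ.+ ℓ →
  multinomial (+ n ℤ.- + q ℤ.- + ℓ) (+ q ℤ.- + r ∷ + r ∷ []) ℕ.*
  multinomial (+ q ℤ.+ + ℓ ℤ.- + 1) (+ ℓ ℤ.- + s ∷ + s ∷ []) ≡ 0
multinomial₂-vanishes n zero    (suc ℓ) r s n<ℓ = 
  *-≡0 (multinomial (+ n ℤ.- + 0 ℤ.- + suc ℓ) (+ 0 ℤ.- + r ∷ + r ∷ [])) (multinomial-multichoose₂ 0 (suc ℓ) s)
multinomial₂-vanishes n (suc q) ℓ r s n<2q+ℓ = ≡.cong (ℕ._* multinomial (+ suc q ℤ.+ + ℓ ℤ.- + 1) (+ ℓ ℤ.- + s ∷ + s ∷ []))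
  (multinomial-no (+ n ℤ.- + suc q ℤ.- + ℓ) (+ suc q ℤ.- + r ∷ + r ∷ [])
    (λ (_ , le) → ℤ.<⇒≱ (n-q-ℓ<q {n} {suc q} {ℓ} n<2q+ℓ) (≡.subst (ℤ._≤ + n ℤ.- + suc q ℤ.- + ℓ) (sum≡ (+ suc q) (+ r)) le))
    (λ { (_ , e ∷ e′ ∷ []) → suc-q-r≢0 q r (e , e′) }))
  where
  sum≡ : ∀ q r → q ℤ.- r ℤ.+ (r ℤ.+ + 0) ≡ q
  sum≡ = ℤ-solve-∀

multinomial₃-vanishes : ∀ n q ℓ r s → n ℕ.< 2 ℕ.* q ℕ.+ ℓ →
  multinomial (+ n ℤ.- + q ℤ.- + ℓ) (+ q ℤ.- + r ∷ + r ∷ + s ∷ []) ℕ.*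
  multinomial (+ q ℤ.+ + ℓ ℤ.- + 1) (+ ℓ ∷ []) ≡ 0
multinomial₃-vanishes n zero    (suc ℓ) r s n<ℓ = 
  *-≡0 (multinomial (+ n ℤ.- + 0 ℤ.- + suc ℓ) (+ 0 ℤ.- + r ∷ + r ∷ + s ∷ [])) (multinomial-multichoose₁ 0 (suc ℓ))
multinomial₃-vanishes n (suc q) ℓ r s n<2q+ℓ = ≡.cong (ℕ._* multinomial (+ suc q ℤ.+ + ℓ ℤ.- + 1) (+ ℓ ∷ []))
  (multinomial-no (+ n ℤ.- + suc q ℤ.- + ℓ) (+ suc q ℤ.- + r ∷ + r ∷ + s ∷ [])
    (λ (_ , le) → ℤ.<⇒≱ (n-q-ℓ<q {n} {suc q} {ℓ} n<2q+ℓ)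
      (ℤ.≤-trans (ℤ.i≤i+j (+ suc q) (+ s)) (≡.subst (ℤ._≤ + n ℤ.- + suc q ℤ.- + ℓ) (sum≡ (+ suc q) (+ r) (+ s)) le)))
    (λ { (_ , e ∷ e′ ∷ _) → suc-q-r≢0 q r (e , e′) }))
  where
  sum≡ : ∀ q r s → q ℤ.- r ℤ.+ (r ℤ.+ (s ℤ.+ + 0)) ≡ q ℤ.+ s
  sum≡ = ℤ-solve-∀

module FiniteSums (K : DecidableField c ℓ) where
  open DecidableField K
  open Sums K using (sumOver; IsSum)
  open SumProperties K
  open Mult semiring using (×-congˡ; ×-comm-*; ×-homo-+)
  open import Algebra.Solver.Ring.NaturalCoefficients.Default commutativeSemiring
    using (solve; _:=_; _:*_; _:+_; con)
  open SetoidReasoning setoid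

  Σ< : ℕ → (ℕ → Carrier) → Carrier
  Σ< zero    f = 0#
  Σ< (suc M) f = f 0 + Σ< M (λ i → f (suc i))

  Σ-cong : ∀ M {f g} → (∀ i → f i ≈ g i) → Σ< M f ≈ Σ< M g
  Σ-cong zero    e = refl
  Σ-cong (suc M) e = +-cong (e 0) (Σ-cong M (λ i → e (suc i)))

  Σ-0 : ∀ M {f} → (∀ i → f i ≈ 0#) → Σ< M f ≈ 0#
  Σ-0 zero    e = refl
  Σ-0 (suc M) e = trans (+-cong (e 0) (Σ-0 M (λ i → e (suc i)))) (+-identityˡ 0#)

  Σ-+ : ∀ M f g → Σ< M (λ i → f i + g i) ≈ Σ< M f + Σ< M g
  Σ-+ zero    f g = sym (+-identityˡ 0#)
  Σ-+ (suc M) f g = trans (+-congˡ (Σ-+ M _ _))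
    (solve 4 (λ a b c d → (a :+ b) :+ (c :+ d) := (a :+ c) :+ (b :+ d)) refl _ _ _ _)

  Σ-*ˡ : ∀ M a f → Σ< M (λ i → a * f i) ≈ a * Σ< M f
  Σ-*ˡ zero    a f = sym (zeroʳ a)
  Σ-*ˡ (suc M) a f = trans (+-congˡ (Σ-*ˡ M a _)) (sym (distribˡ _ _ _))

  Σ-linear : ∀ M a f b g → Σ< M (λ i → a * f i + b * g i) ≈ a * Σ< M f + b * Σ< M g
  Σ-linear M a f b g = trans (Σ-+ M _ _) (+-cong (Σ-*ˡ M a f) (Σ-*ˡ M b g))

  sumOver-upTo : ∀ M f → sumOver (upTo M) f ≈ Σ< M f
  sumOver-upTo M f = go id M
    where
    go : ∀ (g : ℕ → ℕ) M → sumOver (applyUpTo g M) f ≈ Σ< M (f ∘ g)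
    go g zero    = refl
    go g (suc M) = +-congˡ (go (g ∘ suc) M)

  binomial-theorem : ∀ x N M → N ℕ.< M → Σ< M (λ m → (N C m) • x ^ m) ≈ (1# + x) ^ N
  binomial-theorem x zero    (suc M) _ = trans (+-cong (+-identityʳ 1#)
    (Σ-0 M (λ m → ×-congˡ {x ^ suc m} (k>n⇒nCk≡0 {0} {suc m} (s≤s z≤n))))) (+-identityʳ 1#)
  binomial-theorem x (suc N) (suc M) (s≤s N<M) = begin
    (suc N C 0) • x ^ 0 + Σ< M (λ m → (suc N C suc m) • x ^ suc m)
      ≈⟨ +-congˡ (trans (Σ-cong M pascal) (Σ-+ M _ _)) ⟩
    (N C 0) • x ^ 0 + (Σ< M (λ m → x * ((N C m) • x ^ m)) + Σ< M (λ m → (N C suc m) • x ^ suc m))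
      ≈⟨ solve 3 (λ a b c → a :+ (b :+ c) := (a :+ c) :+ b) refl _ _ _ ⟩
    Σ< (suc M) (λ m → (N C m) • x ^ m) + Σ< M (λ m → x * ((N C m) • x ^ m))
      ≈⟨ +-cong (binomial-theorem x N (suc M) (ℕ.m<n⇒m<1+n N<M))
                (trans (Σ-*ˡ M x _) (*-congˡ (binomial-theorem x N M N<M))) ⟩
    (1# + x) ^ N + x * (1# + x) ^ N
      ≈⟨ solve 2 (λ x y → y :+ x :* y := (con 1 :+ x) :* y) refl x ((1# + x) ^ N) ⟩
    (1# + x) ^ suc N ∎
    where
    pascal : ∀ m → (suc N C suc m) • x ^ suc m ≈ x * ((N C m) • x ^ m) + (N C suc m) • x ^ suc m
    pascal m = begin
      (suc N C suc m) • x ^ suc m              ≈⟨ ×-congˡ (≡.sym (nCk+nC[k+1]≡[n+1]C[k+1] N m)) ⟩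
      ((N C m) ℕ.+ (N C suc m)) • x ^ suc m    ≈⟨ ×-homo-+ _ (N C m) _ ⟩
      (N C m) • x ^ suc m + _                  ≈⟨ +-congʳ (×-comm-* (N C m) x (x ^ m)) ⟨
      x * ((N C m) • x ^ m) + _                ∎

  ℕ⁵ : Set
  ℕ⁵ = ℕ × ℕ × ℕ × ℕ × ℕ

  isSum-box : ∀ M (f : ℕ⁵ → Carrier) S →
    (∀ q l r s m → (M ℕ.≤ q ⊎ M ℕ.≤ l) ⊎ (M ℕ.≤ r ⊎ M ℕ.≤ s ⊎ M ℕ.≤ m) → f (q , l , r , s , m) ≈ 0#) →
    Σ< M (λ q → Σ< M λ l → Σ< M λ r → Σ< M λ s → Σ< M λ m → f (q , l , r , s , m)) ≈ S →
    IsSum f S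
  isSum-box M f S outside sum = record
    { support   = box
    ; unique    = cartesianProduct⁺ u (cartesianProduct⁺ u (cartesianProduct⁺ u (cartesianProduct⁺ u u)))
    ; vanishing = vanishing
    ; sum≈      = trans (sym sum) (sym
        (step _ λ q → step _ λ l → step _ λ r → trans (sumOver-cartesianProduct _ (upTo M) (upTo M))
          (trans (sumOver-upTo M _) (Σ-cong M λ s → sumOver-upTo M _))))
    }
    where
    u = upTo⁺ M

    box : List ℕ⁵
    box = List.cartesianProduct (upTo M) (List.cartesianProduct (upTo M)
      (List.cartesianProduct (upTo M) (List.cartesianProduct (upTo M) (upTo M))))

    step : ∀ {J : Set} {js : List J} (f : ℕ × J → Carrier) {g : ℕ → Carrier} →
           (∀ i → sumOver js (λ j → f (i , j)) ≈ g i) →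
           sumOver (List.cartesianProduct (upTo M) js) f ≈ Σ< M g
    step {js = js} f e = trans (sumOver-cartesianProduct f (upTo M) js)
                               (trans (sumOver-upTo M _) (Σ-cong M e))

    vanishing : ∀ i → i ∉ box → f i ≈ 0#
    vanishing (q , l , r , s , m) i∉
      with q ℕ.<? M | l ℕ.<? M | r ℕ.<? M | s ℕ.<? M | m ℕ.<? M
    ... | no n | _ | _ | _ | _ = outside q l r s m (inj₁ (inj₁ (ℕ.≮⇒≥ n)))
    ... | yes _ | no n | _ | _ | _ = outside q l r s m (inj₁ (inj₂ (ℕ.≮⇒≥ n)))
    ... | yes _ | yes _ | no n | _ | _ = outside q l r s m (inj₂ (inj₁ (ℕ.≮⇒≥ n)))
    ... | yes _ | yes _ | yes _ | no n | _ = outside q l r s m (inj₂ (inj₂ (inj₁ (ℕ.≮⇒≥ n))))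
    ... | yes _ | yes _ | yes _ | yes _ | no n = outside q l r s m (inj₂ (inj₂ (inj₂ (ℕ.≮⇒≥ n))))
    ... | yes q< | yes l< | yes r< | yes s< | yes m< =
      contradiction (∈-cartesianProduct⁺ (∈-upTo⁺ q<) (∈-cartesianProduct⁺ (∈-upTo⁺ l<)
        (∈-cartesianProduct⁺ (∈-upTo⁺ r<) (∈-cartesianProduct⁺ (∈-upTo⁺ s<) (∈-upTo⁺ m<))))) i∉

private
  2[1+q]+l : ∀ q l → 2 ℕ.* suc q ℕ.+ l ≡ suc (suc (2 ℕ.* q ℕ.+ l))
  2[1+q]+l = ℕ-solve-∀

choose-pascal : ∀ p q → (p ℕ.+ suc q) C suc q ℕ.+ (suc p ℕ.+ q) C q ≡ (suc p ℕ.+ suc q) C suc q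
choose-pascal p q rewrite ℕ.+-suc p q =
  ≡.trans (ℕ.+-comm ((suc (p ℕ.+ q)) C suc q) _) (nCk+nC[k+1]≡[n+1]C[k+1] (suc (p ℕ.+ q)) q)

multichoose-pascal : ∀ q l → multichoose q (suc l) ℕ.+ multichoose (suc q) l ≡ multichoose (suc q) (suc l)
multichoose-pascal zero    l = ≡.trans (nCn≡1 l) (≡.sym (nCn≡1 (suc l)))
multichoose-pascal (suc q) l = choose-pascal q l

multichoose-0 : ∀ q → multichoose q 0 ≡ 1
multichoose-0 zero    = ≡.refl
multichoose-0 (suc q) = ≡.refl

module TransferSums (K : DecidableField c ℓ) (y₁ y₂ y₃ : DecidableField.Carrier K) where
  open DecidableField K hiding (zero)
  open Transfer commutativeSemiring y₁ y₂ y₃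
  open FiniteSums K
  open Mult semiring using (×-congʳ; ×-congˡ; ×-comm-*; ×-homo-+)
  open import Algebra.Solver.Ring.NaturalCoefficients.Default commutativeSemiring
    using (solve; _:=_; _:*_; _:+_; con)
  open SetoidReasoning setoid

  -- α n q l and β n q l are the parts of A n and B n of degree q in y₂ and l in y₃.
  α β : ℕ → ℕ → ℕ → Carrier
  α zero    zero    zero    = 1#
  α zero    zero    (suc l) = 0#
  α zero    (suc q) l       = 0#
  α (suc n) zero    l       = y₁ * α n zero l
  α (suc n) (suc q) l       = y₁ * α n (suc q) l + y₂ * β n q l
  β zero    q       l       = 0#
  β (suc n) q       zero    = α n q zero
  β (suc n) q       (suc l) = α n q (suc l) + y₃ * β n q l

  A-sum : ∀ n {Q L} → n ℕ.< Q → n ℕ.< L → Σ< Q (λ q → Σ< L (α n q)) ≈ A n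
  B-sum : ∀ n {Q L} → n ℕ.≤ Q → n ℕ.≤ L → Σ< Q (λ q → Σ< L (β n q)) ≈ B n
  A-sum zero    {suc Q} {suc L} _ _ = begin
    (1# + Σ< L (λ _ → 0#)) + Σ< Q (λ _ → Σ< (suc L) (λ _ → 0#))
      ≈⟨ +-cong (+-congˡ (Σ-0 L (λ _ → refl))) (Σ-0 Q (λ _ → Σ-0 (suc L) (λ _ → refl))) ⟩
    (1# + 0#) + 0# ≈⟨ trans (+-identityʳ _) (+-identityʳ _) ⟩
    1#             ∎
  A-sum (suc n) {suc Q} {L} (s≤s n<Q) n<L = begin
    Σ< L (λ l → y₁ * α n 0 l) + Σ< Q (λ q → Σ< L (λ l → y₁ * α n (suc q) l + y₂ * β n q l))
      ≈⟨ +-cong (Σ-*ˡ L y₁ _) (trans (Σ-cong Q (λ q → Σ-linear L y₁ _ y₂ _)) (Σ-linear Q y₁ _ y₂ _)) ⟩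
    y₁ * Σ< L (α n 0) + (y₁ * Σ< Q (λ q → Σ< L (α n (suc q))) + y₂ * Σ< Q (λ q → Σ< L (β n q)))
      ≈⟨ solve 4 (λ y a b c → y :* a :+ (y :* b :+ c) := y :* (a :+ b) :+ c) refl y₁ _ _ _ ⟩
    y₁ * Σ< (suc Q) (λ q → Σ< L (α n q)) + y₂ * Σ< Q (λ q → Σ< L (β n q))
      ≈⟨ +-cong (*-congˡ (A-sum n (ℕ.m<n⇒m<1+n n<Q) (ℕ.<⇒≤ n<L)))
                (*-congˡ (B-sum n (ℕ.<⇒≤ n<Q) (ℕ.<⇒≤ (ℕ.<⇒≤ n<L)))) ⟩
    A (suc n) ∎
  B-sum zero    {Q} {L} _ _ = Σ-0 Q (λ q → Σ-0 L (λ l → refl))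
  B-sum (suc n) {Q} {suc L} n<Q (s≤s n≤L) = begin
    Σ< Q (λ q → α n q 0 + Σ< L (λ l → α n q (suc l) + y₃ * β n q l))
      ≈⟨ Σ-cong Q (λ q → trans (+-congˡ (trans (Σ-+ L _ _) (+-congˡ (Σ-*ˡ L y₃ _)))) (sym (+-assoc _ _ _))) ⟩
    Σ< Q (λ q → Σ< (suc L) (α n q) + y₃ * Σ< L (β n q))
      ≈⟨ trans (Σ-+ Q _ _) (+-congˡ (Σ-*ˡ Q y₃ _)) ⟩
    Σ< Q (λ q → Σ< (suc L) (α n q)) + y₃ * Σ< Q (λ q → Σ< L (β n q))
      ≈⟨ +-cong (A-sum n n<Q (s≤s n≤L)) (*-congˡ (B-sum n (ℕ.<⇒≤ n<Q) n≤L)) ⟩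
    B (suc n) ∎

  α-vanishes : ∀ n q l → n ℕ.< 2 ℕ.* q ℕ.+ l → α n q l ≈ 0#
  β-vanishes : ∀ n q l → n ℕ.≤ 2 ℕ.* q ℕ.+ l → β n q l ≈ 0#
  α-vanishes zero    zero    (suc l) _   = refl
  α-vanishes zero    (suc q) l       _   = refl
  α-vanishes (suc n) zero    l       n<l = trans (*-congˡ (α-vanishes n zero l (ℕ.<⇒≤ n<l))) (zeroʳ y₁)
  α-vanishes (suc n) (suc q) l       n<l = trans (+-cong
    (trans (*-congˡ (α-vanishes n (suc q) l (ℕ.<⇒≤ n<l))) (zeroʳ y₁))
    (trans (*-congˡ (β-vanishes n q l (ℕ.≤-pred (ℕ.≤-pred (≡.subst (suc n ℕ.<_) (2[1+q]+l q l) n<l))))) (zeroʳ y₂)))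
    (+-identityˡ 0#)
  β-vanishes zero    q l       _   = refl
  β-vanishes (suc n) q zero    n≤l = α-vanishes n q 0 n≤l
  β-vanishes (suc n) q (suc l) n≤l = trans (+-cong
    (α-vanishes n q (suc l) n≤l)
    (trans (*-congˡ (β-vanishes n q l (ℕ.≤-pred (≡.subst (suc n ℕ.≤_) (ℕ.+-suc (2 ℕ.* q) l) n≤l)))) (zeroʳ y₃)))
    (+-identityˡ 0#)

  monomial : ℕ → ℕ → ℕ → Carrier
  monomial p q l = y₁ ^ p * y₂ ^ q * y₃ ^ l

  private
    *-monomial₁ : ∀ k p q l → y₁ * (k • monomial p q l) ≈ k • monomial (suc p) q l
    *-monomial₁ k p q l = trans (×-comm-* k _ _) (×-congʳ k
      (solve 4 (λ y a b c → y :* (a :* b :* c) := (y :* a) :* b :* c) refl y₁ (y₁ ^ p) (y₂ ^ q) (y₃ ^ l)))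

    *-monomial₂ : ∀ k p q l → y₂ * (k • monomial p q l) ≈ k • monomial p (suc q) l
    *-monomial₂ k p q l = trans (×-comm-* k _ _) (×-congʳ k
      (solve 4 (λ y a b c → y :* (a :* b :* c) := a :* (y :* b) :* c) refl y₂ (y₁ ^ p) (y₂ ^ q) (y₃ ^ l)))

    *-monomial₃ : ∀ k p q l → y₃ * (k • monomial p q l) ≈ k • monomial p q (suc l)
    *-monomial₃ k p q l = trans (×-comm-* k _ _) (×-congʳ k
      (solve 4 (λ y a b c → y :* (a :* b :* c) := a :* b :* (y :* c)) refl y₃ (y₁ ^ p) (y₂ ^ q) (y₃ ^ l)))

    +-• : ∀ j k {i x} → j ℕ.+ k ≡ i → j • x + k • x ≈ i • x
    +-• j k {x = x} ≡.refl = sym (×-homo-+ x j k)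

  α-closed : ∀ n p q l → n ≡ p ℕ.+ (2 ℕ.* q ℕ.+ l) →
    α n q l ≈ (((p ℕ.+ q) C q) ℕ.* multichoose q l) • monomial p q l
  β-closed : ∀ n p q l → n ≡ suc (p ℕ.+ (2 ℕ.* q ℕ.+ l)) →
    β n q l ≈ (((p ℕ.+ q) C q) ℕ.* multichoose (suc q) l) • monomial p q l
  α-closed zero    zero    zero    zero    e = solve 0 (con 1 := con 1 :* con 1 :* con 1 :+ con 0) refl
  α-closed (suc n) zero    zero    (suc l) e = trans
    (*-congˡ (α-vanishes n zero (suc l) (ℕ.≤-reflexive e))) (zeroʳ y₁)
  α-closed (suc n) (suc p) zero    l       e = trans
    (*-congˡ (α-closed n p zero l (ℕ.suc-injective e))) (*-monomial₁ (((p ℕ.+ 0) C 0) ℕ.* multichoose 0 l) p zero l)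
  α-closed (suc n) zero    (suc q) l       e = begin
    y₁ * α n (suc q) l + y₂ * β n q l
      ≈⟨ +-cong (trans (*-congˡ (α-vanishes n (suc q) l (ℕ.≤-reflexive e))) (zeroʳ y₁))
                (trans (*-congˡ (β-closed n zero q l (ℕ.suc-injective (≡.trans e (2[1+q]+l q l)))))
                       (*-monomial₂ ((q C q) ℕ.* multichoose (suc q) l) zero q l)) ⟩
    0# + ((q C q) ℕ.* multichoose (suc q) l) • monomial zero (suc q) l
      ≈⟨ +-identityˡ _ ⟩
    ((q C q) ℕ.* multichoose (suc q) l) • monomial zero (suc q) l
      ≈⟨ ×-congˡ (≡.cong (ℕ._* multichoose (suc q) l) (≡.trans (nCn≡1 q) (≡.sym (nCn≡1 (suc q))))) ⟩
    ((suc q C suc q) ℕ.* multichoose (suc q) l) • monomial zero (suc q) l ∎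
  α-closed (suc n) (suc p) (suc q) l       e = trans
    (+-cong (trans (*-congˡ (α-closed n p (suc q) l (ℕ.suc-injective e))) (*-monomial₁ (((p ℕ.+ suc q) C suc q) ℕ.* d) p (suc q) l))
            (trans (*-congˡ (β-closed n (suc p) q l (ℕ.suc-injective (≡.trans e (shift p q l))))) (*-monomial₂ (((suc p ℕ.+ q) C q) ℕ.* d) (suc p) q l)))
    (+-• (((p ℕ.+ suc q) C suc q) ℕ.* d) (((suc p ℕ.+ q) C q) ℕ.* d)
      (≡.trans (≡.sym (ℕ.*-distribʳ-+ d ((p ℕ.+ suc q) C suc q) _)) (≡.cong (ℕ._* d) (choose-pascal p q))))
    where
    d : ℕ
    d = multichoose (suc q) l
    shift : ∀ p q l → suc p ℕ.+ (2 ℕ.* suc q ℕ.+ l) ≡ suc (suc (suc p ℕ.+ (2 ℕ.* q ℕ.+ l)))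
    shift = ℕ-solve-∀
  β-closed (suc n) p q zero    e = trans
    (α-closed n p q zero (ℕ.suc-injective e))
    (×-congˡ (≡.cong (((p ℕ.+ q) C q) ℕ.*_) (multichoose-0 q)))
  β-closed (suc n) p q (suc l) e = trans
    (+-cong (α-closed n p q (suc l) (ℕ.suc-injective e))
            (trans (*-congˡ (β-closed n p q l (ℕ.suc-injective (≡.trans e (shift p q l))))) (*-monomial₃ (b ℕ.* multichoose (suc q) l) p q l)))
    (+-• (b ℕ.* multichoose q (suc l)) (b ℕ.* multichoose (suc q) l)
      (≡.trans (≡.sym (ℕ.*-distribˡ-+ b (multichoose q (suc l)) _)) (≡.cong (b ℕ.*_) (multichoose-pascal q l))))
    where
    b : ℕ
    b = (p ℕ.+ q) C q
    shift : ∀ p q l → suc (p ℕ.+ (2 ℕ.* q ℕ.+ suc l)) ≡ suc (suc (p ℕ.+ (2 ℕ.* q ℕ.+ l)))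
    shift = ℕ-solve-∀

module BinomialSums (K : DecidableField c ℓ) where
  open DecidableField K hiding (zero)
  open FiniteSums K
  open Mult semiring using (×-congʳ; ×-congˡ; ×-assoc-*; ×1-homo-*)
  open Exp commutativeSemiring using (^-homo-*; ^-assocʳ; ^-distrib-*)
  open import Algebra.Solver.Ring.NaturalCoefficients.Default commutativeSemiring
    using (solve; _:=_; _:*_)
  open SetoidReasoning setoid

  ⌜_⌝ : ℕ → Carrier
  ⌜ n ⌝ = n • 1#

  •≈⌜⌝* : ∀ n x → n • x ≈ ⌜ n ⌝ * x
  •≈⌜⌝* n x = trans (×-congʳ n (sym (*-identityˡ x))) (sym (×-assoc-* n 1# x))

  ⌜⌝-≡0 : ∀ {n} → n ≡ 0 → ⌜ n ⌝ ≈ 0#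
  ⌜⌝-≡0 e = ×-congˡ e

  Σ-binomial : ∀ {N M} x → N ℕ.< M → Σ< M (λ m → ⌜ N C m ⌝ * x ^ m) ≈ (1# + x) ^ N
  Σ-binomial {N} {M} x N<M = trans (Σ-cong M (λ m → sym (•≈⌜⌝* (N C m) (x ^ m)))) (binomial-theorem x N M N<M)

  Σ-binomial³ : ∀ M c G q k e R x → e ℕ.+ (2 ℕ.* q ℕ.+ k) ℕ.< M →
    Σ< M (λ r → Σ< M λ s → Σ< M λ m →
      (c ℕ.* (q C r) ℕ.* (k C s) ℕ.* ((e ℕ.+ 2 ℕ.* r ℕ.+ s) C m)) • (G * (R ^ r * R ^ s) * x ^ m))
    ≈ c • (G * ((1# + x) ^ e * (1# + (1# + x) ^ 2 * R) ^ q * (1# + (1# + x) * R) ^ k))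
  Σ-binomial³ M c G q k e R x bound = begin
    _ ≈⟨ Σ-cong M (λ r → Σ-cong M (λ s → over-m r s)) ⟩
    Σ< M (λ r → Σ< M λ s → (⌜c⌝Gu^e * (⌜ q C r ⌝ * (u ^ 2 * R) ^ r)) * (⌜ k C s ⌝ * (u * R) ^ s))
      ≈⟨ Σ-cong M (λ r → trans (Σ-*ˡ M _ _) (trans (*-congˡ (Σ-binomial (u * R) k<M))
           (solve 3 (λ a b c → a :* b :* c := (a :* c) :* b) refl _ _ _))) ⟩
    Σ< M (λ r → (⌜c⌝Gu^e * (1# + u * R) ^ k) * (⌜ q C r ⌝ * (u ^ 2 * R) ^ r))
      ≈⟨ trans (Σ-*ˡ M _ _) (*-congˡ (Σ-binomial (u ^ 2 * R) q<M)) ⟩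
    (⌜c⌝Gu^e * (1# + u * R) ^ k) * (1# + u ^ 2 * R) ^ q
      ≈⟨ solve 5 (λ c G ue k q → (c :* G :* ue :* k) :* q := c :* (G :* (ue :* q :* k))) refl ⌜ c ⌝ G (u ^ e) _ _ ⟩
    ⌜ c ⌝ * (G * (u ^ e * (1# + u ^ 2 * R) ^ q * (1# + u * R) ^ k))
      ≈⟨ •≈⌜⌝* c _ ⟨
    c • (G * (u ^ e * (1# + u ^ 2 * R) ^ q * (1# + u * R) ^ k)) ∎
    where
    u ⌜c⌝Gu^e : Carrier
    u = 1# + x
    ⌜c⌝Gu^e = ⌜ c ⌝ * G * u ^ e

    k<M : k ℕ.< M
    k<M = ℕ.≤-<-trans (ℕ.≤-trans (ℕ.m≤n+m k (2 ℕ.* q)) (ℕ.m≤n+m _ e)) bound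

    q<M : q ℕ.< M
    q<M = ℕ.≤-<-trans (ℕ.≤-trans (ℕ.≤-trans (ℕ.m≤n*m q 2) (ℕ.m≤m+n _ k)) (ℕ.m≤n+m _ e)) bound

    term : ℕ → ℕ → ℕ → ℕ
    term r s m = c ℕ.* (q C r) ℕ.* (k C s) ℕ.* ((e ℕ.+ 2 ℕ.* r ℕ.+ s) C m)

    -- The sum over m may be cut off at M only if the coefficients in front of it vanish.
    truncated : ∀ r s N → N ≡ e ℕ.+ 2 ℕ.* r ℕ.+ s →
                ⌜ q C r ⌝ * ⌜ k C s ⌝ * Σ< M (λ m → ⌜ N C m ⌝ * x ^ m) ≈ ⌜ q C r ⌝ * ⌜ k C s ⌝ * u ^ N
    truncated r s N N≡ with r ℕ.≤? q | s ℕ.≤? k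
    ... | yes r≤q | yes s≤k = *-congˡ (Σ-binomial x (ℕ.≤-<-trans N≤ bound))
      where
      N≤ : N ℕ.≤ e ℕ.+ (2 ℕ.* q ℕ.+ k)
      N≤ = ≡.subst₂ ℕ._≤_ (≡.sym N≡) (ℕ.+-assoc e (2 ℕ.* q) k)
             (ℕ.+-mono-≤ (ℕ.+-monoʳ-≤ e (ℕ.*-monoʳ-≤ 2 r≤q)) s≤k)
    ... | no r≰q | _ = trans (vanish _) (sym (vanish _))
      where
      vanish : ∀ y → ⌜ q C r ⌝ * ⌜ k C s ⌝ * y ≈ 0#
      vanish y = trans (*-congʳ (trans (*-congʳ (⌜⌝-≡0 (k>n⇒nCk≡0 (ℕ.≰⇒> r≰q)))) (zeroˡ _))) (zeroˡ y)
    ... | yes _ | no s≰k = trans (vanish _) (sym (vanish _))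
      where
      vanish : ∀ y → ⌜ q C r ⌝ * ⌜ k C s ⌝ * y ≈ 0#
      vanish y = trans (*-congʳ (trans (*-congˡ (⌜⌝-≡0 (k>n⇒nCk≡0 (ℕ.≰⇒> s≰k)))) (zeroʳ _))) (zeroˡ y)

    over-m : ∀ r s → Σ< M (λ m → term r s m • (G * (R ^ r * R ^ s) * x ^ m)) ≈
             (⌜c⌝Gu^e * (⌜ q C r ⌝ * (u ^ 2 * R) ^ r)) * (⌜ k C s ⌝ * (u * R) ^ s)
    over-m r s = begin
      Σ< M (λ m → term r s m • (G * (R ^ r * R ^ s) * x ^ m))
        ≈⟨ Σ-cong M (λ m → trans (•≈⌜⌝* (term r s m) _) (trans (*-congʳ (expand m))
             (solve 7 (λ c a b d g h x → c :* a :* b :* d :* (g :* h :* x) := (c :* g :* h :* (a :* b)) :* (d :* x))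
               refl ⌜ c ⌝ ⌜ q C r ⌝ ⌜ k C s ⌝ ⌜ N C m ⌝ G (R ^ r * R ^ s) (x ^ m)))) ⟩
      Σ< M (λ m → (⌜ c ⌝ * G * (R ^ r * R ^ s) * (⌜ q C r ⌝ * ⌜ k C s ⌝)) * (⌜ N C m ⌝ * x ^ m))
        ≈⟨ Σ-*ˡ M _ _ ⟩
      (⌜ c ⌝ * G * (R ^ r * R ^ s) * (⌜ q C r ⌝ * ⌜ k C s ⌝)) * Σ< M (λ m → ⌜ N C m ⌝ * x ^ m)
        ≈⟨ trans (*-assoc _ _ _) (*-congˡ (truncated r s N ≡.refl)) ⟩
      (⌜ c ⌝ * G * (R ^ r * R ^ s)) * (⌜ q C r ⌝ * ⌜ k C s ⌝ * u ^ N)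
        ≈⟨ *-congˡ (*-congˡ u^N) ⟩
      (⌜ c ⌝ * G * (R ^ r * R ^ s)) * (⌜ q C r ⌝ * ⌜ k C s ⌝ * (u ^ e * (u ^ 2) ^ r * u ^ s))
        ≈⟨ solve 9 (λ c g R^r R^s a b u^e u²^r u^s →
             (c :* g :* (R^r :* R^s)) :* (a :* b :* (u^e :* u²^r :* u^s)) :=
             (c :* g :* u^e :* (a :* (u²^r :* R^r))) :* (b :* (u^s :* R^s)))
             refl ⌜ c ⌝ G (R ^ r) (R ^ s) ⌜ q C r ⌝ ⌜ k C s ⌝ (u ^ e) ((u ^ 2) ^ r) (u ^ s) ⟩
      (⌜c⌝Gu^e * (⌜ q C r ⌝ * ((u ^ 2) ^ r * R ^ r))) * (⌜ k C s ⌝ * (u ^ s * R ^ s))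
        ≈⟨ *-cong (*-congˡ (*-congˡ (^-distrib-* (u ^ 2) R r))) (*-congˡ (^-distrib-* u R s)) ⟨
      (⌜c⌝Gu^e * (⌜ q C r ⌝ * (u ^ 2 * R) ^ r)) * (⌜ k C s ⌝ * (u * R) ^ s) ∎
      where
      N : ℕ
      N = e ℕ.+ 2 ℕ.* r ℕ.+ s

      expand : ∀ m → ⌜ term r s m ⌝ ≈ ⌜ c ⌝ * ⌜ q C r ⌝ * ⌜ k C s ⌝ * ⌜ N C m ⌝
      expand m = trans (×1-homo-* (c ℕ.* (q C r) ℕ.* (k C s)) (N C m))
        (*-congʳ (trans (×1-homo-* (c ℕ.* (q C r)) (k C s)) (*-congʳ (×1-homo-* c (q C r)))))

      u^N : u ^ N ≈ u ^ e * (u ^ 2) ^ r * u ^ s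
      u^N = trans (^-homo-* u (e ℕ.+ 2 ℕ.* r) s) (*-congʳ (trans (^-homo-* u e (2 ℕ.* r))
              (*-congˡ (sym (^-assocʳ u 2 r)))))

module Expansions (K : DecidableField c ℓ) where
  open DecidableField K hiding (zero)

  module Expansion
    (y₁ y₂ y₃ a R x : Carrier) (k e : ℕ → ℕ → ℕ)
    (e+k : ∀ p l → e p l ℕ.+ k p l ≡ p ℕ.+ l)
    (G : ℕ → ℕ → ℕ → Carrier)
    (cell : ∀ p q l →
      G p q l * ((1# + x) ^ e p l * (1# + (1# + x) ^ 2 * R) ^ q * (1# + (1# + x) * R) ^ k p l)
      ≈ a * (y₁ ^ p * y₂ ^ q * y₃ ^ l))
    where
    open Transfer commutativeSemiring y₁ y₂ y₃ using (A)
    open FiniteSums K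
    open BinomialSums K
    open TransferSums K y₁ y₂ y₃
    open Sums K using (IsSum)
    open Mult semiring using (×-congʳ; ×-congˡ; ×-comm-*; ×-cong)
    open SetoidReasoning setoid

    module _ (n : ℕ) (coefficient : ℕ → ℕ → ℕ → ℕ → ℕ → ℕ) (power : ℕ → ℕ → ℕ → ℕ → ℕ → Carrier)
             (vanishes : ∀ q l r s m → n ℕ.< 2 ℕ.* q ℕ.+ l → coefficient q l r s m ≡ 0)
             (coefficient≡ : ∀ p q l r s m → n ≡ p ℕ.+ (2 ℕ.* q ℕ.+ l) →
               coefficient q l r s m ≡
               ((p ℕ.+ q) C q) ℕ.* multichoose q l ℕ.* (q C r) ℕ.* (k p l C s)
                 ℕ.* ((e p l ℕ.+ 2 ℕ.* r ℕ.+ s) C m))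
             (power≈ : ∀ p q l r s m → n ≡ p ℕ.+ (2 ℕ.* q ℕ.+ l) →
               power q l r s m ≈ G p q l * (R ^ r * R ^ s) * x ^ m)
             where

      private
        weight : ℕ → ℕ → ℕ → ℕ
        weight p q l = ((p ℕ.+ q) C q) ℕ.* multichoose q l

        M : ℕ
        M = suc n

        f : ℕ⁵ → Carrier
        f (q , l , r , s , m) = coefficient q l r s m • power q l r s m

        total : ∀ p q l → n ≡ p ℕ.+ (2 ℕ.* q ℕ.+ l) → e p l ℕ.+ (2 ℕ.* q ℕ.+ k p l) ≡ n
        total p q l ≡.refl = ≡.trans (swap (e p l) (2 ℕ.* q) (k p l))
          (≡.trans (≡.cong (ℕ._+ 2 ℕ.* q) (e+k p l)) (≡.sym (swap p (2 ℕ.* q) l)))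
          where
          swap : ∀ a b c → a ℕ.+ (b ℕ.+ c) ≡ a ℕ.+ c ℕ.+ b
          swap = ℕ-solve-∀

        f≈0 : ∀ q l r s m → coefficient q l r s m ≡ 0 → f (q , l , r , s , m) ≈ 0#
        f≈0 q l r s m e = ×-congˡ e

        qCr≡0 : ∀ c {a} b d → a ≡ 0 → c ℕ.* a ℕ.* b ℕ.* d ≡ 0
        qCr≡0 c b d ≡.refl = ≡.cong (λ i → i ℕ.* b ℕ.* d) (ℕ.*-zeroʳ c)

        kCs≡0 : ∀ c a {b} d → b ≡ 0 → c ℕ.* a ℕ.* b ℕ.* d ≡ 0
        kCs≡0 c a d ≡.refl = ≡.cong (ℕ._* d) (ℕ.*-zeroʳ (c ℕ.* a))

        NCm≡0 : ∀ c a b {d} → d ≡ 0 → c ℕ.* a ℕ.* b ℕ.* d ≡ 0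
        NCm≡0 c a b ≡.refl = ℕ.*-zeroʳ (c ℕ.* a ℕ.* b)

        module _ (p q l r s m : ℕ) (n≡ : n ≡ p ℕ.+ (2 ℕ.* q ℕ.+ l)) where
          N : ℕ
          N = e p l ℕ.+ 2 ℕ.* r ℕ.+ s

          outside′ : (q ℕ.< r ⊎ k p l ℕ.< s) ⊎ N ℕ.< m → coefficient q l r s m ≡ 0
          outside′ h = ≡.trans (coefficient≡ p q l r s m n≡) (case h)
            where
            case : (q ℕ.< r ⊎ k p l ℕ.< s) ⊎ N ℕ.< m → (weight p q l) ℕ.* (q C r) ℕ.* (k p l C s) ℕ.* (N C m) ≡ 0
            case (inj₁ (inj₁ q<r)) = qCr≡0 (weight p q l) (k p l C s) (N C m) (k>n⇒nCk≡0 q<r)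
            case (inj₁ (inj₂ k<s)) = kCs≡0 (weight p q l) (q C r) (N C m) (k>n⇒nCk≡0 k<s)
            case (inj₂ N<m)        = NCm≡0 (weight p q l) (q C r) (k p l C s) (k>n⇒nCk≡0 N<m)

          q≤n : q ℕ.≤ n
          q≤n = ≡.subst (q ℕ.≤_) (≡.sym n≡) (ℕ.≤-trans (ℕ.m≤n*m q 2) (ℕ.≤-trans (ℕ.m≤m+n _ l) (ℕ.m≤n+m _ p)))

          k≤n : k p l ℕ.≤ n
          k≤n = ≡.subst (k p l ℕ.≤_) (total p q l n≡) (ℕ.≤-trans (ℕ.m≤n+m _ (2 ℕ.* q)) (ℕ.m≤n+m _ (e p l)))

          outside : M ℕ.≤ r ⊎ M ℕ.≤ s ⊎ M ℕ.≤ m → coefficient q l r s m ≡ 0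
          outside (inj₁ M≤r) = outside′ (inj₁ (inj₁ (ℕ.≤-trans (s≤s q≤n) M≤r)))
          outside (inj₂ (inj₁ M≤s)) = outside′ (inj₁ (inj₂ (ℕ.≤-trans (s≤s k≤n) M≤s)))
          outside (inj₂ (inj₂ M≤m)) with r ℕ.≤? q | s ℕ.≤? k p l
          ... | no r≰q  | _       = outside′ (inj₁ (inj₁ (ℕ.≰⇒> r≰q)))
          ... | yes _   | no s≰k  = outside′ (inj₁ (inj₂ (ℕ.≰⇒> s≰k)))
          ... | yes r≤q | yes s≤k = outside′ (inj₂ (ℕ.≤-trans (s≤s N≤n) M≤m))
            where
            N≤n : N ℕ.≤ n
            N≤n = ≡.subst (N ℕ.≤_) (≡.trans (ℕ.+-assoc (e p l) (2 ℕ.* q) (k p l)) (total p q l n≡))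
              (ℕ.+-mono-≤ (ℕ.+-monoʳ-≤ (e p l) (ℕ.*-monoʳ-≤ 2 r≤q)) s≤k)

        outside-box : ∀ q l r s m → (M ℕ.≤ q ⊎ M ℕ.≤ l) ⊎ (M ℕ.≤ r ⊎ M ℕ.≤ s ⊎ M ℕ.≤ m) →
                      f (q , l , r , s , m) ≈ 0#
        outside-box q l r s m (inj₁ (inj₁ M≤q)) = f≈0 q l r s m (vanishes q l r s m
          (ℕ.≤-trans M≤q (ℕ.≤-trans (ℕ.m≤n*m q 2) (ℕ.m≤m+n _ l))))
        outside-box q l r s m (inj₁ (inj₂ M≤l)) = f≈0 q l r s m (vanishes q l r s m
          (ℕ.≤-trans M≤l (ℕ.m≤n+m l _)))
        outside-box q l r s m (inj₂ h) with subtractionView n (2 ℕ.* q ℕ.+ l)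
        ... | below n<   = f≈0 q l r s m (vanishes q l r s m n<)
        ... | above p n≡ = f≈0 q l r s m (outside p q l r s m n≡ h)

        cells : ∀ q l → Σ< M (λ r → Σ< M λ s → Σ< M λ m → f (q , l , r , s , m)) ≈ a * α n q l
        cells q l with subtractionView n (2 ℕ.* q ℕ.+ l)
        ... | below n<   = trans
          (Σ-0 M λ r → Σ-0 M λ s → Σ-0 M λ m → f≈0 q l r s m (vanishes q l r s m n<))
          (sym (trans (*-congˡ (α-vanishes n q l n<)) (zeroʳ a)))
        ... | above p n≡ = begin
          Σ< M (λ r → Σ< M λ s → Σ< M λ m → f (q , l , r , s , m))
            ≈⟨ Σ-cong M (λ r → Σ-cong M λ s → Σ-cong M λ m →
                 ×-cong (coefficient≡ p q l r s m n≡) (power≈ p q l r s m n≡)) ⟩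
          _ ≈⟨ Σ-binomial³ M c₀ (G p q l) q (k p l) (e p l) R x (s≤s (ℕ.≤-reflexive (total p q l n≡))) ⟩
          c₀ • _                        ≈⟨ ×-congʳ c₀ (cell p q l) ⟩
          c₀ • (a * monomial p q l)     ≈⟨ ×-comm-* c₀ a _ ⟨
          a * (c₀ • monomial p q l)     ≈⟨ *-congˡ (α-closed n p q l n≡) ⟨
          a * α n q l                   ∎
          where
          c₀ : ℕ
          c₀ = weight p q l

      expansion : ∀ {S} → S ≈ a * A n → IsSum f S
      expansion {S} S≈aA = isSum-box M f S outside-box (begin
        Σ< M (λ q → Σ< M λ l → Σ< M λ r → Σ< M λ s → Σ< M λ m → f (q , l , r , s , m))
          ≈⟨ Σ-cong M (λ q → trans (Σ-cong M (cells q)) (Σ-*ˡ M a (α n q))) ⟩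
        Σ< M (λ q → a * Σ< M (α n q))  ≈⟨ Σ-*ˡ M a (λ q → Σ< M (α n q)) ⟩
        a * Σ< M (λ q → Σ< M (α n q))  ≈⟨ *-congˡ (A-sum n (ℕ.n<1+n n) (ℕ.n<1+n n)) ⟩
        a * A n                        ≈⟨ S≈aA ⟨
        S                              ∎)

private
  regroup₅ : ∀ a b d g h → (a ℕ.* b) ℕ.* (d ℕ.* g) ℕ.* h ≡ a ℕ.* d ℕ.* b ℕ.* g ℕ.* h
  regroup₅ = ℕ-solve-∀

  regroup₅′ : ∀ a b d g h → (a ℕ.* b ℕ.* d) ℕ.* g ℕ.* h ≡ a ℕ.* g ℕ.* b ℕ.* d ℕ.* h
  regroup₅′ = ℕ-solve-∀

  n-q-l≡p+q : ∀ p q l → p ℤ.+ (q ℤ.+ (q ℤ.+ + 0) ℤ.+ l) ℤ.- q ℤ.- l ≡ p ℤ.+ q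
  n-q-l≡p+q = ℤ-solve-∀

coefficient₁ coefficient₂ : ℕ → ℕ → ℕ → ℕ → ℕ → ℕ → ℕ
coefficient₁ n q l r s m =
  multinomial (+ n ℤ.- + q ℤ.- + l) (+ q ℤ.- + r ∷ + r ∷ [])
  ℕ.* multinomial (+ q ℤ.+ + l ℤ.- + 1) (+ l ℤ.- + s ∷ + s ∷ [])
  ℕ.* multinomial (+ n ℤ.+ + 2 ℤ.* + r ℤ.+ + s ℤ.- + 2 ℤ.* + q ℤ.- + l) (+ m ∷ [])
coefficient₂ n q l r s m =
  multinomial (+ n ℤ.- + q ℤ.- + l) (+ q ℤ.- + r ∷ + r ∷ + s ∷ [])
  ℕ.* multinomial (+ q ℤ.+ + l ℤ.- + 1) (+ l ∷ [])
  ℕ.* multinomial (+ 2 ℤ.* + r ℤ.+ + s ℤ.+ + l) (+ m ∷ [])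

coefficient₁-vanishes : ∀ n q l r s m → n ℕ.< 2 ℕ.* q ℕ.+ l → coefficient₁ n q l r s m ≡ 0
coefficient₁-vanishes n q l r s m n< =
  ≡.cong (ℕ._* multinomial (+ n ℤ.+ + 2 ℤ.* + r ℤ.+ + s ℤ.- + 2 ℤ.* + q ℤ.- + l) (+ m ∷ []))
         (multinomial₂-vanishes n q l r s n<)

coefficient₂-vanishes : ∀ n q l r s m → n ℕ.< 2 ℕ.* q ℕ.+ l → coefficient₂ n q l r s m ≡ 0
coefficient₂-vanishes n q l r s m n< =
  ≡.cong (ℕ._* multinomial (+ 2 ℤ.* + r ℤ.+ + s ℤ.+ + l) (+ m ∷ []))
         (multinomial₃-vanishes n q l r s n<)

coefficient₁≡ : ∀ n p q l r s m → n ≡ p ℕ.+ (2 ℕ.* q ℕ.+ l) → coefficient₁ n q l r s m ≡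
  ((p ℕ.+ q) C q) ℕ.* multichoose q l ℕ.* (q C r) ℕ.* (l C s) ℕ.* ((p ℕ.+ 2 ℕ.* r ℕ.+ s) C m)
coefficient₁≡ n p q l r s m ≡.refl = ≡.trans
  (≡.cong₂ ℕ._*_ (≡.cong₂ ℕ._*_
    (≡.trans (≡.cong (λ N → multinomial N (+ q ℤ.- + r ∷ + r ∷ [])) (n-q-l≡p+q (+ p) (+ q) (+ l)))
             (multinomial₂ (p ℕ.+ q) q r))
    (multinomial-multichoose₂ q l s))
    (≡.trans (≡.cong (λ N → multinomial N (+ m ∷ [])) (top (+ p) (+ q) (+ l) (+ r) (+ s)))
             (multinomial₁ (p ℕ.+ 2 ℕ.* r ℕ.+ s) m)))
  (regroup₅ ((p ℕ.+ q) C q) (q C r) (multichoose q l) (l C s) _)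
  where
  top : ∀ p q l r s → p ℤ.+ (q ℤ.+ (q ℤ.+ + 0) ℤ.+ l) ℤ.+ + 2 ℤ.* r ℤ.+ s ℤ.- + 2 ℤ.* q ℤ.- l ≡
        p ℤ.+ (r ℤ.+ (r ℤ.+ + 0)) ℤ.+ s
  top = ℤ-solve-∀

coefficient₂≡ : ∀ n p q l r s m → n ≡ p ℕ.+ (2 ℕ.* q ℕ.+ l) → coefficient₂ n q l r s m ≡
  ((p ℕ.+ q) C q) ℕ.* multichoose q l ℕ.* (q C r) ℕ.* (p C s) ℕ.* ((l ℕ.+ 2 ℕ.* r ℕ.+ s) C m)
coefficient₂≡ n p q l r s m ≡.refl = ≡.trans
  (≡.cong₂ ℕ._*_ (≡.cong₂ ℕ._*_
    (≡.trans (≡.cong (λ N → multinomial N (+ q ℤ.- + r ∷ + r ∷ + s ∷ [])) (n-q-l≡p+q (+ p) (+ q) (+ l)))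
             (multinomial₃ p q r s))
    (multinomial-multichoose₁ q l))
    (≡.trans (≡.cong (λ N → multinomial N (+ m ∷ [])) (top (+ l) (+ r) (+ s)))
             (multinomial₁ (l ℕ.+ 2 ℕ.* r ℕ.+ s) m)))
  (regroup₅′ ((p ℕ.+ q) C q) (q C r) (p C s) (multichoose q l) _)
  where
  top : ∀ l r s → + 2 ℤ.* r ℤ.+ s ℤ.+ l ≡ l ℤ.+ (r ℤ.+ (r ℤ.+ + 0)) ℤ.+ s
  top = ℤ-solve-∀

module ExplicitFormulas (K : DecidableField c ℓ) where
  open DecidableField K hiding (zero)

  module Formulas
    (a x P Q S : Carrier) (a≉0 : ¬ a ≈ 0#) (x≉0 : ¬ x ≈ 0#)
    (P≈ : P ≈ (1# + x) * (a ⁻¹) ^ 2)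
    (Q≈ : Q ≈ (1# + (1# + x) ^ 2 * (a ⁻¹) ^ 4) * x ⁻¹)
    (S≈ : S ≈ (1# + (1# + x) * (a ⁻¹) ^ 4) * a ^ 2 * x ⁻¹)
    where
    open FieldProperties K
    open Sums K using (IsSum)
    open Exp commutativeSemiring using (^-congˡ; ^-homo-*; ^-assocʳ; ^-distrib-*)
    open import Algebra.Solver.Ring.NaturalCoefficients.Default commutativeSemiring
      using (solve; _:=_; _:*_)
    open SetoidReasoning setoid

    private
      i j R : Carrier
      i = a ⁻¹
      j = x ⁻¹
      R = i ^ 4

      G : ℕ → ℕ → ℕ → Carrier
      G p q l = a ^ suc (2 ℕ.* l) * i ^ (2 ℕ.* p) * j ^ (q ℕ.+ l)

      U V W : Carrier
      U = 1# + x
      V = 1# + U ^ 2 * R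
      W = 1# + U * R

      cell : ∀ p q l → G p q l * (U ^ p * V ^ q * W ^ l) ≈ a * (P ^ p * Q ^ q * S ^ l)
      cell p q l = begin
        a * a ^ (2 ℕ.* l) * i ^ (2 ℕ.* p) * j ^ (q ℕ.+ l) * (U ^ p * V ^ q * W ^ l)
          ≈⟨ *-congʳ (*-cong (*-cong (*-congˡ (sym (^-assocʳ a 2 l))) (sym (^-assocʳ i 2 p))) (^-homo-* j q l)) ⟩
        a * (a ^ 2) ^ l * (i ^ 2) ^ p * (j ^ q * j ^ l) * (U ^ p * V ^ q * W ^ l)
          ≈⟨ solve 8 (λ a al ip jq jl up vq wl →
               a :* al :* ip :* (jq :* jl) :* (up :* vq :* wl) :=
               a :* ((up :* ip) :* (vq :* jq) :* ((wl :* al) :* jl)))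
               refl a ((a ^ 2) ^ l) ((i ^ 2) ^ p) (j ^ q) (j ^ l) (U ^ p) (V ^ q) (W ^ l) ⟩
        a * ((U ^ p * (i ^ 2) ^ p) * (V ^ q * j ^ q) * (W ^ l * (a ^ 2) ^ l * j ^ l))
          ≈⟨ *-congˡ (*-cong (*-cong (^-distrib-* U (i ^ 2) p) (^-distrib-* V j q))
               (trans (^-distrib-* (W * a ^ 2) j l) (*-congʳ (^-distrib-* W (a ^ 2) l)))) ⟨
        a * ((U * i ^ 2) ^ p * (V * j) ^ q * (W * a ^ 2 * j) ^ l)
          ≈⟨ *-congˡ (*-cong (*-cong (^-congˡ p P≈) (^-congˡ q Q≈)) (^-congˡ l S≈)) ⟨
        a * (P ^ p * Q ^ q * S ^ l) ∎

      power : ∀ p q l r s m {A X} →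
        A ≡ + suc (2 ℕ.* l) ℤ.- + (2 ℕ.* p ℕ.+ (4 ℕ.* r ℕ.+ 4 ℕ.* s)) → X ≡ + m ℤ.- + (q ℕ.+ l) →
        a ^ᶻ A * x ^ᶻ X ≈ G p q l * (R ^ r * R ^ s) * x ^ m
      power p q l r s m {A} {X} A≡ X≡ = begin
        a ^ᶻ A * x ^ᶻ X
          ≡⟨ ≡.cong₂ (λ A X → a ^ᶻ A * x ^ᶻ X) (≡.trans A≡ (ℤ.m-n≡m⊖n A⁺ A⁻)) (≡.trans X≡ (ℤ.m-n≡m⊖n m (q ℕ.+ l))) ⟩
        a ^ᶻ (A⁺ ℤ.⊖ A⁻) * x ^ᶻ (m ℤ.⊖ (q ℕ.+ l))
          ≈⟨ *-cong (x^m*x⁻¹^n a≉0 A⁺ A⁻) (x^m*x⁻¹^n x≉0 m (q ℕ.+ l)) ⟨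
        (a ^ A⁺ * i ^ A⁻) * (x ^ m * j ^ (q ℕ.+ l))
          ≈⟨ *-congʳ (*-congˡ (trans (^-homo-* i (2 ℕ.* p) _) (*-congˡ (trans (^-homo-* i (4 ℕ.* r) (4 ℕ.* s))
               (*-cong (sym (^-assocʳ i 4 r)) (sym (^-assocʳ i 4 s))))))) ⟩
        (a ^ A⁺ * (i ^ (2 ℕ.* p) * (R ^ r * R ^ s))) * (x ^ m * j ^ (q ℕ.+ l))
          ≈⟨ solve 5 (λ a i R x j → (a :* (i :* R)) :* (x :* j) := a :* i :* j :* R :* x) refl _ _ _ _ _ ⟩
        G p q l * (R ^ r * R ^ s) * x ^ m ∎
        where
        A⁺ A⁻ : ℕ
        A⁺ = suc (2 ℕ.* l)
        A⁻ = 2 ℕ.* p ℕ.+ (4 ℕ.* r ℕ.+ 4 ℕ.* s)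

    formula₁ : ∀ n {T} → T ≈ a * Transfer.A commutativeSemiring P Q S n →
      IsSum {ℕ × ℕ × ℕ × ℕ × ℕ}
        (λ (q , l , r , s , m) → coefficient₁ n q l r s m •
          ( a ^ᶻ (+ 1 ℤ.+ + 4 ℤ.* (+ q ℤ.+ + l) ℤ.- + 2 ℤ.* + n ℤ.- + 4 ℤ.* (+ r ℤ.+ + s))
          * x ^ᶻ (+ m ℤ.- + q ℤ.- + l))) T
    formula₁ n = Expansions.Expansion.expansion K P Q S a R x (λ p l → l) (λ p l → p) (λ p l → ≡.refl) G cell n
      (coefficient₁ n) _ (coefficient₁-vanishes n) (coefficient₁≡ n) λ where
        p q l r s m ≡.refl → power p q l r s m (a-exponent (+ p) (+ q) (+ l) (+ r) (+ s)) (x-exponent (+ q) (+ l) (+ m))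
      where
      a-exponent : ∀ p q l r s →
        + 1 ℤ.+ + 4 ℤ.* (q ℤ.+ l) ℤ.- + 2 ℤ.* (p ℤ.+ (q ℤ.+ (q ℤ.+ + 0) ℤ.+ l)) ℤ.- + 4 ℤ.* (r ℤ.+ s) ≡
        + 1 ℤ.+ (l ℤ.+ (l ℤ.+ + 0)) ℤ.-
          (p ℤ.+ (p ℤ.+ + 0) ℤ.+ (r ℤ.+ (r ℤ.+ (r ℤ.+ (r ℤ.+ + 0))) ℤ.+ (s ℤ.+ (s ℤ.+ (s ℤ.+ (s ℤ.+ + 0))))))
      a-exponent = ℤ-solve-∀

      x-exponent : ∀ q l m → m ℤ.- q ℤ.- l ≡ m ℤ.- (q ℤ.+ l)
      x-exponent = ℤ-solve-∀

    formula₂ : ∀ n {T} → T ≈ a * Transfer.A commutativeSemiring S Q P n →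
      IsSum {ℕ × ℕ × ℕ × ℕ × ℕ}
        (λ (q , l , r , s , m) → coefficient₂ n q l r s m •
          ( a ^ᶻ (+ 1 ℤ.+ + 2 ℤ.* + n ℤ.- + 4 ℤ.* (+ q ℤ.+ + l ℤ.+ + r ℤ.+ + s))
          * x ^ᶻ (+ q ℤ.+ + l ℤ.+ + m ℤ.- + n))) T
    formula₂ n = Expansions.Expansion.expansion K S Q P a R x (λ p l → p) (λ p l → l) (λ p l → ℕ.+-comm l p)
      (λ p q l → G l q p)
      (λ p q l → trans (cell l q p) (*-congˡ (solve 3 (λ a b c → a :* b :* c := c :* b :* a) refl _ _ _))) n
      (coefficient₂ n) _ (coefficient₂-vanishes n) (coefficient₂≡ n) λ where
        p q l r s m ≡.refl → power l q p r s m (a-exponent (+ p) (+ q) (+ l) (+ r) (+ s)) (x-exponent (+ p) (+ q) (+ l) (+ m))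
      where
      a-exponent : ∀ p q l r s →
        + 1 ℤ.+ + 2 ℤ.* (p ℤ.+ (q ℤ.+ (q ℤ.+ + 0) ℤ.+ l)) ℤ.- + 4 ℤ.* (q ℤ.+ l ℤ.+ r ℤ.+ s) ≡
        + 1 ℤ.+ (p ℤ.+ (p ℤ.+ + 0)) ℤ.-
          (l ℤ.+ (l ℤ.+ + 0) ℤ.+ (r ℤ.+ (r ℤ.+ (r ℤ.+ (r ℤ.+ + 0))) ℤ.+ (s ℤ.+ (s ℤ.+ (s ℤ.+ (s ℤ.+ + 0))))))
      a-exponent = ℤ-solve-∀

      x-exponent : ∀ p q l m → q ℤ.+ l ℤ.+ m ℤ.- (p ℤ.+ (q ℤ.+ (q ℤ.+ + 0) ℤ.+ l)) ≡ m ℤ.- (q ℤ.+ p)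
      x-exponent = ℤ-solve-∀

record Augmentation (D : DecidableDomain c ℓ) : Set (c ⊔ ℓ) where
  open DecidableDomain D
  field
    ε        : Carrier → ℤ
    ε-cong   : ∀ {x y} → x ≈ y → ε x ≡ ε y
    ε-homo-0 : ε 0# ≡ + 0
    ε-homo-1 : ε 1# ≡ + 1
    ε-homo-+ : ∀ x y → ε (x + y) ≡ ε x ℤ.+ ε y
    ε-homo-* : ∀ x y → ε (x * y) ≡ ε x ℤ.* ε y

ℤ-augmentation : Augmentation ℤ-domain
ℤ-augmentation = record
  { ε = λ x → x ; ε-cong = λ e → e ; ε-homo-0 = ≡.refl ; ε-homo-1 = ≡.refl
  ; ε-homo-+ = λ _ _ → ≡.refl ; ε-homo-* = λ _ _ → ≡.refl }

module EvaluationAt1 {D : DecidableDomain c ℓ} (aug : Augmentation D) where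
  open DecidableDomain D using (0#)
  open Augmentation aug
  open Polynomial D
  open ≡.≡-Reasoning

  sum-ε : Poly → ℤ
  sum-ε = List.foldr (λ a s → ε a ℤ.+ s) (+ 0)

  sum-ε-0 : ∀ p → p ≈ₚ [] → sum-ε p ≡ + 0
  sum-ε-0 []      _ = ≡.refl
  sum-ε-0 (a ∷ p) e = ≡.cong₂ ℤ._+_ (≡.trans (ε-cong (at e 0)) ε-homo-0) (sum-ε-0 p (0∷0-tail e))

  sum-ε-cong : ∀ p q → p ≈ₚ q → sum-ε p ≡ sum-ε q
  sum-ε-cong []      q       e = ≡.sym (sum-ε-0 q (≈ₚ-sym e))
  sum-ε-cong (a ∷ p) []      e = sum-ε-0 (a ∷ p) e
  sum-ε-cong (a ∷ p) (b ∷ q) e = ≡.cong₂ ℤ._+_ (ε-cong (at e 0)) (sum-ε-cong p q (∷-tail e))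

  sum-ε-+ : ∀ p q → sum-ε (p +ₚ q) ≡ sum-ε p ℤ.+ sum-ε q
  sum-ε-+ []      q       = ≡.sym (ℤ.+-identityˡ _)
  sum-ε-+ (a ∷ p) []      = ≡.sym (ℤ.+-identityʳ _)
  sum-ε-+ (a ∷ p) (b ∷ q) = ≡.trans (≡.cong₂ ℤ._+_ (ε-homo-+ a b) (sum-ε-+ p q))
                                    (ℤ-interchange (ε a) (ε b) (sum-ε p) (sum-ε q))

  sum-ε-· : ∀ a p → sum-ε (a ·ₚ p) ≡ ε a ℤ.* sum-ε p
  sum-ε-· a []      = ≡.sym (ℤ.*-zeroʳ (ε a))
  sum-ε-· a (b ∷ p) = ≡.trans (≡.cong₂ ℤ._+_ (ε-homo-* a b) (sum-ε-· a p))
                              (≡.sym (ℤ.*-distribˡ-+ (ε a) (ε b) (sum-ε p)))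

  sum-ε-* : ∀ p q → sum-ε (p *ₚ q) ≡ sum-ε p ℤ.* sum-ε q
  sum-ε-* []      q = ≡.refl
  sum-ε-* (a ∷ p) q = begin
    sum-ε (a ·ₚ q +ₚ (0# ∷ p *ₚ q))               ≡⟨ sum-ε-+ (a ·ₚ q) _ ⟩
    sum-ε (a ·ₚ q) ℤ.+ (ε 0# ℤ.+ sum-ε (p *ₚ q))
      ≡⟨ ≡.cong₂ ℤ._+_ (sum-ε-· a q)
           (≡.trans (≡.cong₂ ℤ._+_ ε-homo-0 (sum-ε-* p q)) (ℤ.+-identityˡ _)) ⟩
    ε a ℤ.* sum-ε q ℤ.+ sum-ε p ℤ.* sum-ε q       ≡⟨ ℤ.*-distribʳ-+ (sum-ε q) (ε a) (sum-ε p) ⟨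
    (ε a ℤ.+ sum-ε p) ℤ.* sum-ε q                 ∎

  augmentation : Augmentation domain
  augmentation = record
    { ε = sum-ε ; ε-cong = λ {p} {q} → sum-ε-cong p q ; ε-homo-0 = ≡.refl
    ; ε-homo-1 = ≡.trans (ℤ.+-identityʳ _) ε-homo-1 ; ε-homo-+ = sum-ε-+ ; ε-homo-* = sum-ε-* }

-- Quotients of elements with positive augmentation.  All xₙ lie in this cone, which avoids 0.
module Cone {D : DecidableDomain c ℓ} (aug : Augmentation D) where
  open DecidableDomain D using (Carrier)
  private module D = DecidableDomain D
  open Augmentation aug
  open Fractions D hiding (*-cancelˡ)
  private module K = DecidableField field′
  open FieldProperties field′ using (*-cancelˡ)
  open import Algebra.Solver.Ring.NaturalCoefficients.Default D.commutativeSemiring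

  ε>0 : Carrier → Set
  ε>0 p = ∃[ n ] ε p ≡ + suc n

  ε>0⇒≉0 : ∀ {p} → ε>0 p → ¬ p D.≈ D.0#
  ε>0⇒≉0 (n , e) p≈0 with () ← ≡.trans (≡.sym e) (≡.trans (ε-cong p≈0) ε-homo-0)

  +-ε>0 : ∀ {p q} → ε>0 p → ε>0 q → ε>0 (p D.+ q)
  +-ε>0 {p} {q} (m , e) (n , f) = _ , ≡.trans (ε-homo-+ p q) (≡.cong₂ ℤ._+_ e f)

  *-ε>0 : ∀ {p q} → ε>0 p → ε>0 q → ε>0 (p D.* q)
  *-ε>0 {p} {q} (m , e) (n , f) = _ , ≡.trans (ε-homo-* p q) (≡.cong₂ ℤ._*_ e f)

  record InCone (u : Frac) : Set (c ⊔ ℓ) where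
    constructor inCone
    field
      {p q} : Carrier
      p>0   : ε>0 p
      q>0   : ε>0 q
      u≈p/q : u ≈ᶠ frac p q (ε>0⇒≉0 q>0)

  cone-resp : ∀ {u v} → u ≈ᶠ v → InCone v → InCone u
  cone-resp e (inCone p>0 q>0 f) = inCone p>0 q>0 (≈ᶠ-trans e f)

  embed-cone : ∀ {p} → ε>0 p → InCone (embed p)
  embed-cone p>0 = inCone p>0 (0 , ε-homo-1) (mk≈ D.refl)

  1-cone : InCone 1ᶠ
  1-cone = embed-cone (0 , ε-homo-1)

  cone⇒≉0 : ∀ {u} → InCone u → ¬ u ≈ᶠ 0ᶠ
  cone⇒≉0 (inCone p>0 q>0 e) u≈0 = ε>0⇒≉0 p>0 (≈0⇒num≈0 (≈ᶠ-trans (≈ᶠ-sym e) u≈0))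

  +-cone : ∀ {u v} → InCone u → InCone v → InCone (u +ᶠ v)
  +-cone (inCone p>0 q>0 e) (inCone r>0 s>0 f) =
    inCone (+-ε>0 (*-ε>0 p>0 s>0) (*-ε>0 r>0 q>0)) (*-ε>0 q>0 s>0) (≈ᶠ-trans (+ᶠ-cong e f) (mk≈ D.refl))

  *-cone : ∀ {u v} → InCone u → InCone v → InCone (u *ᶠ v)
  *-cone (inCone p>0 q>0 e) (inCone r>0 s>0 f) =
    inCone (*-ε>0 p>0 r>0) (*-ε>0 q>0 s>0) (≈ᶠ-trans (*ᶠ-cong e f) (mk≈ D.refl))

  divide-cone : ∀ {u v w} → InCone u → v *ᶠ u ≈ᶠ w → InCone w → InCone v
  divide-cone {u} {v} {w} u⁺@(inCone {p} {q} p>0 q>0 e) vu≈w (inCone {r} {s} r>0 s>0 f) =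
    inCone rq>0 sp>0 (*-cancelˡ (cone⇒≉0 u⁺)
      (≈ᶠ-trans (*ᶠ-comm u v) (≈ᶠ-trans vu≈w (≈ᶠ-trans f (≈ᶠ-trans
        (mk≈ (solve 4 (λ p q r s → r :* (q :* (s :* p)) := p :* (r :* q) :* s) D.refl p q r s))
        (*ᶠ-cong {v = v′} {v′ = v′} (≈ᶠ-sym e) (mk≈ D.refl)))))))
    where
    v′ : Frac
    rq>0 : ε>0 (r D.* q)
    rq>0 = *-ε>0 r>0 q>0
    sp>0 : ε>0 (s D.* p)
    sp>0 = *-ε>0 s>0 p>0
    v′ = frac (r D.* q) (s D.* p) (ε>0⇒≉0 sp>0)

open import Defs

module NonVanishing {x : ℤ → Carrier} (isCluster : IsClusterSequence x) where
  open IsClusterSequence isCluster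
  open ClusterSequences.ClusterSequence ℚ⟨X₀,X₁⟩ x even odd using (z; w; z-recurrence; w-recurrence)
  open Cone (EvaluationAt1.augmentation (EvaluationAt1.augmentation ℤ-augmentation))

  zw∈cone : ∀ n → InCone (z n) × InCone (w n)
  zw∈cone zero    = cone-resp x₀≈X₀ (embed-cone (0 , ≡.refl)) , cone-resp x₁≈X₁ (embed-cone (0 , ≡.refl))
  zw∈cone (suc n) = z⁺ , divide-cone w⁺ (w-recurrence n) (+-cone 1-cone
      (*-cone z⁺ (*-cone z⁺ (*-cone z⁺ (*-cone z⁺ 1-cone)))))
    where
    w⁺ : InCone (w n)
    w⁺ = proj₂ (zw∈cone n)
    z⁺ : InCone (z (suc n))
    z⁺ = divide-cone (proj₁ (zw∈cone n)) (z-recurrence n) (+-cone 1-cone w⁺)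

  z≉0 : ∀ n → ¬ z n ≈ 0#
  z≉0 n = cone⇒≉0 (proj₁ (zw∈cone n))

  w≉0 : ∀ n → ¬ w n ≈ 0#
  w≉0 n = cone⇒≉0 (proj₂ (zw∈cone n))

mainTheorem2 :
  ∀ (x : ℤ → Carrier) → IsClusterSequence x →
  let
    x₀ = x (+ 0)
    x₁ = x (+ 1)
    x₂ = x (+ 2)

    y⁰₁ = (1# + x₁) ÷ x₀ ^ 2
    y⁰₂ = (x₀ ^ 4 + (1# + x₁) ^ 2) ÷ (x₀ ^ 4 * x₁)
    y⁰₃ = (x₀ ^ 4 + 1# + x₁) ÷ (x₀ ^ 2 * x₁)

    y¹₁ = (x₂ ^ 4 + 1# + x₁) ÷ (x₂ ^ 2 * x₁)
    y¹₂ = (x₂ ^ 4 + (1# + x₁) ^ 2) ÷ (x₂ ^ 4 * x₁)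
    y¹₃ = (1# + x₁) ÷ x₂ ^ 2
  in
    ( ((λ n → x (+ (2 *ℕ n))) ≈ˢ continuedFraction x₀ y⁰₁ y⁰₂ y⁰₃)
    × ((λ n → x (+ (2 *ℕ n +ℕ 2))) ≈ˢ continuedFraction x₂ y¹₁ y¹₂ y¹₃)
    )
  × (∀ (n : ℕ) →
      IsSum {ℕ × ℕ × ℕ × ℕ × ℕ}
        (λ (q , ℓ , r , s , m) →
          ( multinomial (+ n -ℤ + q -ℤ + ℓ) (+ q -ℤ + r ∷ + r ∷ [])
          *ℕ multinomial (+ q +ℤ + ℓ -ℤ + 1) (+ ℓ -ℤ + s ∷ + s ∷ [])
          *ℕ multinomial (+ n +ℤ + 2 *ℤ + r +ℤ + s -ℤ + 2 *ℤ + q -ℤ + ℓ) (+ m ∷ []))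
          • ( x₀ ^ᶻ (+ 1 +ℤ + 4 *ℤ (+ q +ℤ + ℓ) -ℤ + 2 *ℤ + n -ℤ + 4 *ℤ (+ r +ℤ + s))
            * x₁ ^ᶻ (+ m -ℤ + q -ℤ + ℓ)))
        (x (+ (2 *ℕ n)))
    × IsSum {ℕ × ℕ × ℕ × ℕ × ℕ}
        (λ (q , ℓ , r , s , m) →
          ( multinomial (+ n -ℤ + q -ℤ + ℓ) (+ q -ℤ + r ∷ + r ∷ + s ∷ [])
          *ℕ multinomial (+ q +ℤ + ℓ -ℤ + 1) (+ ℓ ∷ [])
          *ℕ multinomial (+ 2 *ℤ + r +ℤ + s +ℤ + ℓ) (+ m ∷ []))
          • ( x₂ ^ᶻ (+ 1 +ℤ + 2 *ℤ + n -ℤ + 4 *ℤ (+ q +ℤ + ℓ +ℤ + r +ℤ + s))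
            * x₁ ^ᶻ (+ q +ℤ + ℓ +ℤ + m -ℤ + n)))
        (x (+ (2 *ℕ n +ℕ 2)))
    )
  × (∀ (n : ℕ) →
      x (+ (2 *ℕ n +ℕ 1)) ≈ x (+ (2 *ℕ n)) * x (+ (2 *ℕ n +ℕ 2)) - 1#
    × IsPositiveLaurentIn x₀ x₁ (x (+ (2 *ℕ n +ℕ 1)))
    × IsPositiveLaurentIn x₁ x₂ (x (+ (2 *ℕ n +ℕ 1)))
    )
mainTheorem2 x isCluster =
    (Orbit₀.continuedFraction , λ n → trans (x[2n+2]≈z n) (Orbit₂.continuedFraction n))
  , (λ n → ExplicitFormulas.Formulas.formula₁ ℚ⟨X₀,X₁⟩ x₀ x₁ F₀.p F₀.q F₀.s (z≉0 0) (w≉0 0) F₀.p≈ F₀.q≈ F₀.s≈ n (Orbit₀.z≈aA n)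
         , ExplicitFormulas.Formulas.formula₂ ℚ⟨X₀,X₁⟩ x₂ x₁ F₂.p F₂.q F₂.s (z≉0 1) (w≉0 0) F₂.p≈ F₂.q≈ F₂.s≈ n
             (trans (x[2n+2]≈z n) (Orbit₂.z≈aA n)))
  , λ n → w≈zz-1 n , w-positive₀ n , w-positive₂ n
  where
  open IsClusterSequence isCluster
  open NonVanishing isCluster
  module Sequence = ClusterSequences.ClusterSequence ℚ⟨X₀,X₁⟩ x even odd
  open Sequence using (z)
  module Solved = Sequence.Solution z≉0 w≉0
  open Solved
  open DecidableField ℚ⟨X₀,X₁⟩ using (trans; reflexive)

  x₀ x₁ x₂ : Carrier
  x₀ = x (+ 0)
  x₁ = x (+ 1)
  x₂ = x (+ 2)

  x[2n+2]≈z : ∀ n → x (+ (2 *ℕ n +ℕ 2)) ≈ z (suc n)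
  x[2n+2]≈z n = reflexive (≡.cong (λ k → x (+ k)) (≡.trans (ℕ.+-comm (2 *ℕ n) 2) (≡.sym (ℕ.*-suc 2 n))))
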